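{- The following problem is $\mathsf{PSPACE}$-hard: given a one-counter Markov decision process $\mathcal{A}$, a set $R$ of control locations of $\mathcal{A}$, and a vertex $s$ of the Markov decision process defined by $\mathcal{A}$, decide whether $s\in\mathrm{ValOne}(R)$.
   Context: Hardness is with respect to polynomial time many-one reductions. Markov decision processes. A Markov decision process (MDP) consists of a (countable) directed graph in which every vertex has at least one outgoing transition, whose vertex set is partitioned into nondeterministic and probabilistic vertices, together with, for each probabilistic vertex, a probability distribution on its outgoing transitions. A strategy $\sigma$ for the player Eve assigns to each finite path ending in a nondeterministic vertex $v$ a probability distribution on the outgoing transitions of $v$ (so it may depend on the whole past of the play and may be randomized). An MDP together with a strategy and an initial vertex defines a Markov chain on the unfolding of the graph, and hence a probability measure on infinite paths from the initial vertex. One-counter Markov decision processes (OC-MDPs). An OC-MDP $\mathcal{A}$ consists of a finite set $Q$ of control locations partitioned into nondeterministic locations $Q_N$ and probabilistic locations $Q_P$; zero transitions $\delta_0\subseteq Q\times\{0,1\}\times Q$ and positive transitions $\delta_{>0}\subseteq Q\times\{ -1,0,1\}\times Q$ such that each $q\in Q$ has at least one outgoing transition in each of $\delta_0$ and $\delta_{>0}$; and, for each $q\in Q_P$, positive rational probability distributions on the outgoing transitions of $q$ in $\delta_0$ and on those in $\delta_{>0}$. It defines the infinite MDP with vertex set $Q\times\mathbb{N}$ and transitions $(q,n)\to(q',n+j)$ iff either $n=0$ and $(q,j,q')\in\delta_0$, or $n>0$ and $(q,j,q')\in\delta_{>0}$; a vertex $(q,n)$ is nondeterministic iff $q\in Q_N$,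 and for $q\in Q_P$ the transitions of $(q,n)$ carry the probabilities of the corresponding transitions in $\delta_0$ (if $n=0$) or $\delta_{>0}$ (if $n>0$). In the input, a vertex is a pair $(q,n)$ with $n$ written in binary. $\mathrm{ValOne}(R)$. For $R\subseteq Q$, $\mathrm{ValOne}(R)$ is the set of all vertices $s$ of the MDP defined by $\mathcal{A}$ such that for every $\varepsilon>0$ there exists a strategy $\sigma$ for Eve under which the probability of eventually reaching from $s$ a vertex $(r,0)$ with $r\in R$ (i.e., a control location in $R$ and at the same time counter value $0$) is at least $1-\varepsilon$. -}

module Defs where

open import Data.Bool using (Bool; true; false; if_then_else_; _∨_; T)
open import Data.Fin using (Fin; zero; suc; toℕ; fromℕ)
open import Data.Fin.Subset using (Subset)
open import Data.Integer using (∣_∣)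
open import Data.List using (List; []; _∷_; _++_; length; concat; lookup; map; replicate; tabulate)
open import Data.List.Relation.Unary.Unique.Propositional using (Unique)
open import Data.Maybe using (Maybe; just; nothing)
open import Data.Nat as ℕ using (ℕ; zero; suc)
import Data.Nat.Properties as ℕ
open import Data.Nat.Binary using (ℕᵇ; 2[1+_]; 1+[2_])
import Data.Nat.Binary as ℕᵇ
open import Data.Product using (_×_; _,_; ∃; proj₁; proj₂)
open import Data.Rational as ℚ using (ℚ; 0ℚ; 1ℚ; ½; ↥_; ↧ₙ_; 1/_)
import Data.Rational.Properties as ℚ
open import Data.Rational.Solver using (module +-*-Solver)
open import Data.Vec using (Vec; []; _∷_)
import Data.Vec as Vec
import Data.Vec.Functional as Vector
open import Function using (_∘_; _⇔_)
open import Relation.Binary.PropositionalEquality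
  using (_≡_; refl; sym; trans; cong; subst)

-- Reals are Cauchy sequences of rationals; their equality is _≃_.

IsCauchy : (ℕ → ℚ) → Set
IsCauchy x = ∀ ε → 0ℚ ℚ.< ε →
  ∃ λ N → ∀ m n → N ℕ.≤ m → N ℕ.≤ n → ℚ.∣ x m ℚ.- x n ∣ ℚ.≤ ε

record ℝ : Set where
  no-eta-equality
  constructor mkℝ
  field
    seq    : ℕ → ℚ
    cauchy : IsCauchy seq

open ℝ public

infix 4 _≤ᴿ_ _≃_
infixl 6 _+ᴿ_
infixl 7 _*ᴿ_

_≤ᴿ_ : ℝ → ℝ → Set
x ≤ᴿ y = ∀ ε → 0ℚ ℚ.< ε → ∃ λ N → ∀ n → N ℕ.≤ n → seq x n ℚ.≤ seq y n ℚ.+ ε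

_≃_ : ℝ → ℝ → Set
x ≃ y = x ≤ᴿ y × y ≤ᴿ x

private
  half-pos : ∀ {ε} → 0ℚ ℚ.< ε → 0ℚ ℚ.< ½ ℚ.* ε
  half-pos {ε} 0<ε = ℚ.positive⁻¹ (½ ℚ.* ε) {{ℚ.pos*pos⇒pos ½ ε {{ℚ.positive 0<ε}}}}

  half+half : ∀ ε → ½ ℚ.* ε ℚ.+ ½ ℚ.* ε ≡ ε
  half+half ε = trans (sym (ℚ.*-distribʳ-+ ε ½ ½)) (ℚ.*-identityˡ ε)

  swap-sums : ∀ a b c d → (a ℚ.+ b) ℚ.- (c ℚ.+ d) ≡ (a ℚ.- c) ℚ.+ (b ℚ.- d)
  swap-sums = solve 4
    (λ a b c d → (a :+ b) :- (c :+ d) := (a :- c) :+ (b :- d)) refl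
    where open +-*-Solver

  split-products : ∀ a b c d →
    a ℚ.* b ℚ.- c ℚ.* d ≡ a ℚ.* (b ℚ.- d) ℚ.+ d ℚ.* (a ℚ.- c)
  split-products = solve 4
    (λ a b c d → a :* b :- c :* d := a :* (b :- d) :+ d :* (a :- c)) refl
    where open +-*-Solver

  detour : ∀ a b → a ≡ b ℚ.+ (a ℚ.- b)
  detour = solve 2 (λ a b → a := b :+ (a :- b)) refl
    where open +-*-Solver

  ∣∣-*-mono : ∀ p q r s → ℚ.∣ p ∣ ℚ.≤ r → ℚ.∣ q ∣ ℚ.≤ s → ℚ.∣ p ℚ.* q ∣ ℚ.≤ r ℚ.* s
  ∣∣-*-mono p q r s p≤r q≤s = begin
    ℚ.∣ p ℚ.* q ∣        ≡⟨ ℚ.∣p*q∣≡∣p∣*∣q∣ p q ⟩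
    ℚ.∣ p ∣ ℚ.* ℚ.∣ q ∣  ≤⟨ ℚ.*-monoʳ-≤-nonNeg ℚ.∣ q ∣ {{ℚ.∣-∣-nonNeg q}} p≤r ⟩
    r ℚ.* ℚ.∣ q ∣        ≤⟨ ℚ.*-monoˡ-≤-nonNeg r {{ℚ.nonNegative (ℚ.≤-trans (ℚ.0≤∣p∣ p) p≤r)}} q≤s ⟩
    r ℚ.* s              ∎
    where open ℚ.≤-Reasoning

  eventually-bounded : ∀ x → IsCauchy x →
    ∃ λ B → 0ℚ ℚ.< B × ∃ λ N → ∀ n → N ℕ.≤ n → ℚ.∣ x n ∣ ℚ.≤ B
  eventually-bounded x c with c 1ℚ (ℚ.positive⁻¹ 1ℚ)
  ... | N , close = B , 0<B , N , bound
    where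
    B : ℚ
    B = ℚ.∣ x N ∣ ℚ.+ 1ℚ
    0<B : 0ℚ ℚ.< B
    0<B = ℚ.+-mono-≤-< (ℚ.0≤∣p∣ (x N)) (ℚ.positive⁻¹ 1ℚ)
    bound : ∀ n → N ℕ.≤ n → ℚ.∣ x n ∣ ℚ.≤ B
    bound n N≤n = begin
      ℚ.∣ x n ∣                           ≡⟨ cong ℚ.∣_∣ (detour (x n) (x N)) ⟩
      ℚ.∣ x N ℚ.+ (x n ℚ.- x N) ∣         ≤⟨ ℚ.∣p+q∣≤∣p∣+∣q∣ (x N) (x n ℚ.- x N) ⟩
      ℚ.∣ x N ∣ ℚ.+ ℚ.∣ x n ℚ.- x N ∣     ≤⟨ ℚ.+-monoʳ-≤ ℚ.∣ x N ∣ (close n N N≤n ℕ.≤-refl) ⟩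
      B                                   ∎
      where open ℚ.≤-Reasoning

  share : ∀ S ε → 0ℚ ℚ.< S → 0ℚ ℚ.< ε → ∃ λ δ → 0ℚ ℚ.< δ × S ℚ.* δ ≡ ε
  share S ε 0<S 0<ε = δ , 0<δ , Sδ≡ε
    where
    instance
      S-pos : ℚ.Positive S
      S-pos = ℚ.positive 0<S
      S-nonZero : ℚ.NonZero S
      S-nonZero = ℚ.pos⇒nonZero S
    δ : ℚ
    δ = (1/ S) ℚ.* ε
    0<δ : 0ℚ ℚ.< δ
    0<δ = ℚ.positive⁻¹ δ
      {{ℚ.pos*pos⇒pos (1/ S) {{ℚ.1/pos⇒pos S}} ε {{ℚ.positive 0<ε}}}}
    Sδ≡ε : S ℚ.* δ ≡ ε
    Sδ≡ε = trans (sym (ℚ.*-assoc S (1/ S) ε))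
      (trans (cong (ℚ._* ε) (ℚ.*-inverseʳ S)) (ℚ.*-identityˡ ε))

  *-close : ∀ (x y : ℕ → ℚ) B C N₁ N₂ →
    (∀ n → N₁ ℕ.≤ n → ℚ.∣ x n ∣ ℚ.≤ B) →
    (∀ n → N₂ ℕ.≤ n → ℚ.∣ y n ∣ ℚ.≤ C) →
    ∀ δ ε → (B ℚ.+ C) ℚ.* δ ≡ ε → ∀ N₃ N₄ →
    (∀ m n → N₃ ℕ.≤ m → N₃ ℕ.≤ n → ℚ.∣ x m ℚ.- x n ∣ ℚ.≤ δ) →
    (∀ m n → N₄ ℕ.≤ m → N₄ ℕ.≤ n → ℚ.∣ y m ℚ.- y n ∣ ℚ.≤ δ) →
    ∃ λ N → ∀ m n → N ℕ.≤ m → N ℕ.≤ n → ℚ.∣ x m ℚ.* y m ℚ.- x n ℚ.* y n ∣ ℚ.≤ ε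
  *-close x y B C N₁ N₂ boundˣ boundʸ δ ε Sδ≡ε N₃ N₄ closeˣ closeʸ = N , close
    where
    N : ℕ
    N = (N₁ ℕ.⊔ N₂) ℕ.⊔ (N₃ ℕ.⊔ N₄)
    module _ {n} (N≤n : N ℕ.≤ n) where
      12≤ : N₁ ℕ.⊔ N₂ ℕ.≤ n
      12≤ = ℕ.m⊔n≤o⇒m≤o (N₁ ℕ.⊔ N₂) (N₃ ℕ.⊔ N₄) N≤n
      34≤ : N₃ ℕ.⊔ N₄ ℕ.≤ n
      34≤ = ℕ.m⊔n≤o⇒n≤o (N₁ ℕ.⊔ N₂) (N₃ ℕ.⊔ N₄) N≤n
      1≤ : N₁ ℕ.≤ n
      1≤ = ℕ.m⊔n≤o⇒m≤o N₁ N₂ 12≤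
      2≤ : N₂ ℕ.≤ n
      2≤ = ℕ.m⊔n≤o⇒n≤o N₁ N₂ 12≤
      3≤ : N₃ ℕ.≤ n
      3≤ = ℕ.m⊔n≤o⇒m≤o N₃ N₄ 34≤
      4≤ : N₄ ℕ.≤ n
      4≤ = ℕ.m⊔n≤o⇒n≤o N₃ N₄ 34≤
    close : ∀ m n → N ℕ.≤ m → N ℕ.≤ n → ℚ.∣ x m ℚ.* y m ℚ.- x n ℚ.* y n ∣ ℚ.≤ ε
    close m n ≤m ≤n = begin
      ℚ.∣ x m ℚ.* y m ℚ.- x n ℚ.* y n ∣
        ≡⟨ cong ℚ.∣_∣ (split-products (x m) (y m) (x n) (y n)) ⟩
      ℚ.∣ x m ℚ.* (y m ℚ.- y n) ℚ.+ y n ℚ.* (x m ℚ.- x n) ∣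
        ≤⟨ ℚ.∣p+q∣≤∣p∣+∣q∣ (x m ℚ.* (y m ℚ.- y n)) (y n ℚ.* (x m ℚ.- x n)) ⟩
      ℚ.∣ x m ℚ.* (y m ℚ.- y n) ∣ ℚ.+ ℚ.∣ y n ℚ.* (x m ℚ.- x n) ∣
        ≤⟨ ℚ.+-mono-≤
             (∣∣-*-mono (x m) (y m ℚ.- y n) B δ (boundˣ m (1≤ ≤m)) (closeʸ m n (4≤ ≤m) (4≤ ≤n)))
             (∣∣-*-mono (y n) (x m ℚ.- x n) C δ (boundʸ n (2≤ ≤n)) (closeˣ m n (3≤ ≤m) (3≤ ≤n))) ⟩
      B ℚ.* δ ℚ.+ C ℚ.* δ
        ≡⟨ sym (ℚ.*-distribʳ-+ δ B C) ⟩
      (B ℚ.+ C) ℚ.* δ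
        ≡⟨ Sδ≡ε ⟩
      ε ∎
      where open ℚ.≤-Reasoning

-- Abstract, so that comparing two reals never unfolds these proofs.
private abstract
  const-cauchy : ∀ q → IsCauchy (λ _ → q)
  const-cauchy q ε 0<ε = 0 , λ _ _ _ _ →
    subst (λ d → ℚ.∣ d ∣ ℚ.≤ ε) (sym (ℚ.+-inverseʳ q)) (ℚ.<⇒≤ 0<ε)

  +-cauchy : ∀ x y → IsCauchy x → IsCauchy y → IsCauchy (λ n → x n ℚ.+ y n)
  +-cauchy x y cx cy ε 0<ε
    with cx (½ ℚ.* ε) (half-pos 0<ε) | cy (½ ℚ.* ε) (half-pos 0<ε)
  ... | N , closeˣ | M , closeʸ = N ℕ.⊔ M , close
    where
    close : ∀ m n → N ℕ.⊔ M ℕ.≤ m → N ℕ.⊔ M ℕ.≤ n →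
            ℚ.∣ (x m ℚ.+ y m) ℚ.- (x n ℚ.+ y n) ∣ ℚ.≤ ε
    close m n ≤m ≤n = begin
      ℚ.∣ (x m ℚ.+ y m) ℚ.- (x n ℚ.+ y n) ∣          ≡⟨ cong ℚ.∣_∣ (swap-sums (x m) (y m) (x n) (y n)) ⟩
      ℚ.∣ (x m ℚ.- x n) ℚ.+ (y m ℚ.- y n) ∣          ≤⟨ ℚ.∣p+q∣≤∣p∣+∣q∣ (x m ℚ.- x n) (y m ℚ.- y n) ⟩
      ℚ.∣ x m ℚ.- x n ∣ ℚ.+ ℚ.∣ y m ℚ.- y n ∣        ≤⟨ ℚ.+-mono-≤
                                                          (closeˣ m n (ℕ.m⊔n≤o⇒m≤o N M ≤m) (ℕ.m⊔n≤o⇒m≤o N M ≤n))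
                                                          (closeʸ m n (ℕ.m⊔n≤o⇒n≤o N M ≤m) (ℕ.m⊔n≤o⇒n≤o N M ≤n)) ⟩
      ½ ℚ.* ε ℚ.+ ½ ℚ.* ε                            ≡⟨ half+half ε ⟩
      ε                                              ∎
      where open ℚ.≤-Reasoning

  *-cauchy : ∀ x y → IsCauchy x → IsCauchy y → IsCauchy (λ n → x n ℚ.* y n)
  *-cauchy x y cx cy ε 0<ε =
    let (B , 0<B , N₁ , boundˣ) = eventually-bounded x cx
        (C , 0<C , N₂ , boundʸ) = eventually-bounded y cy
        (δ , 0<δ , Sδ≡ε)        = share (B ℚ.+ C) ε (ℚ.+-mono-<-≤ 0<B (ℚ.<⇒≤ 0<C)) 0<ε
        (N₃ , closeˣ)           = cx δ 0<δ
        (N₄ , closeʸ)           = cy δ 0<δ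
    in *-close x y B C N₁ N₂ boundˣ boundʸ δ ε Sδ≡ε N₃ N₄ closeˣ closeʸ

fromℚ : ℚ → ℝ
fromℚ q = mkℝ (λ _ → q) (const-cauchy q)

0ᴿ 1ᴿ : ℝ
0ᴿ = fromℚ 0ℚ
1ᴿ = fromℚ 1ℚ

_+ᴿ_ : ℝ → ℝ → ℝ
x +ᴿ y = mkℝ (λ n → seq x n ℚ.+ seq y n) (+-cauchy (seq x) (seq y) (cauchy x) (cauchy y))

_*ᴿ_ : ℝ → ℝ → ℝ
x *ᴿ y = mkℝ (λ n → seq x n ℚ.* seq y n) (*-cauchy (seq x) (seq y) (cauchy x) (cauchy y))

sumᴿ : ∀ {n} → (Fin n → ℝ) → ℝ
sumᴿ = Vector.foldr _+ᴿ_ 0ᴿ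

sumℚ : ∀ {n} → (Fin n → ℚ) → ℚ
sumℚ = Vector.foldr ℚ._+_ 0ℚ

record Distribution (n : ℕ) : Set where
  field
    weight   : Fin n → ℝ
    nonneg   : ∀ i → 0ᴿ ≤ᴿ weight i
    sum≃1    : sumᴿ weight ≃ 1ᴿ

open Distribution public

record PositiveRationalDistribution (n : ℕ) : Set where
  field
    weight   : Fin n → ℚ
    positive : ∀ i → 0ℚ ℚ.< weight i
    sum≡1    : sumℚ weight ≡ 1ℚ

module PRD = PositiveRationalDistribution

private
  seq-sum : ∀ {n} (w : Fin n → ℚ) k → seq (sumᴿ (fromℚ ∘ w)) k ≡ sumℚ w
  seq-sum {zero}  w k = refl
  seq-sum {suc n} w k = cong (w zero ℚ.+_) (seq-sum (w ∘ suc) k)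

  ≤+pos : ∀ {p q ε} → p ℚ.≤ q → 0ℚ ℚ.< ε → p ℚ.≤ q ℚ.+ ε
  ≤+pos {p} {q} {ε} p≤q 0<ε =
    subst (ℚ._≤ q ℚ.+ ε) (ℚ.+-identityʳ p)
      (ℚ.+-mono-≤ {p} {q} {0ℚ} {ε} p≤q (ℚ.<⇒≤ 0<ε))

toDistribution : ∀ {n} → PositiveRationalDistribution n → Distribution n
toDistribution D = record
  { weight = fromℚ ∘ PRD.weight D
  ; nonneg = λ i ε 0<ε → 0 , λ _ _ → ≤+pos (ℚ.<⇒≤ (PRD.positive D i)) 0<ε
  ; sum≃1  = (λ ε 0<ε → 0 , λ k _ → ≤+pos (ℚ.≤-reflexive (sum≡ k)) 0<ε)
           , (λ ε 0<ε → 0 , λ k _ → ≤+pos (ℚ.≤-reflexive (sym (sum≡ k))) 0<ε)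
  }
  where
  sum≡ : ∀ k → seq (sumᴿ (fromℚ ∘ PRD.weight D)) k ≡ 1ℚ
  sum≡ k = trans (seq-sum (PRD.weight D) k) (PRD.sum≡1 D)

-- Only finitely branching processes are needed: the outgoing transitions of v
-- are numbered by Fin (outdegree v).

data Kind : Set where
  nondeterministic probabilistic : Kind

record MDP : Set₁ where
  field
    Vertex      : Set
    kind        : Vertex → Kind
    outdegree   : Vertex → ℕ
    outdegree>0 : ∀ v → 0 ℕ.< outdegree v
    target      : ∀ v → Fin (outdegree v) → Vertex
    probability : ∀ v → kind v ≡ probabilistic → Distribution (outdegree v)

module _ (M : MDP) where
  open MDP M

  infixl 5 _▷_

  data Path (s : Vertex) : Vertex → Set where
    start : Path s s
    _▷_   : ∀ {v} → Path s v → (i : Fin (outdegree v)) → Path s (target v i)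

  Strategy : Set
  Strategy = ∀ {s v} → Path s v → kind v ≡ nondeterministic → Distribution (outdegree v)

module _ {M : MDP} where
  open MDP M

  visits : (Vertex → Bool) → ∀ {s v} → Path M s v → Bool
  visits R {v = v} start               = R v
  visits R (_▷_ {v} π i) = visits R π ∨ R (target v i)

  module _ (σ : Strategy M) where

    nextOfKind : ∀ {s v} → Path M s v → ∀ k → kind v ≡ k → Distribution (outdegree v)
    nextOfKind {v = v} π nondeterministic eq = σ π eq
    nextOfKind {v = v} π probabilistic    eq = probability v eq

    next : ∀ {s v} → Path M s v → Distribution (outdegree v)
    next {v = v} π = nextOfKind π (kind v) refl

    -- Given that the play begins with π, the probability that its prefix
    -- obtained from π by k further transitions satisfies E.
    Pr : ∀ (k : ℕ) {s v} → Path M s v → (∀ {w} → Path M s w → Bool) → ℝ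
    Pr zero    π E = if E π then 1ᴿ else 0ᴿ
    Pr (suc k) π E = sumᴿ λ i → weight (next π) i *ᴿ Pr k (π ▷ i) E

    PrReachWithin : ℕ → Vertex → (Vertex → Bool) → ℝ
    PrReachWithin k s R = Pr k (start {s = s}) (visits R)

    -- The probability of eventually reaching R is the supremum over k of
    -- PrReachWithin k s R (continuity of the measure along an increasing union
    -- of cylinder events).  Such a supremum need not exist constructively as a
    -- Cauchy real, so "it is at least c" is expressed through its
    -- approximations.
    PrReachAtLeast : Vertex → (Vertex → Bool) → ℚ → Set
    PrReachAtLeast s R c = ∀ δ → 0ℚ ℚ.< δ →
      ∃ λ k → fromℚ (c ℚ.- δ) ≤ᴿ PrReachWithin k s R

data ZeroChange : Set where
  stay inc : ZeroChange

data PositiveChange : Set where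
  dec stay inc : PositiveChange

-- The sets δ₀ and δ₊ are given, for each source location, as repetition-free
-- lists of pairs (change of the counter, target location).
record OCMDP : Set where
  field
    size : ℕ

  Location : Set
  Location = Fin size

  field
    owner     : Location → Kind
    δ₀        : Location → List (ZeroChange × Location)
    δ₊        : Location → List (PositiveChange × Location)
    δ₀-unique : ∀ q → Unique (δ₀ q)
    δ₊-unique : ∀ q → Unique (δ₊ q)
    δ₀-total  : ∀ q → 0 ℕ.< length (δ₀ q)
    δ₊-total  : ∀ q → 0 ℕ.< length (δ₊ q)
    P₀        : ∀ q → owner q ≡ probabilistic → PositiveRationalDistribution (length (δ₀ q))
    P₊        : ∀ q → owner q ≡ probabilistic → PositiveRationalDistribution (length (δ₊ q))

module _ (A : OCMDP) where
  open OCMDP A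

  afterZero : ZeroChange → ℕ
  afterZero stay = 0
  afterZero inc  = 1

  -- New counter value, the old one being suc m.
  afterPositive : ℕ → PositiveChange → ℕ
  afterPositive m dec  = m
  afterPositive m stay = suc m
  afterPositive m inc  = suc (suc m)

  outdegreeᴬ : Location × ℕ → ℕ
  outdegreeᴬ (q , zero)  = length (δ₀ q)
  outdegreeᴬ (q , suc _) = length (δ₊ q)

  outdegreeᴬ>0 : ∀ v → 0 ℕ.< outdegreeᴬ v
  outdegreeᴬ>0 (q , zero)  = δ₀-total q
  outdegreeᴬ>0 (q , suc _) = δ₊-total q

  targetᴬ : ∀ v → Fin (outdegreeᴬ v) → Location × ℕ
  targetᴬ (q , zero)  i = let (j , q′) = lookup (δ₀ q) i in q′ , afterZero j
  targetᴬ (q , suc m) i = let (j , q′) = lookup (δ₊ q) i in q′ , afterPositive m j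

  probabilityᴬ : ∀ v → owner (proj₁ v) ≡ probabilistic → Distribution (outdegreeᴬ v)
  probabilityᴬ (q , zero)  eq = toDistribution (P₀ q eq)
  probabilityᴬ (q , suc _) eq = toDistribution (P₊ q eq)

  mdp : MDP
  mdp = record
    { Vertex      = Location × ℕ
    ; kind        = owner ∘ proj₁
    ; outdegree   = outdegreeᴬ
    ; outdegree>0 = outdegreeᴬ>0
    ; target      = targetᴬ
    ; probability = probabilityᴬ
    }

  inZero : Subset size → Location × ℕ → Bool
  inZero R (q , zero)  = Vec.lookup R q
  inZero R (q , suc _) = false

  ValOne : Subset size → Location × ℕ → Set
  ValOne R s = ∀ ε → 0ℚ ℚ.< ε →
    ∃ λ (σ : Strategy mdp) → PrReachAtLeast σ s (inZero R) (1ℚ ℚ.- ε)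

Word : Set
Word = List Bool

data Symbol (aux : ℕ) : Set where
  blank : Symbol aux
  bit   : Bool → Symbol aux
  extra : Fin aux → Symbol aux

data Move : Set where
  left right none : Move

record TM : Set where
  field
    tapes-1 : ℕ
    states  : ℕ
    aux     : ℕ

  Tapes : ℕ
  Tapes = suc tapes-1

  Γ : Set
  Γ = Symbol aux

  field
    initial   : Fin states
    accepting : Fin states → Bool
    -- The machine halts where the transition function yields nothing.
    step      : Fin states → Vec Γ Tapes → Maybe (Fin states × Vec (Γ × Move) Tapes)

-- Tapes are infinite in both directions.  The cells left of the head are
-- listed from the head outwards.  Only the cells of the input and those
-- visited so far are stored, so that tapeSize measures space.
record Tape (Γ : Set) : Set where
  constructor tape
  field
    before : List Γ
    head   : Γ
    after  : List Γ

open Tape public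

module _ {aux : ℕ} where

  fromList : List (Symbol aux) → Tape (Symbol aux)
  fromList []       = tape [] blank []
  fromList (a ∷ as) = tape [] a as

  move : Move → Tape (Symbol aux) → Tape (Symbol aux)
  move left  (tape []       a rs)       = tape [] blank (a ∷ rs)
  move left  (tape (l ∷ ls) a rs)       = tape ls l (a ∷ rs)
  move right (tape ls       a [])       = tape (a ∷ ls) blank []
  move right (tape ls       a (r ∷ rs)) = tape (a ∷ ls) r rs
  move none  t                          = t

  act : Symbol aux × Move → Tape (Symbol aux) → Tape (Symbol aux)
  act (b , d) (tape ls _ rs) = move d (tape ls b rs)

  tapeSize : Tape (Symbol aux) → ℕ
  tapeSize (tape ls _ rs) = length ls ℕ.+ suc (length rs)

  leadingBits : List (Symbol aux) → Word
  leadingBits (bit b ∷ as) = b ∷ leadingBits as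
  leadingBits _            = []

module _ (M : TM) where
  open TM M

  Config : Set
  Config = Fin states × Vec (Tape Γ) Tapes

  init : Word → Config
  init w = initial , fromList (map bit w) ∷ Vec.replicate tapes-1 (fromList [])

  stepConfig : Config → Maybe Config
  stepConfig (q , ts) with step q (Vec.map head ts)
  ... | nothing        = nothing
  ... | just (q′ , as) = just (q′ , Vec.zipWith act as ts)

  Halted : Config → Set
  Halted c = stepConfig c ≡ nothing

  run : ℕ → Config → Config
  run zero    c = c
  run (suc n) c with stepConfig c
  ... | nothing = c
  ... | just c′ = run n c′

  Accepting : Config → Set
  Accepting (q , _) = T (accepting q)

  space : Config → ℕ
  space (_ , ts) = Vec.sum (Vec.map tapeSize ts)

  -- The output is the longest block of bits on the last tape that starts at
  -- the head and extends to the right.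
  output : Config → Word
  output (_ , ts) = let t = Vec.lookup ts (fromℕ tapes-1) in leadingBits (head t ∷ after t)

-- Coefficients, the constant one first.
Polynomial : Set
Polynomial = List ℕ

eval : Polynomial → ℕ → ℕ
eval []      n = 0
eval (a ∷ p) n = a ℕ.+ n ℕ.* eval p n

Language : Set₁
Language = Word → Set

PolynomialTime : (Word → Word) → Set
PolynomialTime f = ∃ λ (M : TM) → ∃ λ (p : Polynomial) → ∀ w →
  ∃ λ t → t ℕ.≤ eval p (length w)
        × Halted M (run M t (init M w))
        × output M (run M t (init M w)) ≡ f w

PSPACE : Language → Set
PSPACE L = ∃ λ (M : TM) → ∃ λ (p : Polynomial) → ∀ w →
    (∀ t → space M (run M t (init M w)) ℕ.≤ eval p (length w))
  × ∃ λ t → Halted M (run M t (init M w))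
          × (Accepting M (run M t (init M w)) ⇔ L w)

record DecisionProblem : Set₁ where
  field
    Instance : Set
    encode   : Instance → Word
    Yes      : Instance → Set

_≤ₘᵖ_ : Language → DecisionProblem → Set
L ≤ₘᵖ D = ∃ λ (f : Word → Instance) →
  PolynomialTime (encode ∘ f) × (∀ w → L w ⇔ Yes (f w))
  where open DecisionProblem D

PSPACE-hard : DecisionProblem → Set₁
PSPACE-hard D = ∀ (L : Language) → PSPACE L → L ≤ₘᵖ D

-- Every component of the input format is self-delimiting, so an instance can
-- be recovered from its encoding.

unary : ℕ → Word
unary n = replicate n true ++ false ∷ []

-- Each digit of the bijective base-2 numeral is preceded by true; false ends
-- the numeral.
digits : ℕᵇ → Word
digits ℕᵇ.zero  = false ∷ []
digits 2[1+ x ] = true ∷ true ∷ digits x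
digits 1+[2 x ] = true ∷ false ∷ digits x

binary : ℕ → Word
binary n = digits (ℕᵇ.fromℕ n)

-- Only used for positive rationals, so the sign is dropped.
encodeℚ : ℚ → Word
encodeℚ p = binary ∣ ↥ p ∣ ++ binary (↧ₙ p)

encodeZeroChange : ZeroChange → Word
encodeZeroChange stay = false ∷ []
encodeZeroChange inc  = true ∷ []

encodePositiveChange : PositiveChange → Word
encodePositiveChange dec  = true ∷ true ∷ []
encodePositiveChange stay = false ∷ []
encodePositiveChange inc  = true ∷ false ∷ []

-- Locations are written in unary.  As all locations are listed in the input,
-- this changes its length only polynomially.
encodeTransitions : ∀ {C : Set} {n} → (C → Word) →
  (ts : List (C × Fin n)) → (Fin (length ts) → Word) → Word
encodeTransitions encodeC ts encodeP =
  concat (tabulate λ i → let (j , q) = lookup ts i in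
    true ∷ encodeC j ++ unary (toℕ q) ++ encodeP i) ++ false ∷ []

module _ (A : OCMDP) where
  open OCMDP A

  encodeLocationOfKind : ∀ q k → owner q ≡ k → Word
  encodeLocationOfKind q nondeterministic eq =
    false ∷ encodeTransitions encodeZeroChange (δ₀ q) (λ _ → [])
         ++ encodeTransitions encodePositiveChange (δ₊ q) (λ _ → [])
  encodeLocationOfKind q probabilistic eq =
    true ∷ encodeTransitions encodeZeroChange (δ₀ q) (encodeℚ ∘ PRD.weight (P₀ q eq))
        ++ encodeTransitions encodePositiveChange (δ₊ q) (encodeℚ ∘ PRD.weight (P₊ q eq))

  encodeOCMDP : Word
  encodeOCMDP = unary size ++ concat (tabulate λ q → encodeLocationOfKind q (owner q) refl)

record ValOneInstance : Set where
  field
    A : OCMDP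
    R : Subset (OCMDP.size A)
    s : OCMDP.Location A × ℕ

encodeInstance : ValOneInstance → Word
encodeInstance I =
  encodeOCMDP A ++ Vec.toList R ++ unary (toℕ (proj₁ s)) ++ binary (proj₂ s)
  where open ValOneInstance I

ValOneProblem : DecisionProblem
ValOneProblem = record
  { Instance = ValOneInstance
  ; encode   = encodeInstance
  ; Yes      = λ I → let open ValOneInstance I in ValOne A R s
  }

{-
A configuration of a machine, read relative to its heads, is a state of a
cellular automaton: a global state, consisting of the control state and the
scanned symbols, determines together with three neighbouring cells the next
content of each cell.  In the one-counter process a location claims that the
global state, or a given cell, has a given value at time t, where the counter
is 2t.  Eve justifies the claim by naming the global state and the three
contents at time t − 1, and chance picks which of these four claims is examined
next; at counter value 0 only the true claims about the initial configuration
are targets.  True claims are won surely.  A false claim leads to some false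
claim whatever Eve does, so with counter value n it is won with probability at
most 1 − (1/4)ⁿ.  Hence s ∈ ValOne(R) for the claim that the machine accepts at
time t, which is decisive once t is at least the number of configurations of
the admitted space.  Since t may be chosen of the form 2ᵏ − 1, its numeral is
easy to write.

The encoded process consists of one block per cell, and the blocks differ only
in the numbers of the locations that they refer to.  A machine writes them with
a few nested loops over unary registers.
-}

module Submission where

open import Data.Bool using (Bool; true; false; if_then_else_; _∨_; T)
import Data.Bool.Properties as Bool
open import Data.Empty using (⊥; ⊥-elim)
open import Data.Fin using (Fin; zero; suc; toℕ; fromℕ; fromℕ<; inject₁; _↑ˡ_; _↑ʳ_; combine; remQuot; splitAt; funToFin; finToFun)
import Data.Fin.Properties as Fin
import Data.Fin.Relation.Unary.Top as Top
open import Data.Fin.Subset using (Subset)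
open import Data.List using (List; []; _∷_; _++_; length; concat; lookup; map; replicate; tabulate; reverse; _ʳ++_; filter; allFin)
import Data.List.Properties as List
open import Data.List.Membership.Propositional using (find; lose)
open import Data.List.Membership.Propositional.Properties using (∈-filter⁺; ∈-filter⁻; ∈-allFin; ∈-lookup)
open import Data.List.Relation.Unary.All using (All; []; _∷_)
import Data.List.Relation.Unary.All as All
import Data.List.Relation.Unary.All.Properties as All
open import Data.List.Relation.Unary.Any using (Any; here; there)
import Data.List.Relation.Unary.Any as Any
import Data.List.Relation.Unary.Any.Properties as Any
open import Data.List.Relation.Unary.AllPairs using ([]; _∷_)
open import Data.List.Relation.Unary.Unique.Propositional using (Unique)
import Data.List.Relation.Unary.Unique.Propositional.Properties as Unique
open import Data.Maybe using (Maybe; just; nothing; maybe)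
import Data.Maybe as Maybe
import Data.Integer as ℤ
open import Data.Nat as ℕ using (ℕ; zero; suc; _+_; _*_; _^_; _∸_; _≤_; _<_; z≤n; s≤s)
import Data.Nat.Properties as ℕ
open import Data.Nat.Induction using (<-rec)
open import Data.Nat.Solver using () renaming (module +-*-Solver to ℕ-Solver)
open import Data.Nat.Binary using (ℕᵇ; 1+[2_])
import Data.Nat.Binary as ℕᵇ
import Data.Nat.Binary.Properties as ℕᵇ
open import Data.Product using (_×_; _,_; ∃; proj₁; proj₂; map₁; uncurry)
open import Data.Product.Function.NonDependent.Propositional using (_×-↔_)
open import Data.Rational as ℚ using (ℚ; 0ℚ; 1ℚ; ½)
import Data.Rational.Properties as ℚ
open import Data.Rational.Solver using (module +-*-Solver)
open import Data.Sum using (_⊎_; inj₁; inj₂)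
open import Data.Sum.Properties using (inj₂-injective)
open import Data.Sum.Function.Propositional using (_⊎-↔_)
open import Data.Unit using (⊤; tt)
open import Data.Vec using (Vec; []; _∷_; _[_]≔_)
import Data.Vec as Vec
import Data.Vec.Properties as Vec
open import Function using (_∘_; _⇔_; _↔_; mk⇔; mk↔ₛ′; Inverse; Equivalence)
open import Function.Construct.Composition using (_↔-∘_) renaming (_⇔-∘_ to infixr 9 _⇔∘_)
open import Function.Construct.Symmetry using (↔-sym; ⇔-sym)
open import Relation.Binary.PropositionalEquality
  using (_≡_; _≢_; refl; sym; trans; cong; cong₂; subst; subst₂; module ≡-Reasoning)
open import Relation.Nullary using (¬_; Dec; yes; no; does)
open import Relation.Nullary.Decidable using (toWitness)
open import Defs

-- Falsity persists because Eve is offered only those neighbourhoods whose update gives the claimed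
-- value. If the claim is false, the actual neighbourhood is not among them, so each one that she
-- can name has a false component, and chance finds it with probability at least 1/4. The gap (1/4)ⁿ
-- is doubly exponentially small in the input, but any positive gap separates value one from the
-- rest.
--
-- Naming and examining are two transitions, hence 2t, and one further transition at the start names
-- an accepting global state; the initial counter 2t + 1 = 2ᵏ⁺¹ - 1 is again a numeral of ones. A
-- location must have a transition even if nothing can be named, so a losing sink is always on
-- offer.
--
-- Reading the tapes relative to their heads keeps the update local although the heads of several
-- tapes drift apart, and the start claim needs no guess of head positions.
--
-- Inequalities of reals hold only up to an error, so winning is first characterised by a decidable
-- recursion on the counter; one direction then needs a single strategy, the other a single strict
-- gap.

-- Finite types and their enumerations

Finite : Set → Set
Finite A = ∃ λ n → A ↔ Fin n

module _ {A : Set} (F : Finite A) where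
  open Inverse (proj₂ F)

  index : A → Fin (proj₁ F)
  index = to

  unindex : Fin (proj₁ F) → A
  unindex = from

  unindex-index : ∀ a → unindex (index a) ≡ a
  unindex-index = strictlyInverseʳ

⊤-finite : Finite ⊤
⊤-finite = 1 , mk↔ₛ′ (λ _ → zero) (λ _ → tt) (λ { zero → refl }) (λ _ → refl)

Bool-finite : Finite Bool
Bool-finite = 2 , ↔-sym Fin.2↔Bool

Fin-finite : ∀ n → Finite (Fin n)
Fin-finite n = n , mk↔ₛ′ (λ i → i) (λ i → i) (λ _ → refl) (λ _ → refl)

via : ∀ {A B : Set} (f : A → B) (g : B → A) → (∀ b → f (g b) ≡ b) → (∀ a → g (f a) ≡ a) →
      Finite B → Finite A
via f g fg gf (n , i) = n , mk↔ₛ′ (to ∘ f) (g ∘ from)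
  (λ k → trans (cong to (fg (from k))) (strictlyInverseˡ k))
  (λ a → trans (cong g (strictlyInverseʳ (f a))) (gf a))
  where open Inverse i

infixr 2 _×-finite_
infixr 1 _⊎-finite_

_×-finite_ : ∀ {A B} → Finite A → Finite B → Finite (A × B)
(m , i) ×-finite (n , j) = m * n , ↔-sym Fin.*↔× ↔-∘ (i ×-↔ j)

_⊎-finite_ : ∀ {A B} → Finite A → Finite B → Finite (A ⊎ B)
(m , i) ⊎-finite (n , j) = m + n , ↔-sym Fin.+↔⊎ ↔-∘ (i ⊎-↔ j)

Maybe-finite : ∀ {A} → Finite A → Finite (Maybe A)
Maybe-finite F = via
  (maybe inj₂ (inj₁ tt)) (λ { (inj₁ _) → nothing ; (inj₂ a) → just a })
  (λ { (inj₁ _) → refl ; (inj₂ _) → refl }) (λ { nothing → refl ; (just _) → refl })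
  (⊤-finite ⊎-finite F)

Vec-finite : ∀ {A} k → Finite A → Finite (Vec A k)
Vec-finite zero    F = via (λ _ → tt) (λ _ → []) (λ _ → refl) (λ { [] → refl }) ⊤-finite
Vec-finite (suc k) F = via
  (λ as → Vec.head as , Vec.tail as) (λ (a , as) → a ∷ as) (λ _ → refl) (λ { (_ ∷ _) → refl })
  (F ×-finite Vec-finite k F)

Symbol-finite : ∀ aux → Finite (Symbol aux)
Symbol-finite aux = via
  (λ { blank → inj₁ tt ; (bit b) → inj₂ (inj₁ b) ; (extra i) → inj₂ (inj₂ i) })
  (λ { (inj₁ _) → blank ; (inj₂ (inj₁ b)) → bit b ; (inj₂ (inj₂ i)) → extra i })
  (λ { (inj₁ _) → refl ; (inj₂ (inj₁ _)) → refl ; (inj₂ (inj₂ _)) → refl })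
  (λ { blank → refl ; (bit _) → refl ; (extra _) → refl })
  (⊤-finite ⊎-finite Bool-finite ⊎-finite Fin-finite aux)

-- While programs over the tapes of a machine

act-idle : ∀ {aux n} (ts : Vec (Tape (Symbol aux)) n) → Vec.zipWith act (Vec.map (_, none) (Vec.map head ts)) ts ≡ ts
act-idle []       = refl
act-idle (t ∷ ts) = cong (t ∷_) (act-idle ts)

module Programs (tapes-1 aux : ℕ) where

  Tapes : Set
  Tapes = Vec (Tape (Symbol aux)) (suc tapes-1)

  Heads : Set
  Heads = Vec (Symbol aux) (suc tapes-1)

  Actions : Set
  Actions = Vec (Symbol aux × Move) (suc tapes-1)

  infixr 5 _⨾_

  data Prog : Set where
    basic : (Heads → Actions) → Prog
    _⨾_   : Prog → Prog → Prog
    while : (Heads → Bool) → Prog → Prog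

  heads : Tapes → Heads
  heads = Vec.map head

  perform : Actions → Tapes → Tapes
  perform = Vec.zipWith act

  -- Exec P ts n us: P turns ts into us in at most n steps.
  data Exec : Prog → Tapes → ℕ → Tapes → Set where
    basic : ∀ {f ts} → Exec (basic f) ts 1 (perform (f (heads ts)) ts)
    _⨾_   : ∀ {P Q ts us vs m n} → Exec P ts m us → Exec Q us n vs → Exec (P ⨾ Q) ts (m + n) vs
    done  : ∀ {c P ts} → c (heads ts) ≡ false → Exec (while c P) ts 1 ts
    again : ∀ {c P ts us vs m n} → c (heads ts) ≡ true →
            Exec P ts m us → Exec (while c P) us n vs → Exec (while c P) ts (suc (m + n)) vs
    relax : ∀ {P ts us m n} → m ≤ n → Exec P ts m us → Exec P ts n us

  -- The points where execution can stand. In a loop, `nothing` is the test; a sequence has no end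
  -- point of its first part, because leaving `P` already means standing at the entry of `Q`.
  Control : Prog → Set
  Control (basic _)   = ⊤
  Control (P ⨾ Q)     = Control P ⊎ Control Q
  Control (while _ P) = Maybe (Control P)

  entry : ∀ P → Control P
  entry (basic _)   = tt
  entry (P ⨾ Q)     = inj₁ (entry P)
  entry (while _ _) = nothing

  idle : Heads → Actions
  idle = Vec.map (_, none)

  -- The next control state is nothing when the program ends.
  trans-of : ∀ P → Control P → Heads → Maybe (Control P) × Actions
  trans-of (basic f)   _         hs = nothing , f hs
  trans-of (P ⨾ Q)     (inj₁ p)  hs = map₁ (λ n → just (maybe inj₁ (inj₂ (entry Q)) n)) (trans-of P p hs)
  trans-of (P ⨾ Q)     (inj₂ q)  hs = map₁ (Maybe.map inj₂) (trans-of Q q hs)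
  trans-of (while c P) nothing   hs = (if c hs then just (just (entry P)) else nothing) , idle hs
  trans-of (while c P) (just p)  hs = map₁ just (trans-of P p hs)

  Control-finite : ∀ P → Finite (Control P)
  Control-finite (basic _)   = ⊤-finite
  Control-finite (P ⨾ Q)     = Control-finite P ⊎-finite Control-finite Q
  Control-finite (while _ P) = Maybe-finite (Control-finite P)

  State : Prog → Set
  State P = Maybe (Control P) × Tapes

  successor : ∀ P → Control P → Tapes → State P
  successor P p ts = let (q , as) = trans-of P p (heads ts) in q , perform as ts

  infixr 5 _◅_

  data Steps (P : Prog) : State P → ℕ → State P → Set where
    ε   : ∀ {x} → Steps P x 0 x
    _◅_ : ∀ {p ts y z n} → y ≡ successor P p ts → Steps P y n z → Steps P (just p , ts) (suc n) z

  _◅◅_ : ∀ {P x y z m n} → Steps P x m y → Steps P y n z → Steps P x (m + n) z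
  ε        ◅◅ ss = ss
  (e ◅ rs) ◅◅ ss = e ◅ (rs ◅◅ ss)

  first-steps : ∀ {P Q x y n} → Steps P x n y →
    Steps (P ⨾ Q) (map₁ (just ∘ maybe inj₁ (inj₂ (entry Q))) x) n (map₁ (just ∘ maybe inj₁ (inj₂ (entry Q))) y)
  first-steps ε          = ε
  first-steps (refl ◅ s) = refl ◅ first-steps s

  second-steps : ∀ {P Q x y n} → Steps Q x n y →
    Steps (P ⨾ Q) (map₁ (Maybe.map inj₂) x) n (map₁ (Maybe.map inj₂) y)
  second-steps ε          = ε
  second-steps (refl ◅ s) = refl ◅ second-steps s

  body-steps : ∀ {c P x y n} → Steps P x n y → Steps (while c P) (map₁ just x) n (map₁ just y)
  body-steps ε          = ε
  body-steps (refl ◅ s) = refl ◅ body-steps s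

  -- `run` needs an exact number of steps, while `n` is only a bound because of `relax`; hence the
  -- existential `t`.
  sound : ∀ {P ts n us} → Exec P ts n us →
    ∃ λ t → t ≤ n × Steps P (just (entry P) , ts) t (nothing , us)
  sound basic = 1 , ℕ.≤-refl , refl ◅ ε
  sound (p ⨾ q) =
    let (s , s≤ , ps) = sound p ; (t , t≤ , qs) = sound q
    in s + t , ℕ.+-mono-≤ s≤ t≤ , first-steps ps ◅◅ second-steps qs
  sound (done {ts = ts} stop) =
    1 , ℕ.≤-refl , cong₂ _,_ (sym (cong (if_then _ else nothing) stop)) (sym (act-idle ts)) ◅ ε
  sound (again {ts = ts} continue p w) =
    let (s , s≤ , ps) = sound p ; (t , t≤ , ws) = sound w
    in suc (s + t) , s≤s (ℕ.+-mono-≤ s≤ t≤)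
     , cong₂ _,_ (sym (cong (if_then just (just _) else _) continue)) (sym (act-idle ts))
       ◅ (body-steps ps ◅◅ ws)
  sound (relax m≤n p) = let (t , t≤ , ps) = sound p in t , ℕ.≤-trans t≤ m≤n , ps

  module Compile (P : Prog) where

    private
      F : Finite (Control P)
      F = Control-finite P

    -- State `zero` is reserved for the end of the program, where the machine has no transition.
    state : Maybe (Control P) → Fin (suc (proj₁ F))
    state = maybe (suc ∘ index F) zero

    control-step : Fin (suc (proj₁ F)) → Heads → Maybe (Fin (suc (proj₁ F)) × Actions)
    control-step zero    hs = nothing
    control-step (suc i) hs = just (map₁ state (trans-of P (unindex F i) hs))

    machine : TM
    machine = record
      { tapes-1 = tapes-1 ; states = suc (proj₁ F) ; aux = aux
      ; initial = state (just (entry P)) ; accepting = λ _ → false ; step = control-step }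

    stepConfig-successor : ∀ p ts → stepConfig machine (state (just p) , ts) ≡ just (map₁ state (successor P p ts))
    stepConfig-successor p ts rewrite unindex-index F p = refl

    run-step : ∀ {c c′} n → stepConfig machine c ≡ just c′ → run machine (suc n) c ≡ run machine n c′
    run-step {c} n eq with stepConfig machine c
    run-step n refl | just _ = refl

    run-steps : ∀ {x n y} → Steps P x n y → run machine n (map₁ state x) ≡ map₁ state y
    run-steps ε = refl
    run-steps {n = suc n} (_◅_ {p} {ts} refl s) =
      trans (run-step n (stepConfig-successor p ts)) (run-steps s)

    run-exec : ∀ {ts n us} → Exec P ts n us →
      ∃ λ t → t ≤ n × run machine t (state (just (entry P)) , ts) ≡ (zero , us)
    run-exec e = let (t , t≤n , s) = sound e in t , t≤n , run-steps s

    halted-zero : ∀ us → Halted machine (zero , us)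
    halted-zero us = refl

-- Order of the reals

infix 4 _≼_

-- A record, so that the two reals can be inferred from a proof.
record _≼_ (x y : ℝ) : Set where
  constructor eventually
  field
    approximate : x ≤ᴿ y

open _≼_

half-positive : ∀ {ε} → 0ℚ ℚ.< ε → 0ℚ ℚ.< ½ ℚ.* ε
half-positive {ε} 0<ε = ℚ.positive⁻¹ (½ ℚ.* ε) {{ℚ.pos*pos⇒pos ½ ε {{ℚ.positive 0<ε}}}}

p≤p+ε : ∀ {p ε} → 0ℚ ℚ.< ε → p ℚ.≤ p ℚ.+ ε
p≤p+ε {p} {ε} 0<ε = subst (ℚ._≤ p ℚ.+ ε) (ℚ.+-identityʳ p) (ℚ.+-monoʳ-≤ p (ℚ.<⇒≤ 0<ε))

pointwise-≤ : ∀ {x y} → (∀ n → seq x n ℚ.≤ seq y n) → x ≼ y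
pointwise-≤ x≤y = eventually λ ε 0<ε → 0 , λ n _ → ℚ.≤-trans (x≤y n) (p≤p+ε 0<ε)

≼-refl : ∀ {x} → x ≼ x
≼-refl = pointwise-≤ λ _ → ℚ.≤-refl

fromℚ-mono : ∀ {p q} → p ℚ.≤ q → fromℚ p ≼ fromℚ q
fromℚ-mono p≤q = pointwise-≤ λ _ → p≤q

≼-trans : ∀ {x y z} → x ≼ y → y ≼ z → x ≼ z
≼-trans {x} {y} {z} x≤y y≤z = eventually λ ε 0<ε →
  let (M , p) = approximate x≤y _ (half-positive 0<ε)
      (N , q) = approximate y≤z _ (half-positive 0<ε)
  in M ℕ.⊔ N , λ n ≤n → begin
    seq x n                                ≤⟨ p n (ℕ.m⊔n≤o⇒m≤o M N ≤n) ⟩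
    seq y n ℚ.+ ½ ℚ.* ε                    ≤⟨ ℚ.+-monoˡ-≤ (½ ℚ.* ε) (q n (ℕ.m⊔n≤o⇒n≤o M N ≤n)) ⟩
    (seq z n ℚ.+ ½ ℚ.* ε) ℚ.+ ½ ℚ.* ε      ≡⟨ halves (seq z n) ε ⟩
    seq z n ℚ.+ ε                          ∎
  where
  open ℚ.≤-Reasoning
  halves : ∀ a e → (a ℚ.+ ½ ℚ.* e) ℚ.+ ½ ℚ.* e ≡ a ℚ.+ e
  halves = solve 2 (λ a e → (a :+ con ½ :* e) :+ con ½ :* e := a :+ e) refl
    where open +-*-Solver

+ᴿ-mono : ∀ {x x′ y y′} → x ≼ x′ → y ≼ y′ → x +ᴿ y ≼ x′ +ᴿ y′
+ᴿ-mono {x} {x′} {y} {y′} x≤ y≤ = eventually λ ε 0<ε →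
  let (M , p) = approximate x≤ _ (half-positive 0<ε)
      (N , q) = approximate y≤ _ (half-positive 0<ε)
  in M ℕ.⊔ N , λ n ≤n → begin
    seq x n ℚ.+ seq y n
      ≤⟨ ℚ.+-mono-≤ (p n (ℕ.m⊔n≤o⇒m≤o M N ≤n)) (q n (ℕ.m⊔n≤o⇒n≤o M N ≤n)) ⟩
    (seq x′ n ℚ.+ ½ ℚ.* ε) ℚ.+ (seq y′ n ℚ.+ ½ ℚ.* ε)
      ≡⟨ halves (seq x′ n) (seq y′ n) ε ⟩
    (seq x′ n ℚ.+ seq y′ n) ℚ.+ ε ∎
  where
  open ℚ.≤-Reasoning
  halves : ∀ a b e → (a ℚ.+ ½ ℚ.* e) ℚ.+ (b ℚ.+ ½ ℚ.* e) ≡ (a ℚ.+ b) ℚ.+ e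
  halves = solve 3 (λ a b e → (a :+ con ½ :* e) :+ (b :+ con ½ :* e) := (a :+ b) :+ e) refl
    where open +-*-Solver

p≤∣p∣ : ∀ p → p ℚ.≤ ℚ.∣ p ∣
p≤∣p∣ p with ℚ.≤-total 0ℚ p
... | inj₁ 0≤p = ℚ.≤-reflexive (sym (ℚ.0≤p⇒∣p∣≡p 0≤p))
... | inj₂ p≤0 = ℚ.≤-trans p≤0 (ℚ.0≤∣p∣ p)

eventually-≤ : ∀ x → ∃ λ B → 0ℚ ℚ.≤ B × ∃ λ N → ∀ n → N ≤ n → seq x n ℚ.≤ B
eventually-≤ x =
  let (N , close) = cauchy x 1ℚ (ℚ.positive⁻¹ 1ℚ)
  in ℚ.∣ seq x N ∣ ℚ.+ 1ℚ , ℚ.+-mono-≤ (ℚ.0≤∣p∣ (seq x N)) (ℚ.<⇒≤ (ℚ.positive⁻¹ 1ℚ)) , N , λ n N≤n → begin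
    seq x n                            ≡⟨ detour (seq x n) (seq x N) ⟩
    seq x N ℚ.+ (seq x n ℚ.- seq x N)  ≤⟨ ℚ.+-mono-≤ (p≤∣p∣ (seq x N)) (ℚ.≤-trans (p≤∣p∣ _) (close n N N≤n ℕ.≤-refl)) ⟩
    ℚ.∣ seq x N ∣ ℚ.+ 1ℚ               ∎
  where
  open ℚ.≤-Reasoning
  detour : ∀ a b → a ≡ b ℚ.+ (a ℚ.- b)
  detour = solve 2 (λ a b → a := b :+ (a :- b)) refl
    where open +-*-Solver

positive-quotient : ∀ S ε → 0ℚ ℚ.< S → 0ℚ ℚ.< ε → ∃ λ δ → 0ℚ ℚ.< δ × S ℚ.* δ ≡ ε
positive-quotient S ε 0<S 0<ε = (ℚ.1/ S) ℚ.* ε , 0<δ ,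
  trans (sym (ℚ.*-assoc S (ℚ.1/ S) ε)) (trans (cong (ℚ._* ε) (ℚ.*-inverseʳ S)) (ℚ.*-identityˡ ε))
  where
  instance
    S-positive : ℚ.Positive S
    S-positive = ℚ.positive 0<S
    S-nonZero : ℚ.NonZero S
    S-nonZero = ℚ.pos⇒nonZero S
  0<δ : 0ℚ ℚ.< (ℚ.1/ S) ℚ.* ε
  0<δ = ℚ.positive⁻¹ _ {{ℚ.pos*pos⇒pos (ℚ.1/ S) {{ℚ.1/pos⇒pos S}} ε {{ℚ.positive 0<ε}}}}

0≤p*q : ∀ {p q} → 0ℚ ℚ.≤ p → 0ℚ ℚ.≤ q → 0ℚ ℚ.≤ p ℚ.* q
0≤p*q {p} {q} 0≤p 0≤q = subst (ℚ._≤ p ℚ.* q) (ℚ.*-zeroʳ p) (ℚ.*-monoˡ-≤-nonNeg p {{ℚ.nonNegative 0≤p}} 0≤q)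

-- Both hypotheses hold up to an error δ only, so w (y - x) need not be nonnegative termwise, but (w
-- + δ)(y - x + δ) is. The two differ by (w + (y - x) + δ) δ, which upper bounds on w and y - x make
-- small.
*ᴿ-monoʳ : ∀ {w x y} → 0ᴿ ≼ w → x ≼ y → w *ᴿ x ≼ w *ᴿ y
*ᴿ-monoʳ {w} {x} {y} 0≤w x≤y = eventually λ ε 0<ε →
  let (B , 0≤B , N₁ , w≤B) = eventually-≤ w
      (D , 0≤D , N₂ , d≤D) = eventually-≤ (y +ᴿ (fromℚ (ℚ.- 1ℚ) *ᴿ x))
      S               = (B ℚ.+ D) ℚ.+ 1ℚ
      (η , 0<η , Sη≡ε) = positive-quotient S ε
                           (ℚ.+-mono-≤-< (ℚ.+-mono-≤ 0≤B 0≤D) (ℚ.positive⁻¹ 1ℚ)) 0<ε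
      -- δ ≤ 1 pays for the summand δ inside the bracket, and δ ≤ η brings S δ below ε.
      δ               = 1ℚ ℚ.⊓ η
      0<δ             = ⊓-positive (ℚ.positive⁻¹ 1ℚ) 0<η
      (N₃ , 0≤w+δ)    = approximate 0≤w δ 0<δ
      (N₄ , x≤y+δ)    = approximate x≤y δ 0<δ
  in (N₁ ℕ.⊔ N₂) ℕ.⊔ (N₃ ℕ.⊔ N₄) , λ n ≤n →
     let 12≤ = ℕ.m⊔n≤o⇒m≤o (N₁ ℕ.⊔ N₂) (N₃ ℕ.⊔ N₄) ≤n
         34≤ = ℕ.m⊔n≤o⇒n≤o (N₁ ℕ.⊔ N₂) (N₃ ℕ.⊔ N₄) ≤n
     in step (seq w n) (seq x n) (seq y n) B D η δ
          (w≤B n (ℕ.m⊔n≤o⇒m≤o N₁ N₂ 12≤)) (d≤D n (ℕ.m⊔n≤o⇒n≤o N₁ N₂ 12≤))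
          (0≤w+δ n (ℕ.m⊔n≤o⇒m≤o N₃ N₄ 34≤)) (x≤y+δ n (ℕ.m⊔n≤o⇒n≤o N₃ N₄ 34≤))
          (ℚ.<⇒≤ 0<δ) (ℚ.p⊓q≤p 1ℚ η) (ℚ.p⊓q≤q 1ℚ η)
          (ℚ.+-mono-≤ (ℚ.+-mono-≤ 0≤B 0≤D) (ℚ.<⇒≤ (ℚ.positive⁻¹ 1ℚ))) Sη≡ε
  where
  ⊓-positive : ∀ {p q} → 0ℚ ℚ.< p → 0ℚ ℚ.< q → 0ℚ ℚ.< p ℚ.⊓ q
  ⊓-positive {p} {q} 0<p 0<q with ℚ.⊓-sel p q
  ... | inj₁ eq = subst (0ℚ ℚ.<_) (sym eq) 0<p
  ... | inj₂ eq = subst (0ℚ ℚ.<_) (sym eq) 0<q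
  -- Moving the nonnegative (w + δ)(d + δ), where d = y − x, to the left.
  identity : ∀ w x y δ → w ℚ.* x ℚ.+ (w ℚ.+ δ) ℚ.* ((y ℚ.+ ℚ.- 1ℚ ℚ.* x) ℚ.+ δ)
                       ≡ w ℚ.* y ℚ.+ ((w ℚ.+ (y ℚ.+ ℚ.- 1ℚ ℚ.* x)) ℚ.+ δ) ℚ.* δ
  identity = solve 4 (λ w x y δ → w :* x :+ (w :+ δ) :* ((y :+ con (ℚ.- 1ℚ) :* x) :+ δ)
                       := w :* y :+ ((w :+ (y :+ con (ℚ.- 1ℚ) :* x)) :+ δ) :* δ) refl
    where open +-*-Solver
  difference : ∀ x y δ → (y ℚ.+ δ) ℚ.+ ℚ.- 1ℚ ℚ.* x ≡ (y ℚ.+ ℚ.- 1ℚ ℚ.* x) ℚ.+ δ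
  difference = solve 3 (λ x y δ → (y :+ δ) :+ con (ℚ.- 1ℚ) :* x := (y :+ con (ℚ.- 1ℚ) :* x) :+ δ) refl
    where open +-*-Solver
  cancel : ∀ x → x ℚ.+ ℚ.- 1ℚ ℚ.* x ≡ 0ℚ
  cancel = solve 1 (λ x → x :+ con (ℚ.- 1ℚ) :* x := con 0ℚ) refl
    where open +-*-Solver
  open ℚ.≤-Reasoning
  step : ∀ w x y B D η δ {ε} → w ℚ.≤ B → y ℚ.+ ℚ.- 1ℚ ℚ.* x ℚ.≤ D → 0ℚ ℚ.≤ w ℚ.+ δ → x ℚ.≤ y ℚ.+ δ →
         0ℚ ℚ.≤ δ → δ ℚ.≤ 1ℚ → δ ℚ.≤ η → 0ℚ ℚ.≤ (B ℚ.+ D) ℚ.+ 1ℚ → ((B ℚ.+ D) ℚ.+ 1ℚ) ℚ.* η ≡ ε →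
         w ℚ.* x ℚ.≤ w ℚ.* y ℚ.+ ε
  step w x y B D η δ {ε} w≤B d≤D 0≤w+δ x≤y+δ 0≤δ δ≤1 δ≤η 0≤S Sη≡ε = begin
    w ℚ.* x
      ≡⟨ sym (ℚ.+-identityʳ (w ℚ.* x)) ⟩
    w ℚ.* x ℚ.+ 0ℚ
      ≤⟨ ℚ.+-monoʳ-≤ (w ℚ.* x) (0≤p*q 0≤w+δ 0≤d+δ) ⟩
    w ℚ.* x ℚ.+ (w ℚ.+ δ) ℚ.* ((y ℚ.+ ℚ.- 1ℚ ℚ.* x) ℚ.+ δ)
      ≡⟨ identity w x y δ ⟩
    w ℚ.* y ℚ.+ ((w ℚ.+ (y ℚ.+ ℚ.- 1ℚ ℚ.* x)) ℚ.+ δ) ℚ.* δ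
      ≤⟨ ℚ.+-monoʳ-≤ (w ℚ.* y) (ℚ.*-monoʳ-≤-nonNeg δ {{ℚ.nonNegative 0≤δ}} (ℚ.+-mono-≤ (ℚ.+-mono-≤ w≤B d≤D) δ≤1)) ⟩
    w ℚ.* y ℚ.+ ((B ℚ.+ D) ℚ.+ 1ℚ) ℚ.* δ
      ≤⟨ ℚ.+-monoʳ-≤ (w ℚ.* y) (ℚ.*-monoˡ-≤-nonNeg ((B ℚ.+ D) ℚ.+ 1ℚ) {{ℚ.nonNegative 0≤S}} δ≤η) ⟩
    w ℚ.* y ℚ.+ ((B ℚ.+ D) ℚ.+ 1ℚ) ℚ.* η
      ≡⟨ cong (w ℚ.* y ℚ.+_) Sη≡ε ⟩
    w ℚ.* y ℚ.+ ε ∎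
    where
    0≤d+δ : 0ℚ ℚ.≤ (y ℚ.+ ℚ.- 1ℚ ℚ.* x) ℚ.+ δ
    0≤d+δ = subst₂ ℚ._≤_ (cancel x) (difference x y δ) (ℚ.+-monoˡ-≤ (ℚ.- 1ℚ ℚ.* x) x≤y+δ)

sumᴿ-mono : ∀ {n} {f g : Fin n → ℝ} → (∀ i → f i ≼ g i) → sumᴿ f ≼ sumᴿ g
sumᴿ-mono {zero}  f≤g = ≼-refl
sumᴿ-mono {suc n} f≤g = +ᴿ-mono (f≤g zero) (sumᴿ-mono (λ i → f≤g (suc i)))

seq-sumᴿ : ∀ {n} (f : Fin n → ℝ) k → seq (sumᴿ f) k ≡ sumℚ (λ i → seq (f i) k)
seq-sumᴿ {zero}  f k = refl
seq-sumᴿ {suc n} f k = cong (seq (f zero) k ℚ.+_) (seq-sumᴿ (f ∘ suc) k)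

sumℚ-*ʳ : ∀ {n} (f : Fin n → ℚ) u → sumℚ (λ i → f i ℚ.* u) ≡ sumℚ f ℚ.* u
sumℚ-*ʳ {zero}  f u = sym (ℚ.*-zeroˡ u)
sumℚ-*ʳ {suc n} f u = trans (cong (f zero ℚ.* u ℚ.+_) (sumℚ-*ʳ (f ∘ suc) u)) (sym (ℚ.*-distribʳ-+ u (f zero) _))

sumℚ-mono : ∀ {n} {f g : Fin n → ℚ} → (∀ i → f i ℚ.≤ g i) → sumℚ f ℚ.≤ sumℚ g
sumℚ-mono {zero}  f≤g = ℚ.≤-refl
sumℚ-mono {suc n} f≤g = ℚ.+-mono-≤ (f≤g zero) (sumℚ-mono (λ i → f≤g (suc i)))

sumℚ-nonneg : ∀ {n} {f : Fin n → ℚ} → (∀ i → 0ℚ ℚ.≤ f i) → 0ℚ ℚ.≤ sumℚ f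
sumℚ-nonneg {zero}  0≤f = ℚ.≤-refl
sumℚ-nonneg {suc n} 0≤f = ℚ.+-mono-≤ (0≤f zero) (sumℚ-nonneg (λ i → 0≤f (suc i)))

term≤sumℚ : ∀ {n} {f : Fin n → ℚ} → (∀ i → 0ℚ ℚ.≤ f i) → ∀ j → f j ℚ.≤ sumℚ f
term≤sumℚ {f = f} 0≤f zero =
  subst (ℚ._≤ sumℚ f) (ℚ.+-identityʳ (f zero)) (ℚ.+-monoʳ-≤ (f zero) (sumℚ-nonneg (λ i → 0≤f (suc i))))
term≤sumℚ {f = f} 0≤f (suc j) =
  ℚ.≤-trans (term≤sumℚ (λ i → 0≤f (suc i)) j)
    (subst (ℚ._≤ sumℚ f) (ℚ.+-identityˡ (sumℚ (f ∘ suc))) (ℚ.+-monoˡ-≤ (sumℚ (f ∘ suc)) (0≤f zero)))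

-- The weights sum to 1 only up to ε; after multiplication by `u` this error is still at most ε, as
-- u ≤ 1.
average-≤ : ∀ {n} (D : Distribution n) (x : Fin n → ℝ) {u} → 0ℚ ℚ.≤ u → u ℚ.≤ 1ℚ →
            (∀ i → x i ≼ fromℚ u) → sumᴿ (λ i → weight D i *ᴿ x i) ≼ fromℚ u
average-≤ D x {u} 0≤u u≤1 x≤u =
  ≼-trans (sumᴿ-mono (λ i → *ᴿ-monoʳ (eventually {0ᴿ} {weight D i} (nonneg D i)) (x≤u i))) total
  where
  open ℚ.≤-Reasoning
  total : sumᴿ (λ i → weight D i *ᴿ fromℚ u) ≼ fromℚ u
  total = eventually λ ε 0<ε → let (N , Σ≤) = proj₁ (sum≃1 D) ε 0<ε in N , λ n N≤n → begin
    seq (sumᴿ (λ i → weight D i *ᴿ fromℚ u)) n  ≡⟨ seq-sumᴿ (λ i → weight D i *ᴿ fromℚ u) n ⟩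
    sumℚ (λ i → seq (weight D i) n ℚ.* u)       ≡⟨ sumℚ-*ʳ (λ i → seq (weight D i) n) u ⟩
    sumℚ (λ i → seq (weight D i) n) ℚ.* u       ≡⟨ cong (ℚ._* u) (sym (seq-sumᴿ (weight D) n)) ⟩
    seq (sumᴿ (weight D)) n ℚ.* u               ≤⟨ ℚ.*-monoʳ-≤-nonNeg u {{ℚ.nonNegative 0≤u}} (Σ≤ n N≤n) ⟩
    (1ℚ ℚ.+ ε) ℚ.* u                            ≡⟨ ℚ.*-distribʳ-+ u 1ℚ ε ⟩
    1ℚ ℚ.* u ℚ.+ ε ℚ.* u                        ≤⟨ ℚ.+-mono-≤ (ℚ.≤-reflexive (ℚ.*-identityˡ u))
                                                    (ℚ.*-monoˡ-≤-nonNeg ε {{ℚ.nonNegative (ℚ.<⇒≤ 0<ε)}} u≤1) ⟩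
    u ℚ.+ ε ℚ.* 1ℚ                              ≡⟨ cong (u ℚ.+_) (ℚ.*-identityʳ ε) ⟩
    u ℚ.+ ε                                     ∎

weighted-≤ : ∀ {n} (w : Fin n → ℚ) (x : Fin n → ℝ) → (∀ i → 0ℚ ℚ.≤ w i) → (∀ i → x i ≼ 1ᴿ) →
             sumᴿ (λ i → fromℚ (w i) *ᴿ x i) ≼ fromℚ (sumℚ w)
weighted-≤ w x 0≤w x≤1 = ≼-trans
  (sumᴿ-mono (λ i → *ᴿ-monoʳ (fromℚ-mono (0≤w i)) (x≤1 i)))
  (pointwise-≤ λ n → ℚ.≤-reflexive (trans (seq-sumᴿ (λ i → fromℚ (w i) *ᴿ 1ᴿ) n)
    (trans (sumℚ-*ʳ w 1ℚ) (ℚ.*-identityʳ (sumℚ w)))))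

-- The price of one bad successor at a probabilistic location: a gap d below 1 at transition j
-- lowers the average by the weight of j times d.
weighted-gap : ∀ {n} (w : Fin n → ℚ) (x : Fin n → ℝ) → (∀ i → 0ℚ ℚ.≤ w i) → (∀ i → x i ≼ 1ᴿ) →
               ∀ {d} j → x j ≼ fromℚ (1ℚ ℚ.- d) →
               sumᴿ (λ i → fromℚ (w i) *ᴿ x i) ≼ fromℚ (sumℚ w ℚ.- w j ℚ.* d)
weighted-gap w x 0≤w x≤1 {d} zero gap = ≼-trans
  (+ᴿ-mono (*ᴿ-monoʳ (fromℚ-mono (0≤w zero)) gap)
           (weighted-≤ (w ∘ suc) (x ∘ suc) (λ i → 0≤w (suc i)) (λ i → x≤1 (suc i))))
  (pointwise-≤ λ _ → ℚ.≤-reflexive (rearrange (w zero) (sumℚ (w ∘ suc)) d))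
  where
  rearrange : ∀ a b d → a ℚ.* (1ℚ ℚ.- d) ℚ.+ b ≡ (a ℚ.+ b) ℚ.- a ℚ.* d
  rearrange = solve 3 (λ a b d → a :* (con 1ℚ :- d) :+ b := (a :+ b) :- a :* d) refl
    where open +-*-Solver
weighted-gap w x 0≤w x≤1 {d} (suc j) gap = ≼-trans
  (+ᴿ-mono (*ᴿ-monoʳ (fromℚ-mono (0≤w zero)) (x≤1 zero))
           (weighted-gap (w ∘ suc) (x ∘ suc) (λ i → 0≤w (suc i)) (λ i → x≤1 (suc i)) j gap))
  (pointwise-≤ λ _ → ℚ.≤-reflexive (rearrange (w zero) (sumℚ (w ∘ suc)) (w (suc j) ℚ.* d)))
  where
  rearrange : ∀ a b e → a ℚ.* 1ℚ ℚ.+ (b ℚ.- e) ≡ (a ℚ.+ b) ℚ.- e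
  rearrange = solve 3 (λ a b e → a :* con 1ℚ :+ (b :- e) := (a :+ b) :- e) refl
    where open +-*-Solver

-- Point distributions and powers

dirac : ∀ {n} → Fin n → Fin n → ℚ
dirac zero    zero    = 1ℚ
dirac zero    (suc i) = 0ℚ
dirac (suc j) zero    = 0ℚ
dirac (suc j) (suc i) = dirac j i

dirac-nonneg : ∀ {n} (j i : Fin n) → 0ℚ ℚ.≤ dirac j i
dirac-nonneg zero    zero    = ℚ.<⇒≤ (ℚ.positive⁻¹ 1ℚ)
dirac-nonneg zero    (suc i) = ℚ.≤-refl
dirac-nonneg (suc j) zero    = ℚ.≤-refl
dirac-nonneg (suc j) (suc i) = dirac-nonneg j i

dirac-refl : ∀ {n} (j : Fin n) → dirac j j ≡ 1ℚ
dirac-refl zero    = refl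
dirac-refl (suc j) = dirac-refl j

dirac-sum : ∀ {n} (j : Fin n) → sumℚ (dirac j) ≡ 1ℚ
dirac-sum (zero {n}) = trans (cong (1ℚ ℚ.+_) (zeros n)) (ℚ.+-identityʳ 1ℚ)
  where
  zeros : ∀ n → sumℚ {n} (λ _ → 0ℚ) ≡ 0ℚ
  zeros zero    = refl
  zeros (suc n) = trans (ℚ.+-identityˡ _) (zeros n)
dirac-sum (suc j) = trans (ℚ.+-identityˡ _) (dirac-sum j)

point : ∀ {n} → Fin n → Distribution n
point j = record
  { weight = fromℚ ∘ dirac j
  ; nonneg = λ i → approximate (fromℚ-mono (dirac-nonneg j i))
  ; sum≃1  = approximate {sumᴿ (fromℚ ∘ dirac j)} {1ᴿ} (pointwise-≤ (λ k → ℚ.≤-reflexive (sum≡ k)))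
           , approximate {1ᴿ} {sumᴿ (fromℚ ∘ dirac j)} (pointwise-≤ (λ k → ℚ.≤-reflexive (sym (sum≡ k))))
  }
  where
  sum≡ : ∀ k → seq (sumᴿ (fromℚ ∘ dirac j)) k ≡ 1ℚ
  sum≡ k = trans (seq-sumᴿ (fromℚ ∘ dirac j) k) (dirac-sum j)

power : ℚ → ℕ → ℚ
power c zero    = 1ℚ
power c (suc n) = c ℚ.* power c n

-- One-counter games in which every positive transition decrements the counter

All-lookup : ∀ {A : Set} {P : A → Set} {xs} → All P xs → ∀ i → P (lookup xs i)
All-lookup ps i = All.lookup ps (∈-lookup i)

-- At a probabilistic location every transition must lead to a win, as each of them has positive
-- probability.
Wins-as : Kind → ∀ {C L : Set} → (L → Set) → List (C × L) → Set
Wins-as nondeterministic P = Any (P ∘ proj₂)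
Wins-as probabilistic    P = All (P ∘ proj₂)

Wins-as? : ∀ κ {C L : Set} {P : L → Set} → (∀ q → Dec (P q)) → ∀ (ts : List (C × L)) → Dec (Wins-as κ P ts)
Wins-as? nondeterministic P? = Any.any? (P? ∘ proj₂)
Wins-as? probabilistic    P? = All.all? (P? ∘ proj₂)

module _ (A : OCMDP) (R : Subset (OCMDP.size A)) where
  open OCMDP A

  -- The recursion suits processes in which every positive transition decrements the counter: n
  -- transitions remain before the targets are looked up. It makes winning decidable, on which
  -- `ValOne⇒Wins` relies.
  Wins : ℕ → Location → Set
  Wins zero    q = Vec.lookup R q ≡ true
  Wins (suc n) q = Wins-as (owner q) (Wins n) (δ₊ q)

  Wins? : ∀ n q → Dec (Wins n q)
  Wins? zero    q = Vec.lookup R q Bool.≟ true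
  Wins? (suc n) q = Wins-as? (owner q) (Wins? n) (δ₊ q)

-- At counter value 0 every play goes to the sink and stays there, so a target can be met only on
-- the first arrival at 0. The constant `c` bounds from below the probability that chance picks a
-- given losing successor.
module CountdownGame
  (A : OCMDP) (R : Subset (OCMDP.size A)) (sink : OCMDP.Location A)
  (sink∉R : Vec.lookup R sink ≡ false)
  (zero-sink : ∀ q → All (_≡ (stay , sink)) (OCMDP.δ₀ A q))
  (countdown : ∀ q → All (λ t → proj₁ t ≡ dec) (OCMDP.δ₊ A q))
  (c : ℚ) (0<c : 0ℚ ℚ.< c) (c≤1 : c ℚ.≤ 1ℚ)
  (c≤P₊ : ∀ q eq i → c ℚ.≤ PRD.weight (OCMDP.P₊ A q eq) i) where

  open OCMDP A

  WinsVertex : Location × ℕ → Set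
  WinsVertex (q , n) = Wins A R n q

  private
    M : MDP
    M = mdp A
    E : ∀ {s v} → Path M s v → Bool
    E = visits {M = M} (inZero A R)

  target-suc : ∀ q n i → MDP.target M (q , suc n) i ≡ (proj₂ (lookup (δ₊ q) i) , n)
  target-suc q n i with lookup (δ₊ q) i | All-lookup (countdown q) i
  ... | .dec , q′ | refl = refl

  target-zero : ∀ q i → MDP.target M (q , zero) i ≡ (sink , 0)
  target-zero q i with lookup (δ₀ q) i | All-lookup (zero-sink q) i
  ... | _ | refl = refl

  inZero-losing : ∀ v → ¬ WinsVertex v → inZero A R v ≡ false
  inZero-losing (q , zero)  ¬win with Vec.lookup R q
  ... | true  = ⊥-elim (¬win refl)
  ... | false = refl
  inZero-losing (q , suc n) ¬win = refl

  power-positive : ∀ n → 0ℚ ℚ.< power c n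
  power-positive zero    = ℚ.positive⁻¹ 1ℚ
  power-positive (suc n) = ℚ.positive⁻¹ _ {{ℚ.pos*pos⇒pos c {{ℚ.positive 0<c}} (power c n) {{ℚ.positive (power-positive n)}}}}

  power-decreasing : ∀ n → power c (suc n) ℚ.≤ power c n
  power-decreasing n = subst (power c (suc n) ℚ.≤_) (ℚ.*-identityˡ (power c n))
    (ℚ.*-monoʳ-≤-nonNeg (power c n) {{ℚ.nonNegative (ℚ.<⇒≤ (power-positive n))}} c≤1)

  power≤1 : ∀ n → power c n ℚ.≤ 1ℚ
  power≤1 zero    = ℚ.≤-refl
  power≤1 (suc n) = ℚ.≤-trans (power-decreasing n) (power≤1 n)

  complement-mono : ∀ {p q} → q ℚ.≤ p → 1ℚ ℚ.- p ℚ.≤ 1ℚ ℚ.- q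
  complement-mono q≤p = ℚ.+-monoʳ-≤ 1ℚ (ℚ.neg-antimono-≤ q≤p)

  bound : ℕ → ℚ
  bound n = 1ℚ ℚ.- power c n

  bound-nonneg : ∀ n → 0ℚ ℚ.≤ bound n
  bound-nonneg n = complement-mono (power≤1 n)

  bound≤1 : ∀ n → bound n ℚ.≤ 1ℚ
  bound≤1 n = complement-mono (ℚ.<⇒≤ (power-positive n))

  module _ (σ : Strategy M) where

    Pr≤1 : ∀ k {s v} (π : Path M s v) → Pr σ k π E ≼ 1ᴿ
    Pr≤1 zero π with E π
    ... | true  = ≼-refl
    ... | false = fromℚ-mono (ℚ.<⇒≤ (ℚ.positive⁻¹ 1ℚ))
    Pr≤1 (suc k) π = average-≤ (next σ π) (λ i → Pr σ k (π ▷ i) E) (ℚ.<⇒≤ (ℚ.positive⁻¹ 1ℚ)) ℚ.≤-refl (λ i → Pr≤1 k (π ▷ i))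

    -- Eve cannot leave the losing vertices, and chance stays among them with probability at least
    -- `c`, so each decrement keeps at least the fraction `c` of the gap. The horizon `k` is
    -- independent of the bound, which therefore passes to the supremum.
    losing : ∀ k {s} v (π : Path M s v) → E π ≡ false → ¬ WinsVertex v →
             Pr σ k π E ≼ fromℚ (bound (proj₂ v))
    losing zero v π unseen ¬win rewrite unseen = fromℚ-mono (bound-nonneg (proj₂ v))
    losing (suc k) v π unseen ¬win = by-counter v π unseen ¬win
      where
      later : ∀ {s v} (π : Path M s v) → E π ≡ false → ∀ i {q n} → MDP.target M v i ≡ (q , n) →
              ¬ Wins A R n q → Pr σ k (π ▷ i) E ≼ fromℚ (bound n)
      later {v = v} π unseen i {n = n} eq ¬win =
        subst (λ m → Pr σ k (π ▷ i) E ≼ fromℚ (bound m)) (cong proj₂ eq)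
          (losing k (MDP.target M v i) (π ▷ i)
            (cong₂ _∨_ unseen (inZero-losing (MDP.target M v i) ¬win′)) ¬win′)
        where
        ¬win′ : ¬ WinsVertex (MDP.target M v i)
        ¬win′ = subst (λ u → ¬ WinsVertex u) (sym eq) ¬win

      by-kind : ∀ {s q n} (π : Path M s (q , suc n)) → E π ≡ false → ∀ κ (eq : owner q ≡ κ) →
                ¬ Wins-as κ (Wins A R n) (δ₊ q) →
                sumᴿ (λ i → weight (nextOfKind σ π κ eq) i *ᴿ Pr σ k (π ▷ i) E) ≼ fromℚ (bound (suc n))
      by-kind {q = q} {n} π unseen nondeterministic eq ¬win = ≼-trans
        (average-≤ (σ π eq) (λ i → Pr σ k (π ▷ i) E) (bound-nonneg n) (bound≤1 n)
          (λ i → later π unseen i (target-suc q n i) (All-lookup (All.¬Any⇒All¬ (δ₊ q) ¬win) i)))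
        -- Randomising over losing successors keeps the gap cⁿ, which is at least the required cⁿ⁺¹.
        (fromℚ-mono (complement-mono (power-decreasing n)))
      by-kind {q = q} {n} π unseen probabilistic eq ¬win =
        let loss = All.¬All⇒Any¬ (Wins? A R n ∘ proj₂) (δ₊ q) ¬win
            j    = Any.index loss
        in ≼-trans
          (weighted-gap (PRD.weight D) (λ i → Pr σ k (π ▷ i) E) (λ i → ℚ.<⇒≤ (PRD.positive D i))
            (λ i → Pr≤1 k (π ▷ i)) j (later π unseen j (target-suc q n j) (Any.lookup-index loss)))
          (fromℚ-mono (subst (λ s → s ℚ.- PRD.weight D j ℚ.* power c n ℚ.≤ bound (suc n)) (sym (PRD.sum≡1 D))
            (complement-mono (ℚ.*-monoʳ-≤-nonNeg (power c n) {{ℚ.nonNegative (ℚ.<⇒≤ (power-positive n))}} (c≤P₊ q eq j)))))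
        where
        D : PositiveRationalDistribution (length (δ₊ q))
        D = P₊ q eq

      by-counter : ∀ {s} v (π : Path M s v) → E π ≡ false → ¬ WinsVertex v →
                   Pr σ (suc k) π E ≼ fromℚ (bound (proj₂ v))
      -- The bound 1 - c⁰ is 0: after missing the targets at counter value 0 the play only sees the
      -- sink.
      by-counter (q , zero) π unseen ¬win =
        average-≤ (next σ π) (λ i → Pr σ k (π ▷ i) E) ℚ.≤-refl (bound≤1 0)
          (λ i → later π unseen i (target-zero q i) (λ win → case-false (trans (sym win) sink∉R)))
        where
        case-false : true ≢ false
        case-false ()
      by-counter (q , suc n) π unseen ¬win = by-kind π unseen (owner q) refl ¬win

  -- The first transition is a default for counter value 0 and for locations without a winning
  -- successor.
  choice : ∀ v → Fin (outdegreeᴬ A v)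
  choice (q , zero) = fromℕ< (δ₀-total q)
  choice (q , suc n) with Any.any? (Wins? A R n ∘ proj₂) (δ₊ q)
  ... | yes win = Any.index win
  ... | no  _   = fromℕ< (δ₊-total q)

  choice-wins : ∀ q n → Any (Wins A R n ∘ proj₂) (δ₊ q) →
                Wins A R n (proj₂ (lookup (δ₊ q) (choice (q , suc n))))
  choice-wins q n win with Any.any? (Wins? A R n ∘ proj₂) (δ₊ q)
  ... | yes win′ = Any.lookup-index win′
  ... | no  ¬win = ⊥-elim (¬win win)

  greedy : Strategy M
  greedy {v = v} π eq = point (choice v)

  greedy-nonneg : ∀ {s} v (π : Path M s v) κ eq i m → 0ℚ ℚ.≤ seq (weight (nextOfKind greedy π κ eq) i) m
  greedy-nonneg v π nondeterministic eq i m = dirac-nonneg (choice v) i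
  greedy-nonneg (q , zero)  π probabilistic eq i m = ℚ.<⇒≤ (PRD.positive (P₀ q eq) i)
  greedy-nonneg (q , suc n) π probabilistic eq i m = ℚ.<⇒≤ (PRD.positive (P₊ q eq) i)

  Pr-nonneg : ∀ k {s} v (π : Path M s v) m → 0ℚ ℚ.≤ seq (Pr greedy k π E) m
  Pr-nonneg zero v π m with E π
  ... | true  = ℚ.<⇒≤ (ℚ.positive⁻¹ 1ℚ)
  ... | false = ℚ.≤-refl
  Pr-nonneg (suc k) v π m = subst (0ℚ ℚ.≤_)
    (sym (seq-sumᴿ (λ i → weight (next greedy π) i *ᴿ Pr greedy k (π ▷ i) E) m))
    (sumℚ-nonneg (λ i → 0≤p*q (greedy-nonneg v π (owner (proj₁ v)) refl i m) (Pr-nonneg k _ (π ▷ i) m)))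

  last-visited : ∀ {s v} (π : Path M s v) → inZero A R v ≡ true → E π ≡ true
  last-visited start seen = seen
  last-visited (π ▷ i) seen = trans (cong (E π ∨_) seen) (Bool.∨-zeroʳ (E π))

  -- All weights under `greedy` are rational constants, so the estimate holds at every index `m` and
  -- carries no error term. The horizon is the counter value, since exactly that many transitions
  -- lead to counter value 0.
  winning : ∀ n {s} v (π : Path M s v) → proj₂ v ≡ n → WinsVertex v → ∀ m → 1ℚ ℚ.≤ seq (Pr greedy n π E) m
  winning zero (q , .0) π refl win m rewrite last-visited π win = ℚ.≤-refl
  winning (suc n) (q , .(suc n)) π refl win m = subst (1ℚ ℚ.≤_)
    (sym (seq-sumᴿ (λ i → weight (next greedy π) i *ᴿ Pr greedy n (π ▷ i) E) m))
    (by-kind (owner q) refl win)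
    where
    x : Fin (length (δ₊ q)) → ℚ
    x i = seq (Pr greedy n (π ▷ i) E) m
    x≥1 : ∀ i → Wins A R n (proj₂ (lookup (δ₊ q) i)) → 1ℚ ℚ.≤ x i
    x≥1 i win′ = winning n _ (π ▷ i) (cong proj₂ (target-suc q n i))
      (subst WinsVertex (sym (target-suc q n i)) win′) m
    by-kind : ∀ κ (eq : owner q ≡ κ) → Wins-as κ (Wins A R n) (δ₊ q) →
              1ℚ ℚ.≤ sumℚ (λ i → seq (weight (nextOfKind greedy π κ eq) i) m ℚ.* x i)
    by-kind nondeterministic eq win = ℚ.≤-trans
      (subst (λ p → 1ℚ ℚ.≤ p ℚ.* x j) (sym (dirac-refl j)) (subst (1ℚ ℚ.≤_) (sym (ℚ.*-identityˡ (x j))) (x≥1 j (choice-wins q n win))))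
      -- The chosen transition alone contributes at least 1, and the other terms are nonnegative.
      (term≤sumℚ {f = λ i → dirac j i ℚ.* x i} (λ i → 0≤p*q (dirac-nonneg j i) (Pr-nonneg n _ (π ▷ i) m)) j)
      where
      j : Fin (length (δ₊ q))
      j = choice (q , suc n)
    by-kind probabilistic eq win = subst (ℚ._≤ sumℚ (λ i → p i ℚ.* x i)) sum≡1
      (sumℚ-mono (λ i → ℚ.*-monoˡ-≤-nonNeg (p i) {{ℚ.nonNegative (ℚ.<⇒≤ (PRD.positive (P₊ q eq) i))}}
        (x≥1 i (All-lookup win i))))
      where
      p : Fin (length (δ₊ q)) → ℚ
      p = PRD.weight (P₊ q eq)
      sum≡1 : sumℚ (λ i → p i ℚ.* 1ℚ) ≡ 1ℚ
      sum≡1 = trans (sumℚ-*ʳ p 1ℚ) (trans (ℚ.*-identityʳ (sumℚ p)) (PRD.sum≡1 (P₊ q eq)))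

  Wins⇒ValOne : ∀ q n → Wins A R n q → ValOne A R (q , n)
  Wins⇒ValOne q n win ε 0<ε = greedy , λ δ 0<δ → n ,
    approximate {fromℚ ((1ℚ ℚ.- ε) ℚ.- δ)} {PrReachWithin greedy n (q , n) (inZero A R)} (pointwise-≤ λ m →
    ℚ.≤-trans (ℚ.≤-trans (minus≤ 0<δ) (minus≤ 0<ε)) (winning n (q , n) start refl win m))
    where
    minus≤ : ∀ {p ε} → 0ℚ ℚ.< ε → p ℚ.- ε ℚ.≤ p
    minus≤ {p} {ε} 0<ε = subst (p ℚ.- ε ℚ.≤_) (ℚ.+-identityʳ p) (ℚ.+-monoʳ-≤ p (ℚ.neg-antimono-≤ (ℚ.<⇒≤ 0<ε)))

  ValOne⇒Wins : ∀ q n → ValOne A R (q , n) → Wins A R n q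
  ValOne⇒Wins q n val with Wins? A R n q
  ... | yes win = win
  ... | no ¬win = ⊥-elim (absurd (val ε 0<ε))
    where
    d ε : ℚ
    d = power c n
    -- An error ε enters three times: in the value, in its approximation from below, and in the
    -- comparison of reals. Their sum 3d/8 stays below the gap d.
    ε = ½ ℚ.* (½ ℚ.* (½ ℚ.* d))
    0<ε : 0ℚ ℚ.< ε
    0<ε = half-positive (half-positive (half-positive (power-positive n)))
    -- Adding d - 1 - d/4 to both sides of 1 - 2ε ≤ 1 - d + ε turns it into d/2 ≤ -ε.
    gather : ∀ d → ((1ℚ ℚ.- ½ ℚ.* (½ ℚ.* (½ ℚ.* d))) ℚ.- ½ ℚ.* (½ ℚ.* (½ ℚ.* d))) ℚ.+ (d ℚ.- 1ℚ ℚ.- ½ ℚ.* (½ ℚ.* d) )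
                   ≡ ½ ℚ.* d
    gather = solve 1
      (λ d → ((con 1ℚ :- con ½ :* (con ½ :* (con ½ :* d))) :- con ½ :* (con ½ :* (con ½ :* d)))
             :+ (d :- con 1ℚ :- con ½ :* (con ½ :* d))
                   := con ½ :* d) refl
      where open +-*-Solver
    gather′ : ∀ d → (1ℚ ℚ.- d ℚ.+ ½ ℚ.* (½ ℚ.* (½ ℚ.* d))) ℚ.+ (d ℚ.- 1ℚ ℚ.- ½ ℚ.* (½ ℚ.* d)) ≡ ℚ.- (½ ℚ.* (½ ℚ.* (½ ℚ.* d)))
    gather′ = solve 1
      (λ d → (con 1ℚ :- d :+ con ½ :* (con ½ :* (con ½ :* d))) :+ (d :- con 1ℚ :- con ½ :* (con ½ :* d))
             := :- (con ½ :* (con ½ :* (con ½ :* d)))) refl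
      where open +-*-Solver
    absurd : (∃ λ (σ : Strategy M) → PrReachAtLeast {M = M} σ (q , n) (inZero A R) (1ℚ ℚ.- ε)) → ⊥
    absurd (σ , reach) =
      let (k , lower) = reach ε 0<ε
          (N , below) = approximate (≼-trans (eventually {fromℚ ((1ℚ ℚ.- ε) ℚ.- ε)} {PrReachWithin σ k (q , n) (inZero A R)} lower)
                          (losing σ k (q , n) start (inZero-losing (q , n) ¬win) ¬win)) ε 0<ε
          squeezed : ½ ℚ.* d ℚ.≤ ℚ.- ε
          squeezed = subst₂ ℚ._≤_ (gather d) (gather′ d) (ℚ.+-monoˡ-≤ (d ℚ.- 1ℚ ℚ.- ½ ℚ.* (½ ℚ.* d)) (below N ℕ.≤-refl))
      in ℚ.<-irrefl refl (ℚ.<-≤-trans (half-positive (power-positive n))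
           (ℚ.≤-trans squeezed (ℚ.neg-antimono-≤ (ℚ.<⇒≤ 0<ε))))

-- Concatenations

concat-tabulate-cong : ∀ {A : Set} {n} {f g : Fin n → List A} → (∀ i → f i ≡ g i) →
                       concat (tabulate f) ≡ concat (tabulate g)
concat-tabulate-cong f≡g = cong concat (List.tabulate-cong f≡g)

concat-tabulate-+ : ∀ {A : Set} m {n} (f : Fin (m + n) → List A) →
  concat (tabulate f) ≡ concat (tabulate (f ∘ (_↑ˡ n))) ++ concat (tabulate (f ∘ (m ↑ʳ_)))
concat-tabulate-+ zero    f = refl
concat-tabulate-+ (suc m) f =
  trans (cong (f zero ++_) (concat-tabulate-+ m (f ∘ suc))) (sym (List.++-assoc (f zero) _ _))

concat-tabulate-* : ∀ {A : Set} m {n} (f : Fin (m * n) → List A) →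
  concat (tabulate f) ≡ concat (tabulate {n = m} λ i → concat (tabulate {n = n} λ j → f (combine i j)))
concat-tabulate-* zero            f = refl
concat-tabulate-* {A} (suc m) {n} f = trans (concat-tabulate-+ n f)
  (cong (concat (tabulate (f ∘ (_↑ˡ (m * n)))) ++_) (concat-tabulate-* m (f ∘ (n ↑ʳ_))))

concat-tabulate-∷ʳ : ∀ {A : Set} n (f : Fin (suc n) → List A) →
  concat (tabulate f) ≡ concat (tabulate (f ∘ inject₁)) ++ f (fromℕ n)
concat-tabulate-∷ʳ zero    f = List.++-identityʳ (f zero)
concat-tabulate-∷ʳ (suc n) f =
  trans (cong (f zero ++_) (concat-tabulate-∷ʳ n (f ∘ suc))) (sym (List.++-assoc (f zero) _ _))

tabulate-singletons : ∀ {A : Set} {n} (f : Fin n → A) → tabulate f ≡ concat (tabulate λ i → f i ∷ [])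
tabulate-singletons f = sym (trans (cong concat (sym (List.map-tabulate f (_∷ [])))) List.concat-map-[ tabulate f ])

toList-tabulate : ∀ {A : Set} {n} (f : Fin n → A) → Vec.toList (Vec.tabulate f) ≡ tabulate f
toList-tabulate {n = zero}  f = refl
toList-tabulate {n = suc n} f = cong (f zero ∷_) (toList-tabulate (f ∘ suc))

-- The recursion appends on the right, as a loop writes its next output after all earlier ones.
series : ∀ {A : Set} → ℕ → (ℕ → List A) → List A
series zero    f = []
series (suc n) f = series n f ++ f n

concat-tabulate-series : ∀ {A : Set} n (f : ℕ → List A) → concat (tabulate {n = n} (f ∘ toℕ)) ≡ series n f
concat-tabulate-series zero    f = refl
concat-tabulate-series (suc n) f = trans (concat-tabulate-∷ʳ n (f ∘ toℕ))
  (cong₂ _++_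
    (trans (concat-tabulate-cong {n = n} {f = f ∘ toℕ ∘ inject₁} {g = f ∘ toℕ} (λ i → cong f (Fin.toℕ-inject₁ i))) (concat-tabulate-series n f))
    (cong f (Fin.toℕ-fromℕ n)))

-- The partial inverse of `inject₁`; applied twice it recognises the two last cells.
lower : ∀ {n} → Fin (suc n) → Maybe (Fin n)
lower {zero}  zero    = nothing
lower {suc n} zero    = just zero
lower {suc n} (suc i) = Maybe.map suc (lower i)

lower-inject₁ : ∀ {n} (i : Fin n) → lower (inject₁ i) ≡ just i
lower-inject₁ zero    = refl
lower-inject₁ (suc i) = cong (Maybe.map suc) (lower-inject₁ i)

lower-fromℕ : ∀ n → lower (fromℕ n) ≡ nothing
lower-fromℕ zero    = refl
lower-fromℕ (suc n) = cong (Maybe.map suc) (lower-fromℕ n)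

quarter : ℚ
quarter = ℤ.+ 1 ℚ./ 4

quarters : ∀ {n} → n ≡ 4 → PositiveRationalDistribution n
quarters n≡4 = record
  { weight   = λ _ → quarter
  ; positive = λ _ → ℚ.positive⁻¹ quarter
  ; sum≡1    = cong (λ n → sumℚ {n} λ _ → quarter) n≡4
  }

certain : PositiveRationalDistribution 1
certain = record { weight = λ _ → 1ℚ ; positive = λ _ → ℚ.positive⁻¹ 1ℚ ; sum≡1 = refl }

-- Cellular automata with a global state, and their one-counter processes

record Automaton : Set where
  field
    globals contents : ℕ
    next-global : Fin globals → Fin contents → Fin contents → Fin contents → Fin globals
    next-content : Fin globals → Fin contents → Fin contents → Fin contents → Fin contents
    edge void : Fin contents
    -- The argument is the input letter at the position concerned, `nothing` past the end of the
    -- input.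
    initial-global : Maybe Bool → Fin globals
    initial-content : Maybe Bool → Fin contents
    accepts : Fin globals → Bool

module Layout (K : Automaton) where
  open Automaton K

  Neighbourhood-finite : Finite (Fin globals × Fin contents × Fin contents × Fin contents)
  Neighbourhood-finite =
    Fin-finite globals ×-finite Fin-finite contents ×-finite Fin-finite contents ×-finite Fin-finite contents

  -- The two additional global locations are the sink, numbered 0, and the start, numbered 1. The
  -- block of a cell has one location per claimed content and one per neighbourhood named around the
  -- cell.
  neighbourhoods globs width : ℕ
  neighbourhoods = proj₁ Neighbourhood-finite
  globs          = 2 + globals
  width          = contents + neighbourhoods

  neighbourhood : Fin neighbourhoods → Fin globals × Fin contents × Fin contents × Fin contents
  neighbourhood = unindex Neighbourhood-finite

  next-global-of : Fin neighbourhoods → Fin globals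
  next-global-of t = let (g , a , b , c) = neighbourhood t in next-global g a b c

  next-content-of : Fin neighbourhoods → Fin contents
  next-content-of t = let (g , a , b , c) = neighbourhood t in next-content g a b c

  data Ref : Set where
    glob : Fin globs → Ref
    -- The three positions are those of the left neighbour, the cell itself and
    -- the right neighbour.
    cell : Fin 3 → Fin width → Ref

  fact : Fin contents → Fin width
  fact = _↑ˡ neighbourhoods

  check : Fin neighbourhoods → Fin width
  check = contents ↑ʳ_

  global-fact : Fin globals → Fin globs
  global-fact g = suc (suc g)

  here-check : Fin neighbourhoods → Ref
  here-check t = cell (suc zero) (check t)

  -- The outgoing transitions of a location up to translation along the cells. `four` makes the
  -- constant weight 1/4 a distribution.
  record Entry : Set where
    field
      kind     : Kind
      refs     : List Ref
      unique   : Unique refs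
      nonempty : 0 < length refs
      four     : kind ≡ probabilistic → length refs ≡ 4

  -- The sink keeps the list nonempty when no option satisfies `P?`; moving there never helps Eve.
  choose : ∀ {n} (f : Fin n → Ref) → (∀ {i j} → f i ≡ f j → i ≡ j) → (∀ i → glob zero ≢ f i) →
           {P : Fin n → Set} → (∀ i → Dec (P i)) → Entry
  choose {n} f injective f≢sink P? = record
    { kind     = nondeterministic
    ; refs     = glob zero ∷ map f (filter P? (allFin n))
    ; unique   = All.map⁺ (All.universal f≢sink _) ∷ Unique.map⁺ injective (Unique.filter⁺ P? (Unique.allFin⁺ n))
    ; nonempty = s≤s z≤n
    ; four     = λ ()
    }

  cell-injective : ∀ {p p′ c c′} → cell p c ≡ cell p′ c′ → c ≡ c′
  cell-injective refl = refl

  forced : Ref → Entry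
  forced r = record
    { kind = nondeterministic ; refs = r ∷ [] ; unique = [] ∷ [] ; nonempty = s≤s z≤n ; four = λ () }

  justify : {P : Fin neighbourhoods → Set} → (∀ t → Dec (P t)) → Entry
  justify = choose here-check (λ eq → Fin.↑ʳ-injective contents _ _ (cell-injective eq)) (λ _ ())

  start-entry : Entry
  start-entry = choose (glob ∘ global-fact) (λ { refl → refl }) (λ _ ()) (λ g → accepts g Bool.≟ true)

  global-entry : Fin globs → Entry
  global-entry zero          = forced (glob zero)
  global-entry (suc zero)    = start-entry
  -- Global entries are placed at window 0, whose middle is cell 1, so the same check locations
  -- serve claims about the global state and about cell 1.
  global-entry (suc (suc g)) = justify (λ t → next-global-of t Fin.≟ g)

  -- A cell whose content never changes hands its claim to itself until the counter is 0; `p` is the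
  -- position of that cell in its window.
  boundary-entry : Fin 3 → Fin width → Entry
  boundary-entry p c = forced (cell p c)

  check-entry : Fin globals × Fin contents × Fin contents × Fin contents → Entry
  check-entry (g , a , b , c) = record
    { kind     = probabilistic
    ; refs     = glob (global-fact g) ∷ cell zero (fact a) ∷ cell (suc zero) (fact b) ∷ cell (suc (suc zero)) (fact c) ∷ []
    ; unique   = ((λ ()) ∷ (λ ()) ∷ (λ ()) ∷ []) ∷ ((λ ()) ∷ (λ ()) ∷ []) ∷ ((λ ()) ∷ []) ∷ [] ∷ []
    ; nonempty = s≤s z≤n
    ; four     = λ _ → refl
    }

  interior-entry′ : Fin contents ⊎ Fin neighbourhoods → Entry
  interior-entry′ (inj₁ y) = justify (λ t → next-content-of t Fin.≟ y)
  interior-entry′ (inj₂ t) = check-entry (neighbourhood t)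

  interior-entry : Fin width → Entry
  interior-entry c = interior-entry′ (splitAt contents c)

  -- `m` is the number of the leftmost of the three cells. The order is that of `code`: the global
  -- block, then one block of length `width` per cell.
  ref-number : ℕ → Ref → ℕ
  ref-number m (glob a)   = toℕ a
  ref-number m (cell p c) = globs + (m * width + (toℕ p * width + toℕ c))

  weight-word zero-weight-word : Kind → Word
  weight-word nondeterministic = []
  weight-word probabilistic    = encodeℚ quarter
  zero-weight-word nondeterministic = []
  zero-weight-word probabilistic    = encodeℚ 1ℚ

  kind-bit : Kind → Bool
  kind-bit nondeterministic = false
  kind-bit probabilistic    = true

  -- The first bit announces a transition, the next two encode `dec`.
  ref-word : Kind → ℕ → Ref → Word
  ref-word κ m r = true ∷ true ∷ true ∷ unary (ref-number m r) ++ weight-word κ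

  -- The bits announce a transition, encode `stay`, and give the sink as unary 0. The `concat` of a
  -- singleton copies the shape of `encodeTransitions`, so that both agree by computation.
  zero-word : Kind → Word
  zero-word κ = concat ((true ∷ false ∷ false ∷ zero-weight-word κ) ∷ []) ++ false ∷ []

  entry-word : ℕ → Entry → Word
  entry-word m e = kind-bit kind ∷ zero-word kind ++ concat (map (ref-word kind m) refs) ++ false ∷ []
    where open Entry e

  block-word : ∀ {n} → (Fin n → Entry) → ℕ → Word
  block-word τ m = concat (tabulate λ c → entry-word m (τ c))

  fact-bit′ : Fin contents → Fin contents ⊎ Fin neighbourhoods → Bool
  fact-bit′ v (inj₁ y) = does (v Fin.≟ y)
  fact-bit′ v (inj₂ t) = false

  fact-bit : Fin contents → Fin width → Bool
  fact-bit v c = fact-bit′ v (splitAt contents c)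

  global-bit : Fin globals → Fin globs → Bool
  global-bit g zero          = false
  global-bit g (suc zero)    = false
  global-bit g (suc (suc h)) = does (g Fin.≟ h)

  -- Cells 1 to S are updated, cells 0, S + 1 and S + 2 keep their contents.
  module Size (S : ℕ) where

    Loc : Set
    Loc = Fin globs ⊎ (Fin (3 + S) × Fin width)

    size : ℕ
    size = globs + (3 + S) * width

    code : Loc → Fin size
    code (inj₁ a)       = a ↑ˡ ((3 + S) * width)
    code (inj₂ (i , c)) = globs ↑ʳ combine i c

    decode′ : Fin globs ⊎ Fin ((3 + S) * width) → Loc
    decode′ (inj₁ a) = inj₁ a
    decode′ (inj₂ k) = inj₂ (remQuot {3 + S} width k)

    decode : Fin size → Loc
    decode q = decode′ (splitAt globs q)

    decode-code : ∀ l → decode (code l) ≡ l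
    decode-code (inj₁ a)       = cong decode′ (Fin.splitAt-↑ˡ globs a ((3 + S) * width))
    decode-code (inj₂ (i , c)) = trans
      (cong decode′ (Fin.splitAt-↑ʳ globs ((3 + S) * width) (combine i c)))
      (cong inj₂ (Fin.remQuot-combine i c))

    position : Fin (suc S) → Fin 3 → Fin (3 + S)
    position j zero             = inject₁ (inject₁ j)
    position j (suc zero)       = suc (inject₁ j)
    position j (suc (suc zero)) = suc (suc j)

    toℕ-position : ∀ j p → toℕ (position j p) ≡ toℕ j + toℕ p
    toℕ-position j zero             = trans (Fin.toℕ-inject₁ _) (trans (Fin.toℕ-inject₁ j) (sym (ℕ.+-identityʳ _)))
    toℕ-position j (suc zero)       = trans (cong suc (Fin.toℕ-inject₁ j)) (ℕ.+-comm 1 (toℕ j))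
    toℕ-position j (suc (suc zero)) = ℕ.+-comm 2 (toℕ j)

    resolve : Fin (suc S) → Ref → Loc
    resolve j (glob a)   = inj₁ a
    resolve j (cell p c) = inj₂ (position j p , c)

    resolve-injective : ∀ j {r r′} → resolve j r ≡ resolve j r′ → r ≡ r′
    resolve-injective j {glob a}   {glob .a} refl = refl
    resolve-injective j {cell p c} {cell p′ c′} eq = cong₂ cell
      (Fin.toℕ-injective (ℕ.+-cancelˡ-≡ (toℕ j) _ _
        (trans (sym (toℕ-position j p)) (trans (cong toℕ (cong proj₁ (inj₂-injective eq))) (toℕ-position j p′)))))
      (cong proj₂ (inj₂-injective eq))

    code-injective : ∀ {l l′} → code l ≡ code l′ → l ≡ l′
    code-injective {l} {l′} eq = trans (sym (decode-code l)) (trans (cong decode eq) (decode-code l′))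

    toℕ-resolve : ∀ j r → toℕ (code (resolve j r)) ≡ ref-number (toℕ j) r
    toℕ-resolve j (glob a)   = Fin.toℕ-↑ˡ a _
    toℕ-resolve j (cell p c) = begin
      toℕ (globs ↑ʳ combine (position j p) c)              ≡⟨ Fin.toℕ-↑ʳ globs _ ⟩
      globs + toℕ (combine (position j p) c)               ≡⟨ cong (globs +_) (Fin.toℕ-combine (position j p) c) ⟩
      globs + (width * toℕ (position j p) + toℕ c)         ≡⟨ cong (λ n → globs + (n + toℕ c))
                                                                (trans (ℕ.*-comm width _) (cong (_* width) (toℕ-position j p))) ⟩
      globs + ((toℕ j + toℕ p) * width + toℕ c)            ≡⟨ cong (λ n → globs + (n + toℕ c)) (ℕ.*-distribʳ-+ width (toℕ j) (toℕ p)) ⟩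
      globs + (toℕ j * width + toℕ p * width + toℕ c)      ≡⟨ cong (globs +_) (ℕ.+-assoc (toℕ j * width) _ _) ⟩
      globs + (toℕ j * width + (toℕ p * width + toℕ c))    ∎
      where open ≡-Reasoning

    Place : Set
    Place = Fin (suc S) × Entry

    place-inner : Fin (suc S) → Fin width → Maybe (Fin S) → Place
    place-inner j c (just _) = j , interior-entry c
    place-inner j c nothing  = j , boundary-entry (suc zero) c

    place-cell′ : Fin width → Maybe (Fin (suc S)) → Place
    place-cell′ c (just j) = place-inner j c (lower j)
    place-cell′ c nothing  = fromℕ S , boundary-entry (suc (suc zero)) c

    -- The window of an interior cell starts at its left neighbour. Cell 0 is the left end of window
    -- 0; cells S + 1 and S + 2 are the middle and the right end of the last window S.
    place : Loc → Place
    place (inj₁ a)           = zero , global-entry a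
    place (inj₂ (zero , c))  = zero , boundary-entry zero c
    place (inj₂ (suc i , c)) = place-cell′ c (lower i)

    place-interior : ∀ j c → place (inj₂ (suc (inject₁ (inject₁ j)) , c)) ≡ (inject₁ j , interior-entry c)
    place-interior j c rewrite lower-inject₁ (inject₁ j) | lower-inject₁ j = refl

    place-void₁ : ∀ c → place (inj₂ (suc (inject₁ (fromℕ S)) , c)) ≡ (fromℕ S , boundary-entry (suc zero) c)
    place-void₁ c rewrite lower-inject₁ (fromℕ S) | lower-fromℕ S = refl

    place-void₂ : ∀ c → place (inj₂ (suc (suc (fromℕ S)) , c)) ≡ (fromℕ S , boundary-entry (suc (suc zero)) c)
    place-void₂ c rewrite lower-fromℕ S = refl

    transitions : Place → List (PositiveChange × Fin size)
    transitions (j , e) = map (λ r → dec , code (resolve j r)) (Entry.refs e)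

    process : OCMDP
    process = record
      { size      = size
      ; owner     = λ q → Entry.kind (proj₂ (place (decode q)))
      ; δ₀        = λ q → (stay , zero) ∷ []
      ; δ₊        = λ q → transitions (place (decode q))
      ; δ₀-unique = λ q → [] ∷ []
      ; δ₊-unique = λ q → let (j , e) = place (decode q) in
          Unique.map⁺ (λ eq → resolve-injective j (code-injective (cong proj₂ eq))) (Entry.unique e)
      ; δ₀-total  = λ q → s≤s z≤n
      ; δ₊-total  = λ q → let e = proj₂ (place (decode q)) in
          subst (0 <_) (sym (List.length-map _ (Entry.refs e))) (Entry.nonempty e)
      ; P₀        = λ q _ → certain
      ; P₊        = λ q eq → let e = proj₂ (place (decode q)) in
          quarters (trans (List.length-map _ (Entry.refs e)) (Entry.four e eq))
      }

    place-word : Place → Word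
    place-word (j , e) = entry-word (toℕ j) e

    transitions-word : ∀ w ((j , e) : Place) →
      encodeTransitions encodePositiveChange (transitions (j , e)) (λ _ → w)
      ≡ concat (map (λ r → true ∷ true ∷ true ∷ unary (ref-number (toℕ j) r) ++ w) (Entry.refs e)) ++ false ∷ []
    transitions-word w (j , e) = cong (λ u → concat u ++ false ∷ [])
      (trans (sym (List.map-tabulate (lookup ts) transition))
      (trans (cong (map transition) (List.tabulate-lookup ts))
      (trans (sym (List.map-∘ (Entry.refs e)))
             (List.map-cong (λ r → cong (λ n → true ∷ true ∷ true ∷ unary n ++ w) (toℕ-resolve j r)) (Entry.refs e)))))
      where
      ts : List (PositiveChange × Fin size)
      ts = transitions (j , e)
      transition : PositiveChange × Fin size → Word
      transition (δ , q) = true ∷ encodePositiveChange δ ++ unary (toℕ q) ++ w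

    location-word : ∀ q κ eq → encodeLocationOfKind process q κ eq ≡ place-word (place (decode q))
    location-word q nondeterministic eq with place (decode q)
    ... | j , e with Entry.kind e | eq
    ... | _ | refl = cong (λ u → false ∷ zero-word nondeterministic ++ u) (transitions-word [] (j , e))
    location-word q probabilistic eq with place (decode q)
    ... | j , e with Entry.kind e | eq
    ... | _ | refl = cong (λ u → true ∷ zero-word probabilistic ++ u) (transitions-word (encodeℚ quarter) (j , e))

    cell-word : (Loc → Word) → Fin (3 + S) → Word
    cell-word h i = concat (tabulate {n = width} λ c → h (inj₂ (i , c)))

    concat-locations : ∀ (h : Loc → Word) → concat (tabulate (h ∘ decode)) ≡
      concat (tabulate (h ∘ inj₁)) ++ cell-word h zero ++
      (concat (tabulate {n = S} λ j → cell-word h (suc (inject₁ (inject₁ j)))) ++ cell-word h (suc (inject₁ (fromℕ S)))) ++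
      cell-word h (suc (suc (fromℕ S)))
    concat-locations h = trans (concat-tabulate-+ globs (h ∘ decode)) (cong₂ _++_
      (concat-tabulate-cong {f = λ a → h (decode (a ↑ˡ ((3 + S) * width)))} (λ a → cong h (decode-code (inj₁ a))))
      (trans (concat-tabulate-* (3 + S) {n = width} (λ k → h (decode (globs ↑ʳ k))))
      (trans (concat-tabulate-cong {f = λ i → concat (tabulate {n = width} λ c → h (decode (code (inj₂ (i , c)))))} {g = cell-word h}
               (λ i → concat-tabulate-cong {n = width} {f = λ c → h (decode (code (inj₂ (i , c))))} (λ c → cong h (decode-code (inj₂ (i , c))))))
      (cong (cell-word h zero ++_) (trans (concat-tabulate-∷ʳ (suc S) (cell-word h ∘ suc))
        (cong (_++ cell-word h (suc (suc (fromℕ S)))) (concat-tabulate-∷ʳ S (cell-word h ∘ suc ∘ inject₁))))))))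

    -- The form in which a program writes the process: constant blocks around a single loop over the
    -- window number.
    encodeOCMDP-process : encodeOCMDP process ≡
      unary size ++ block-word global-entry 0 ++ block-word (boundary-entry zero) 0 ++
      (series S (block-word interior-entry) ++ block-word (boundary-entry (suc zero)) S) ++
      block-word (boundary-entry (suc (suc zero))) S
    encodeOCMDP-process = cong (unary size ++_) (trans
      (concat-tabulate-cong {f = λ q → encodeLocationOfKind process q (OCMDP.owner process q) refl} {g = h ∘ decode}
        (λ q → location-word q _ refl))
      (trans (concat-locations h)
      (cong (λ u → block-word global-entry 0 ++ block-word (boundary-entry zero) 0 ++ u)
        (cong₂ _++_ (cong₂ _++_
          (trans (concat-tabulate-cong {f = λ j → cell-word h (suc (inject₁ (inject₁ j)))} {g = block-word interior-entry ∘ toℕ}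
                   (λ j → concat-tabulate-cong {f = λ c → h (inj₂ (suc (inject₁ (inject₁ j)) , c))}
                     (λ c → trans (cong place-word (place-interior j c)) (cong (λ m → entry-word m (interior-entry c)) (Fin.toℕ-inject₁ j)))))
                 (concat-tabulate-series S (block-word interior-entry)))
          (concat-tabulate-cong {f = λ c → h (inj₂ (suc (inject₁ (fromℕ S)) , c))}
            (λ c → trans (cong place-word (place-void₁ c)) (cong (λ m → entry-word m (boundary-entry (suc zero) c)) (Fin.toℕ-fromℕ S)))))
          (concat-tabulate-cong {f = λ c → h (inj₂ (suc (suc (fromℕ S)) , c))}
            (λ c → trans (cong place-word (place-void₂ c)) (cong (λ m → entry-word m (boundary-entry (suc (suc zero)) c)) (Fin.toℕ-fromℕ S))))))))
      where
      h : Loc → Word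
      h = place-word ∘ place

    initial : (ℕ → Maybe Bool) → Fin (3 + S) → Fin contents
    initial s zero    = edge
    initial s (suc i) = maybe (λ j → maybe (λ _ → initial-content (s (suc (toℕ j)))) void (lower j)) void (lower i)

    initial-interior : ∀ s j → initial s (suc (inject₁ (inject₁ j))) ≡ initial-content (s (suc (toℕ j)))
    initial-interior s j rewrite lower-inject₁ (inject₁ j) | lower-inject₁ j | Fin.toℕ-inject₁ j = refl

    initial-void₁ : ∀ s → initial s (suc (inject₁ (fromℕ S))) ≡ void
    initial-void₁ s rewrite lower-inject₁ (fromℕ S) | lower-fromℕ S = refl

    initial-void₂ : ∀ s → initial s (suc (suc (fromℕ S))) ≡ void
    initial-void₂ s rewrite lower-fromℕ S = refl

    target-bit : (ℕ → Maybe Bool) → Loc → Bool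
    target-bit s (inj₁ a)       = global-bit (initial-global (s 0)) a
    target-bit s (inj₂ (i , c)) = fact-bit (initial s i) c

    targets : (ℕ → Maybe Bool) → Subset size
    targets s = Vec.tabulate (target-bit s ∘ decode)

    toList-targets : ∀ s → Vec.toList (targets s) ≡
      tabulate (global-bit (initial-global (s 0))) ++ tabulate (fact-bit edge) ++
      (series S (λ m → tabulate (fact-bit (initial-content (s (suc m))))) ++ tabulate (fact-bit void)) ++
      tabulate (fact-bit void)
    toList-targets s = trans (toList-tabulate (target-bit s ∘ decode)) (trans (tabulate-singletons (target-bit s ∘ decode))
      (trans (concat-locations h)
      (cong₂ _++_ (sym (tabulate-singletons (global-bit (initial-global (s 0)))))
      (cong₂ _++_ (cells zero refl)
      (cong₂ _++_ (cong₂ _++_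
          (trans (concat-tabulate-cong {f = λ j → cell-word h (suc (inject₁ (inject₁ j)))} {g = bits ∘ toℕ}
                   (λ j → cells (suc (inject₁ (inject₁ j))) (initial-interior s j)))
                 (concat-tabulate-series S bits))
          (cells (suc (inject₁ (fromℕ S))) (initial-void₁ s)))
          (cells (suc (suc (fromℕ S))) (initial-void₂ s)))))))
      where
      h : Loc → Word
      h l = target-bit s l ∷ []
      bits : ℕ → Word
      bits m = tabulate (fact-bit (initial-content (s (suc m))))
      cells : ∀ i {v} → initial s i ≡ v → cell-word h i ≡ tabulate (fact-bit v)
      cells i refl = sym (tabulate-singletons (fact-bit (initial s i)))

    data View : Fin (3 + S) → Set where
      leftmost : View zero
      interior : ∀ j → View (suc (inject₁ (inject₁ j)))
      void₁    : View (suc (inject₁ (fromℕ S)))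
      void₂    : View (suc (suc (fromℕ S)))

    view : ∀ i → View i
    view zero = leftmost
    view (suc i) with Top.view i
    ... | Top.‵fromℕ = void₂
    ... | Top.‵inject₁ j with Top.view j
    ...   | Top.‵fromℕ      = void₁
    ...   | Top.‵inject₁ j′ = interior j′

  -- A successor unfolds by computation to two successors, one for each transition that a step of
  -- the automaton takes; `2 * suc t` would expose only one.
  twice : ℕ → ℕ
  twice zero    = zero
  twice (suc t) = suc (suc (twice t))

  -- The parameters describe a run of the automaton. The size `suc n` makes cell 1 interior, as the
  -- claims about the global state are examined there.
  module Run
    (n : ℕ) (s : ℕ → Maybe Bool) (global : ℕ → Fin globals) (content : ℕ → ℕ → Fin contents)
    (edge-kept : ∀ t → content t 0 ≡ edge)
    (void-beyond : ∀ t i → suc n < i → content t i ≡ void)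
    (global-zero : global 0 ≡ initial-global (s 0))
    (content-zero : ∀ i → i ≤ n → content 0 (suc i) ≡ initial-content (s (suc i)))
    (global-suc : ∀ t → global (suc t) ≡ next-global (global t) (content t 0) (content t 1) (content t 2))
    (content-suc : ∀ t i → i ≤ n →
      content (suc t) (suc i) ≡ next-content (global t) (content t i) (content t (suc i)) (content t (suc (suc i))))
    where

    open Size (suc n)

    Wins-process : ℕ → Fin size → Set
    Wins-process = Wins process (targets s)

    Wins-place : ℕ → Place → Set
    Wins-place m (j , e) = Wins-as (Entry.kind e) (Wins-process m) (transitions (j , e))

    Wins-code : ∀ m l → Wins-process (suc m) (code l) ≡ Wins-place m (place l)
    Wins-code m l = cong (Wins-place m ∘ place) (decode-code l)

    lookup-targets : ∀ l → Vec.lookup (targets s) (code l) ≡ target-bit s l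
    lookup-targets l = trans (Vec.lookup∘tabulate (target-bit s ∘ decode) (code l)) (cong (target-bit s) (decode-code l))

    sink-loses : ∀ m → ¬ Wins-process m zero
    sink-loses zero    ()
    sink-loses (suc m) (here win) = sink-loses m win

    choose-wins : ∀ m j {k} (f : Fin k → Ref) (inj : ∀ {a b} → f a ≡ f b → a ≡ b)
      (f≢ : ∀ a → glob zero ≢ f a) {P : Fin k → Set} (P? : ∀ i → Dec (P i)) →
      Wins-place m (j , choose f inj f≢ P?) ⇔ (∃ λ i → P i × Wins-process m (code (resolve j (f i))))
    choose-wins m j f inj f≢ P? = mk⇔ to from
      where
      to : Wins-place m (j , choose f inj f≢ P?) → _
      to (here win)  = ⊥-elim (sink-loses m win)
      to (there win) =
        let (i , i∈ , win′) = find (Any.map⁻ (Any.map⁻ win))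
        in i , proj₂ (∈-filter⁻ P? {xs = allFin _} i∈) , win′
      from : (∃ λ i → _ × Wins-process m (code (resolve j (f i)))) → Wins-place m (j , choose f inj f≢ P?)
      from (i , Pi , win) = there (Any.map⁺ (Any.map⁺ (lose (∈-filter⁺ P? (∈-allFin i) Pi) win)))

    Actual : ℕ → ℕ → Fin globals × Fin contents × Fin contents × Fin contents
    Actual t i = global t , content t i , content t (suc i) , content t (suc (suc i))

    GlobalClaims CellClaims : ℕ → Set
    GlobalClaims t = ∀ g → Wins-process (twice t) (code (inj₁ (global-fact g))) ⇔ (global t ≡ g)
    CellClaims   t = ∀ i y → Wins-process (twice t) (code (inj₂ (i , fact y))) ⇔ (content t (toℕ i) ≡ y)

    does-true : ∀ {A : Set} (d : Dec A) → (does d ≡ true) ⇔ A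
    does-true (yes a) = mk⇔ (λ _ → a) (λ _ → refl)
    does-true (no ¬a) = mk⇔ (λ ()) (λ a → ⊥-elim (¬a a))

    ≡-⇔ : ∀ {A B : Set} → A ≡ B → A ⇔ B
    ≡-⇔ refl = mk⇔ (λ a → a) (λ a → a)

    toℕ-left : ∀ j → toℕ (inject₁ (inject₁ (inject₁ {suc n} j))) ≡ toℕ j
    toℕ-left j = trans (Fin.toℕ-inject₁ _) (trans (Fin.toℕ-inject₁ _) (Fin.toℕ-inject₁ j))

    toℕ-here : ∀ j → toℕ (suc (inject₁ (inject₁ {suc n} j))) ≡ suc (toℕ j)
    toℕ-here j = cong suc (trans (Fin.toℕ-inject₁ _) (Fin.toℕ-inject₁ j))

    toℕ-right : ∀ j → toℕ (suc (suc (inject₁ {suc n} j))) ≡ suc (suc (toℕ j))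
    toℕ-right j = cong (λ k → suc (suc k)) (Fin.toℕ-inject₁ j)

    void₁-beyond : suc n < toℕ (suc (inject₁ (fromℕ (suc n))))
    void₁-beyond = s≤s (ℕ.≤-reflexive (sym (trans (Fin.toℕ-inject₁ _) (Fin.toℕ-fromℕ (suc n)))))

    void₂-beyond : suc n < toℕ (suc (suc (fromℕ (suc n))))
    void₂-beyond = s≤s (ℕ.≤-trans (ℕ.≤-reflexive (sym (Fin.toℕ-fromℕ (suc n)))) (ℕ.n≤1+n _))

    content-initial : ∀ i → content 0 (toℕ i) ≡ initial s i
    content-initial i with view i
    ... | leftmost   = edge-kept 0
    ... | interior j = trans (cong (content 0) (toℕ-here j))
                         (trans (content-zero (toℕ j) (Fin.toℕ≤pred[n] j)) (sym (initial-interior s j)))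
    ... | void₁      = trans (void-beyond 0 _ void₁-beyond)
                         (sym (initial-void₁ s))
    ... | void₂      = trans (void-beyond 0 _ void₂-beyond)
                         (sym (initial-void₂ s))

    global-claims-zero : GlobalClaims 0
    global-claims-zero g = does-true (global 0 Fin.≟ g) ⇔∘ ≡-⇔ (cong (_≡ true)
      (trans (lookup-targets (inj₁ (global-fact g))) (cong (λ h → does (h Fin.≟ g)) (sym global-zero))))

    cell-claims-zero : CellClaims 0
    cell-claims-zero i y = does-true (content 0 (toℕ i) Fin.≟ y) ⇔∘ ≡-⇔ (cong (_≡ true)
      (trans (lookup-targets (inj₂ (i , fact y)))
      (trans (cong (fact-bit′ (initial s i)) (Fin.splitAt-↑ˡ contents y neighbourhoods))
             (cong (λ v → does (v Fin.≟ y)) (sym (content-initial i))))))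

    -- Chance may examine each of the four components, so all of them must be true.
    check-wins : ∀ t → GlobalClaims t → CellClaims t → ∀ j k →
      Wins-process (suc (twice t)) (code (inj₂ (suc (inject₁ (inject₁ j)) , check k))) ⇔ (neighbourhood k ≡ Actual t (toℕ j))
    check-wins t globals-ok cells-ok j k = mk⇔ (only-actual (neighbourhood k)) (actual (neighbourhood k))
      ⇔∘ ≡-⇔ (trans (Wins-code (twice t) (inj₂ (suc (inject₁ (inject₁ j)) , check k)))
      (cong (Wins-place (twice t)) (trans (place-interior j (check k))
        (cong (λ r → inject₁ j , interior-entry′ r) (Fin.splitAt-↑ʳ contents neighbourhoods k)))))
      where
      open Equivalence
      moved : ∀ {i i′ y} → i ≡ i′ → content t i ≡ y → content t i′ ≡ y
      moved refl eq = eq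
      only-actual : ∀ nb → Wins-place (twice t) (inject₁ j , check-entry nb) → nb ≡ Actual t (toℕ j)
      only-actual (g , a , b , c) (wg ∷ wa ∷ wb ∷ wc ∷ []) = sym (cong₂ _,_ (to (globals-ok g) wg)
        (cong₂ _,_ (moved (toℕ-left j) (to (cells-ok _ a) wa))
        (cong₂ _,_ (moved (toℕ-here j) (to (cells-ok _ b) wb))
                   (moved (toℕ-right j) (to (cells-ok (suc (suc (inject₁ j))) c) wc)))))
      actual : ∀ nb → nb ≡ Actual t (toℕ j) → Wins-place (twice t) (inject₁ j , check-entry nb)
      actual .(Actual t (toℕ j)) refl =
          from (globals-ok _) refl
        ∷ from (cells-ok _ _) (cong (content t) (toℕ-left j))
        ∷ from (cells-ok _ _) (cong (content t) (toℕ-here j))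
        ∷ from (cells-ok (suc (suc (inject₁ j))) _) (cong (content t) (toℕ-right j))
        ∷ []

    -- Only the actual neighbourhood wins, and it is on offer exactly if its update is the claimed
    -- value. The update `f′` is left open to cover both the global state and the cells.
    justify-wins : ∀ t → GlobalClaims t → CellClaims t → ∀ j {m y} (f : Fin neighbourhoods → Fin m)
      (f′ : Fin globals × Fin contents × Fin contents × Fin contents → Fin m) → (∀ k → f k ≡ f′ (neighbourhood k)) →
      Wins-place (suc (twice t)) (inject₁ j , justify (λ k → f k Fin.≟ y)) ⇔ (f′ (Actual t (toℕ j)) ≡ y)
    justify-wins t globals-ok cells-ok j {y = y} f f′ f≡f′ = mk⇔
      (λ (k , fk≡y , win) → trans (cong f′ (sym (to (claim k) win))) (trans (sym (f≡f′ k)) fk≡y))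
      (λ eq → let k = index Neighbourhood-finite (Actual t (toℕ j))
                  k-actual = unindex-index Neighbourhood-finite (Actual t (toℕ j))
              in k , trans (f≡f′ k) (trans (cong f′ k-actual) eq) , from (claim k) k-actual)
      ⇔∘ choose-wins (suc (twice t)) (inject₁ j) here-check
           (λ eq → Fin.↑ʳ-injective contents _ _ (cell-injective eq)) (λ _ ()) (λ k → f k Fin.≟ y)
      where
      open Equivalence
      claim : ∀ k → Wins-process (suc (twice t)) (code (inj₂ (suc (inject₁ (inject₁ j)) , check k))) ⇔
                    (neighbourhood k ≡ Actual t (toℕ j))
      claim = check-wins t globals-ok cells-ok j

    global-claims-suc : ∀ t → GlobalClaims t → CellClaims t → GlobalClaims (suc t)
    global-claims-suc t globals-ok cells-ok g =
      ≡-⇔ (cong (_≡ g) (sym (global-suc t)))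
      ⇔∘ justify-wins t globals-ok cells-ok zero next-global-of (λ (h , a , b , c) → next-global h a b c) (λ _ → refl)
      ⇔∘ ≡-⇔ (Wins-code (suc (twice t)) (inj₁ (global-fact g)))

    boundary-wins : ∀ m {v y} i j p → place (inj₂ (i , fact y)) ≡ (j , boundary-entry p (fact y)) → position j p ≡ i →
      Wins-process m (code (inj₂ (i , fact y))) ⇔ (v ≡ y) → Wins-process (suc m) (code (inj₂ (i , fact y))) ⇔ (v ≡ y)
    boundary-wins m {v} {y} i j p place≡ refl previous =
      previous ⇔∘ mk⇔ (λ { (here win) → win ; (there ()) }) here
      ⇔∘ ≡-⇔ (trans (Wins-code m (inj₂ (i , fact y))) (cong (Wins-place m) place≡))

    -- Two transitions pass in place while the automaton makes one step.
    boundary-kept : ∀ t {y} i j p → place (inj₂ (i , fact y)) ≡ (j , boundary-entry p (fact y)) → position j p ≡ i →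
      content (suc t) (toℕ i) ≡ content t (toℕ i) →
      Wins-process (twice t) (code (inj₂ (i , fact y))) ⇔ (content t (toℕ i) ≡ y) →
      Wins-process (twice (suc t)) (code (inj₂ (i , fact y))) ⇔ (content (suc t) (toℕ i) ≡ y)
    boundary-kept t {y} i j p place≡ position≡ same previous = ≡-⇔ (cong (_≡ y) (sym same))
      ⇔∘ boundary-wins (suc (twice t)) i j p place≡ position≡ (boundary-wins (twice t) i j p place≡ position≡ previous)

    cell-claims-suc : ∀ t → GlobalClaims t → CellClaims t → CellClaims (suc t)
    cell-claims-suc t globals-ok cells-ok i y with view i
    ... | interior j =
      ≡-⇔ (cong (_≡ y) (sym (trans (cong (content (suc t)) (toℕ-here j)) (content-suc t (toℕ j) (Fin.toℕ≤pred[n] j)))))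
      ⇔∘ justify-wins t globals-ok cells-ok j next-content-of (λ (h , a , b , c) → next-content h a b c) (λ _ → refl)
      ⇔∘ ≡-⇔ (trans (Wins-code (suc (twice t)) (inj₂ (suc (inject₁ (inject₁ j)) , fact y)))
        (cong (Wins-place (suc (twice t))) (trans (place-interior j (fact y))
          (cong (λ r → inject₁ j , interior-entry′ r) (Fin.splitAt-↑ˡ contents y neighbourhoods)))))
    ... | leftmost = boundary-kept t zero zero zero refl refl (trans (edge-kept (suc t)) (sym (edge-kept t))) (cells-ok zero y)
    ... | void₁ = boundary-kept t _ (fromℕ (suc n)) (suc zero) (place-void₁ (fact y)) refl
                    (trans (void-beyond (suc t) _ void₁-beyond) (sym (void-beyond t _ void₁-beyond))) (cells-ok _ y)
    ... | void₂ = boundary-kept t _ (fromℕ (suc n)) (suc (suc zero)) (place-void₂ (fact y)) refl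
                    (trans (void-beyond (suc t) _ void₂-beyond) (sym (void-beyond t _ void₂-beyond))) (cells-ok _ y)

    claims : ∀ t → GlobalClaims t × CellClaims t
    claims zero    = global-claims-zero , cell-claims-zero
    claims (suc t) = let (gs , cs) = claims t in global-claims-suc t gs cs , cell-claims-suc t gs cs

    initially : Fin size
    initially = suc zero

    start-wins : ∀ t → Wins-process (suc (twice t)) initially ⇔ (accepts (global t) ≡ true)
    start-wins t = mk⇔
      (λ (g , acc , win) → trans (cong accepts (to (proj₁ (claims t) g) win)) acc)
      (λ acc → global t , acc , from (proj₁ (claims t) (global t)) refl)
      ⇔∘ choose-wins (twice t) zero (glob ∘ global-fact) (λ { refl → refl }) (λ _ ()) (λ g → accepts g Bool.≟ true)
      ⇔∘ ≡-⇔ (Wins-code (twice t) (inj₁ (suc zero)))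
      where open Equivalence

    transitions-decrement : ∀ q → All (λ t → proj₁ t ≡ dec) (OCMDP.δ₊ process q)
    transitions-decrement q = All.map⁺ (All.universal (λ _ → refl) (Entry.refs (proj₂ (place (decode q)))))

    quarter≤1 : quarter ℚ.≤ 1ℚ
    quarter≤1 = toWitness {a? = quarter ℚ.≤? 1ℚ} tt

    open CountdownGame process (targets s) zero refl (λ _ → refl ∷ []) transitions-decrement
      quarter (ℚ.positive⁻¹ quarter) quarter≤1 (λ _ _ _ → ℚ.≤-refl)

    start-ValOne : ∀ t → ValOne process (targets s) (initially , suc (twice t)) ⇔ (accepts (global t) ≡ true)
    start-ValOne t = start-wins t ⇔∘ mk⇔ (ValOne⇒Wins initially (suc (twice t))) (Wins⇒ValOne initially (suc (twice t)))

-- Machines as automata.  Cell i > 0 holds, for each tape, the symbols at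
-- distance i to the left and to the right of the head, so that a step moves
-- contents only between neighbouring cells.

at : ∀ {A : Set} → List A → ℕ → Maybe A
at []       i       = nothing
at (a ∷ as) zero    = just a
at (a ∷ as) (suc i) = at as i

module _ {aux : ℕ} where

  symbol : Maybe Bool → Symbol aux
  symbol = maybe bit blank

  read : List (Symbol aux) → ℕ → Symbol aux
  read []       i       = blank
  read (a ∷ as) zero    = a
  read (a ∷ as) (suc i) = read as i

  read-bits : ∀ w i → read (map bit w) i ≡ symbol (at w i)
  read-bits []      i       = refl
  read-bits (b ∷ w) zero    = refl
  read-bits (b ∷ w) (suc i) = read-bits w i

  read-beyond : ∀ as {i} → length as ≤ i → read as i ≡ blank
  read-beyond []       ≤i       = refl
  read-beyond (a ∷ as) (s≤s ≤i) = read-beyond as ≤i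

module Simulation (M : TM) where
  open TM M

  Pair Content Global : Set
  Pair    = Γ × Γ
  -- The content of cell 0 is nothing.
  Content = Maybe (Vec Pair Tapes)
  Global  = Fin states × Vec Γ Tapes

  -- Abstract, as unfolding these bijections makes type checking slow.
  abstract
    Content-finite : Finite Content
    Content-finite = Maybe-finite (Vec-finite Tapes (Symbol-finite aux ×-finite Symbol-finite aux))

    Global-finite : Finite Global
    Global-finite = Fin-finite states ×-finite Vec-finite Tapes (Symbol-finite aux)

  pair : Tape Γ → ℕ → Pair
  pair t i = read (before t) i , read (after t) i

  pairs : Vec (Tape Γ) Tapes → ℕ → Vec Pair Tapes
  pairs ts i = Vec.tabulate λ k → pair (Vec.lookup ts k) i

  new-head : Γ × Move → Pair → Γ
  new-head (b , left)  (l , r) = l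
  new-head (b , right) (l , r) = r
  new-head (b , none)  (l , r) = b

  -- `p` is `nothing` next to the heads; what moves in from there is the symbol `b` just written.
  new-pair : Γ × Move → Maybe Pair → Pair → Pair → Pair
  new-pair (b , left)  p c n = proj₁ n , maybe proj₂ b p
  new-pair (b , right) p c n = maybe proj₁ b p , proj₂ n
  new-pair (b , none)  p c n = c

  head-act : ∀ (a : Γ × Move) (t : Tape Γ) → head (act a t) ≡ new-head a (pair t 0)
  head-act (b , left)  (tape []      _ rs)      = refl
  head-act (b , left)  (tape (_ ∷ _) _ rs)      = refl
  head-act (b , right) (tape ls _ [])           = refl
  head-act (b , right) (tape ls _ (_ ∷ _))      = refl
  head-act (b , none)  t                        = refl

  pair-act-zero : ∀ (a : Γ × Move) (t : Tape Γ) → pair (act a t) 0 ≡ new-pair a nothing (pair t 0) (pair t 1)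
  pair-act-zero (b , left)  (tape []      _ rs)      = refl
  pair-act-zero (b , left)  (tape (_ ∷ _) _ rs)      = refl
  pair-act-zero (b , right) (tape ls _ [])           = refl
  pair-act-zero (b , right) (tape ls _ (_ ∷ _))      = refl
  pair-act-zero (b , none)  t                        = refl

  pair-act-suc : ∀ (a : Γ × Move) (t : Tape Γ) i →
    pair (act a t) (suc i) ≡ new-pair a (just (pair t i)) (pair t (suc i)) (pair t (suc (suc i)))
  pair-act-suc (b , left)  (tape []      _ rs)      i = refl
  pair-act-suc (b , left)  (tape (_ ∷ _) _ rs)      i = refl
  pair-act-suc (b , right) (tape ls _ [])           i = refl
  pair-act-suc (b , right) (tape ls _ (_ ∷ _))      i = refl
  pair-act-suc (b , none)  t                        i = refl

  new-heads : Vec (Γ × Move) Tapes → Vec Pair Tapes → Vec Γ Tapes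
  new-heads as c = Vec.tabulate λ k → new-head (Vec.lookup as k) (Vec.lookup c k)

  new-pairs : Vec (Γ × Move) Tapes → Content → Vec Pair Tapes → Vec Pair Tapes → Vec Pair Tapes
  new-pairs as p c n = Vec.tabulate λ k →
    new-pair (Vec.lookup as k) (Maybe.map (λ v → Vec.lookup v k) p) (Vec.lookup c k) (Vec.lookup n k)

  lookup-pairs : ∀ (ts : Vec (Tape Γ) Tapes) i k → Vec.lookup (pairs ts i) k ≡ pair (Vec.lookup ts k) i
  lookup-pairs ts i = Vec.lookup∘tabulate (λ k → pair (Vec.lookup ts k) i)

  lookup-act : ∀ (as : Vec (Γ × Move) Tapes) (ts : Vec (Tape Γ) Tapes) k →
    Vec.lookup (Vec.zipWith act as ts) k ≡ act (Vec.lookup as k) (Vec.lookup ts k)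
  lookup-act as ts k = Vec.lookup-zipWith act k as ts

  heads-act : ∀ (as : Vec (Γ × Move) Tapes) (ts : Vec (Tape Γ) Tapes) →
    Vec.map head (Vec.zipWith act as ts) ≡ new-heads as (pairs ts 0)
  heads-act as ts = trans (sym (Vec.tabulate∘lookup _)) (Vec.tabulate-cong λ k →
    trans (Vec.lookup-map k head (Vec.zipWith act as ts))
    (trans (cong head {Vec.lookup (Vec.zipWith act as ts) k} {act (Vec.lookup as k) (Vec.lookup ts k)} (lookup-act as ts k))
    (trans (head-act (Vec.lookup as k) (Vec.lookup ts k))
           (cong (new-head (Vec.lookup as k)) (sym (lookup-pairs ts 0 k))))))

  pairs-act-zero : ∀ (as : Vec (Γ × Move) Tapes) (ts : Vec (Tape Γ) Tapes) →
    pairs (Vec.zipWith act as ts) 0 ≡ new-pairs as nothing (pairs ts 0) (pairs ts 1)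
  pairs-act-zero as ts = Vec.tabulate-cong λ k →
    trans (cong (λ t → pair t 0) (lookup-act as ts k))
    (trans (pair-act-zero (Vec.lookup as k) (Vec.lookup ts k))
           (cong₂ (new-pair (Vec.lookup as k) nothing) (sym (lookup-pairs ts 0 k)) (sym (lookup-pairs ts 1 k))))

  pairs-act-suc : ∀ (as : Vec (Γ × Move) Tapes) (ts : Vec (Tape Γ) Tapes) i → pairs (Vec.zipWith act as ts) (suc i) ≡
                  new-pairs as (just (pairs ts i)) (pairs ts (suc i)) (pairs ts (suc (suc i)))
  pairs-act-suc as ts i = Vec.tabulate-cong λ k →
    trans (cong (λ t → pair t (suc i)) (lookup-act as ts k))
    (trans (pair-act-suc (Vec.lookup as k) (Vec.lookup ts k) i)
    (trans (cong (λ p → new-pair (Vec.lookup as k) (just p) (pair (Vec.lookup ts k) (suc i)) (pair (Vec.lookup ts k) (suc (suc i))))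
                 (sym (lookup-pairs ts i k)))
           (cong₂ (new-pair (Vec.lookup as k) (just (Vec.lookup (pairs ts i) k)))
             (sym (lookup-pairs ts (suc i) k)) (sym (lookup-pairs ts (suc (suc i)) k)))))

  -- A halted machine keeps its configuration. The same default covers `nothing` as content of cell
  -- 1, which no configuration shows.
  update-global : Global → Content → Global
  update-global (q , hs) c with step q hs | c
  ... | just (q′ , as) | just v = q′ , new-heads as v
  ... | _              | _      = q , hs

  update-content : Global → Content → Content → Content → Content
  update-content (q , hs) p c n with step q hs | c | n
  ... | just (_ , as) | just v | just v′ = just (new-pairs as p v v′)
  ... | _             | _      | _       = c

  blank-pairs : Vec Pair Tapes
  blank-pairs = Vec.replicate Tapes (blank , blank)

  global-code : Global → Fin (proj₁ Global-finite)
  global-code = index Global-finite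

  content-code : Content → Fin (proj₁ Content-finite)
  content-code = index Content-finite

  global-value : Fin (proj₁ Global-finite) → Global
  global-value = unindex Global-finite

  content-value : Fin (proj₁ Content-finite) → Content
  content-value = unindex Content-finite

  automaton : Automaton
  automaton = record
    { globals         = proj₁ Global-finite
    ; contents        = proj₁ Content-finite
    ; next-global     = λ g _ c _ → global-code (update-global (global-value g) (content-value c))
    ; next-content    = λ g p c n → content-code
        (update-content (global-value g) (content-value p) (content-value c) (content-value n))
    ; edge            = content-code nothing
    ; void            = content-code (just blank-pairs)
    ; initial-global  = λ m → global-code (initial , symbol m ∷ Vec.replicate tapes-1 blank)
    ; initial-content = λ m → content-code (just ((blank , symbol m) ∷ Vec.replicate tapes-1 (blank , blank)))
    ; accepts         = λ g → accepting (proj₁ (global-value g))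
    }

  open Automaton automaton using (globals; contents; next-global; next-content; edge; void; initial-global; initial-content; accepts)

  global : Config M → Fin globals
  global (q , ts) = global-code (q , Vec.map head ts)

  cell-value : Config M → ℕ → Content
  cell-value c        zero    = nothing
  cell-value (q , ts) (suc i) = just (pairs ts i)

  content : Config M → ℕ → Fin contents
  content c i = content-code (cell-value c i)

  advance : Config M → Config M
  advance c = maybe (λ c′ → c′) c (stepConfig M c)

  run-halted : ∀ n {c} → Halted M c → run M n c ≡ c
  run-halted zero        halted = refl
  run-halted (suc n) {c} halted with stepConfig M c
  run-halted (suc n) refl | nothing = refl

  run-advance : ∀ n c → run M (suc n) c ≡ run M n (advance c)
  run-advance n c with stepConfig M c in eq
  ... | nothing = sym (run-halted n eq)
  ... | just c′ = refl

  run-suc : ∀ n c → run M (suc n) c ≡ advance (run M n c)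
  run-suc zero    c = run-advance zero c
  run-suc (suc n) c = trans (run-advance (suc n) c) (trans (run-suc n (advance c)) (cong advance (sym (run-advance n c))))

  run-+ : ∀ m n c → run M (m + n) c ≡ run M m (run M n c)
  run-+ zero    n c = refl
  run-+ (suc m) n c = trans (run-suc (m + n) c) (trans (cong advance (run-+ m n c)) (sym (run-suc m (run M n c))))

  run-beyond : ∀ {m n} c → Halted M (run M m c) → m ≤ n → run M n c ≡ run M m c
  run-beyond {m} {n} c halted m≤n = begin
    run M n c                   ≡⟨ cong (λ k → run M k c) (sym (ℕ.m∸n+n≡m m≤n)) ⟩
    run M (n ∸ m + m) c         ≡⟨ run-+ (n ∸ m) m c ⟩
    run M (n ∸ m) (run M m c)   ≡⟨ run-halted (n ∸ m) halted ⟩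
    run M m c                   ∎
    where open ≡-Reasoning

  run-final : ∀ {m n} c → Halted M (run M m c) → Halted M (run M n c) → run M m c ≡ run M n c
  run-final {m} {n} c hm hn with ℕ.≤-total m n
  ... | inj₁ m≤n = sym (run-beyond c hm m≤n)
  ... | inj₂ n≤m = run-beyond c hn n≤m

  update-global-advance : ∀ c → update-global (proj₁ c , Vec.map head (proj₂ c)) (cell-value c 1) ≡
                          (proj₁ (advance c) , Vec.map head (proj₂ (advance c)))
  update-global-advance (q , ts) with step q (Vec.map head ts)
  ... | nothing        = refl
  ... | just (q′ , as) = cong (q′ ,_) (sym (heads-act as ts))

  update-content-advance : ∀ c i →
    update-content (proj₁ c , Vec.map head (proj₂ c)) (cell-value c i) (cell-value c (suc i)) (cell-value c (suc (suc i)))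
    ≡ cell-value (advance c) (suc i)
  update-content-advance (q , ts) i with step q (Vec.map head ts)
  update-content-advance (q , ts) i       | nothing       = refl
  update-content-advance (q , ts) zero    | just (_ , as) = cong just (sym (pairs-act-zero as ts))
  update-content-advance (q , ts) (suc i) | just (_ , as) = cong just (sym (pairs-act-suc as ts i))

  global-advance : ∀ c → global (advance c) ≡ next-global (global c) (content c 0) (content c 1) (content c 2)
  global-advance c = sym (cong global-code (trans
    (cong₂ update-global (unindex-index Global-finite _) (unindex-index Content-finite (cell-value c 1)))
    (update-global-advance c)))

  content-advance : ∀ c i → content (advance c) (suc i) ≡
    next-content (global c) (content c i) (content c (suc i)) (content c (suc (suc i)))
  content-advance c i = sym (cong content-code (trans
    (cong₂ (λ g p → update-content g p (content-value (content c (suc i))) (content-value (content c (suc (suc i)))))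
      (unindex-index Global-finite _) (unindex-index Content-finite (cell-value c i)))
    (trans (cong₂ (update-content (proj₁ c , Vec.map head (proj₂ c)) (cell-value c i))
             (unindex-index Content-finite (cell-value c (suc i))) (unindex-index Content-finite (cell-value c (suc (suc i)))))
           (update-content-advance c i))))

  accepts-global : ∀ c → (accepts (global c) ≡ true) ⇔ Accepting M c
  accepts-global c = mk⇔
    (λ eq → subst T (sym (trans (sym q≡) eq)) tt)
    (λ acc → trans q≡ (Equivalence.to Bool.T-≡ acc))
    where
    q≡ : accepts (global c) ≡ accepting (proj₁ c)
    q≡ = cong (accepting ∘ proj₁) (unindex-index Global-finite (proj₁ c , Vec.map head (proj₂ c)))

  size≤space : ∀ c k → tapeSize (Vec.lookup (proj₂ c) k) ≤ space M c
  size≤space (_ , ts) = lookup≤sum ts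
    where
    lookup≤sum : ∀ {n} (ts : Vec (Tape Γ) n) k → tapeSize (Vec.lookup ts k) ≤ Vec.sum (Vec.map tapeSize ts)
    lookup≤sum (t ∷ ts) zero    = ℕ.m≤m+n _ _
    lookup≤sum (t ∷ ts) (suc k) = ℕ.≤-trans (lookup≤sum ts k) (ℕ.m≤n+m _ _)

  -- Cell `suc i` shows entry `i` of the stored lists, and with S ≤ i no list of a tape with at most
  -- S stored cells reaches that far.
  content-beyond : ∀ c {S i} → space M c ≤ S → S < i → content c i ≡ void
  content-beyond c@(q , ts) {S} {suc i} space≤S (s≤s S≤i) = cong (content-code ∘ just) (begin
    Vec.tabulate (λ k → pair (Vec.lookup ts k) i)        ≡⟨ Vec.tabulate-cong (λ k → cong₂ _,_
                                                              (read-beyond (before (Vec.lookup ts k)) (before≤ k))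
                                                              (read-beyond (after (Vec.lookup ts k)) (after≤ k))) ⟩
    Vec.tabulate (λ _ → blank , blank)                   ≡⟨ Vec.tabulate-cong (λ k → sym (Vec.lookup-replicate k (blank , blank))) ⟩
    Vec.tabulate (Vec.lookup blank-pairs)                ≡⟨ Vec.tabulate∘lookup blank-pairs ⟩
    blank-pairs                                          ∎)
    where
    open ≡-Reasoning
    size≤ : ∀ k → tapeSize (Vec.lookup ts k) ≤ i
    size≤ k = ℕ.≤-trans (size≤space c k) (ℕ.≤-trans space≤S S≤i)
    before≤ : ∀ k → length (before (Vec.lookup ts k)) ≤ i
    before≤ k = ℕ.≤-trans (ℕ.m≤m+n _ _) (size≤ k)
    after≤ : ∀ k → length (after (Vec.lookup ts k)) ≤ i
    after≤ k = ℕ.≤-trans (ℕ.≤-trans (ℕ.n≤1+n _) (ℕ.m≤n+m _ _)) (size≤ k)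

  head-fromList : ∀ (as : List Γ) → head (fromList as) ≡ read as 0
  head-fromList []       = refl
  head-fromList (a ∷ as) = refl

  pair-fromList : ∀ (as : List Γ) i → pair (fromList as) i ≡ (blank , read as (suc i))
  pair-fromList []       i = refl
  pair-fromList (a ∷ as) i = refl

  global-init : ∀ w → global (init M w) ≡ initial-global (at w 0)
  global-init w = cong (λ hs → global-code (initial , hs)) (cong₂ _∷_
    (trans (head-fromList (map bit w)) (read-bits w 0))
    (Vec.map-replicate head (fromList []) tapes-1))

  content-init : ∀ w i → content (init M w) (suc i) ≡ initial-content (at w (suc i))
  content-init w i = cong (content-code ∘ just) (cong₂ _∷_
    (trans (pair-fromList (map bit w) i) (cong (blank ,_) (read-bits w (suc i))))
    (trans (Vec.tabulate-cong (λ k → cong (λ t → pair t i) (Vec.lookup-replicate k (fromList []))))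
    (trans (Vec.tabulate-cong (λ k → sym (Vec.lookup-replicate k (blank , blank)))) (Vec.tabulate∘lookup _))))

  -- Halting within the number of configurations

  module Halting (w : Word) (S : ℕ) (space≤S : ∀ t → space M (run M t (init M w)) ≤ S) where

    config : ℕ → Config M
    config t = run M t (init M w)

    -- Cells 0 to S + 2 determine the remaining ones, which are blank within the space bound.
    snapshots : ℕ
    snapshots = globals * contents ^ (3 + S)

    snapshot : ℕ → Fin snapshots
    snapshot t = combine (global (config t)) (funToFin {3 + S} (content (config t) ∘ toℕ))

    -- Equality as the automaton sees it. Equal configurations would be too much to ask for, as
    -- tapes may store different numbers of visited blanks.
    Same : ℕ → ℕ → Set
    Same i j = global (config i) ≡ global (config j) × (∀ k → content (config i) k ≡ content (config j) k)

    snapshot-same : ∀ i j → snapshot i ≡ snapshot j → Same i j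
    snapshot-same i j eq = proj₁ both , agree
      where
      both : global (config i) ≡ global (config j) ×
             funToFin {3 + S} (content (config i) ∘ toℕ) ≡ funToFin {3 + S} (content (config j) ∘ toℕ)
      both = Fin.combine-injective (global (config i)) _ (global (config j)) _ eq
      agree : ∀ k → content (config i) k ≡ content (config j) k
      agree k with k ℕ.<? 3 + S
      ... | yes k< = begin
        content (config i) k                      ≡⟨ cong (content (config i)) (sym (Fin.toℕ-fromℕ< k<)) ⟩
        content (config i) (toℕ (fromℕ< k<))      ≡⟨ sym (Fin.finToFun-funToFin (content (config i) ∘ toℕ) (fromℕ< k<)) ⟩
        _                                         ≡⟨ cong (λ f → finToFun {contents} {3 + S} f (fromℕ< k<)) (proj₂ both) ⟩
        _                                         ≡⟨ Fin.finToFun-funToFin (content (config j) ∘ toℕ) (fromℕ< k<) ⟩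
        content (config j) (toℕ (fromℕ< k<))      ≡⟨ cong (content (config j)) (Fin.toℕ-fromℕ< k<) ⟩
        content (config j) k                      ∎
        where open ≡-Reasoning
      ... | no k≮ = trans (content-beyond (config i) (space≤S i) S<k) (sym (content-beyond (config j) (space≤S j) S<k))
        where
        S<k : S < k
        S<k = ℕ.≤-trans (s≤s (ℕ.m≤n+m S 2)) (ℕ.≮⇒≥ k≮)

    same-suc : ∀ i j → Same i j → Same (suc i) (suc j)
    same-suc i j (gs , cs) =
        trans (cong global (run-suc i (init M w))) (trans (global-advance (config i)) (trans
          (trans (cong (λ g → next-global g (content (config i) 0) (content (config i) 1) (content (config i) 2)) gs)
                 (cong (λ c → next-global (global (config j)) (content (config i) 0) c (content (config i) 2)) (cs 1)))
          (trans (sym (global-advance (config j))) (cong global (sym (run-suc j (init M w)))))))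
      , λ { zero → refl ; (suc k) →
        trans (cong (λ c → content c (suc k)) (run-suc i (init M w))) (trans (content-advance (config i) k) (trans
          (trans (cong₂ (λ g p → next-content g p (content (config i) (suc k)) (content (config i) (suc (suc k)))) gs (cs k))
                 (cong₂ (next-content (global (config j)) (content (config j) k)) (cs (suc k)) (cs (suc (suc k)))))
          (trans (sym (content-advance (config j) k)) (cong (λ c → content c (suc k)) (sym (run-suc j (init M w))))))) }

    same-+ : ∀ k i j → Same i j → Same (k + i) (k + j)
    same-+ zero    i j same = same
    same-+ (suc k) i j same = same-suc (k + i) (k + j) (same-+ k i j same)

    halted-step : ∀ c → Halted M c ⇔ (uncurry step (global-value (global c)) ≡ nothing)
    halted-step c@(q , ts) rewrite unindex-index Global-finite (q , Vec.map head ts) with step q (Vec.map head ts)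
    ... | nothing = mk⇔ (λ _ → refl) (λ _ → refl)
    ... | just _  = mk⇔ (λ ()) (λ ())

    same-halted : ∀ i j → Same i j → Halted M (config j) → Halted M (config i)
    same-halted i j (gs , _) halted = Equivalence.from (halted-step (config i))
      (trans (cong (uncurry step ∘ global-value) gs) (Equivalence.to (halted-step (config j)) halted))

    halted? : ∀ c → Dec (Halted M c)
    halted? c with stepConfig M c
    ... | nothing = yes refl
    ... | just _  = no λ ()

    -- From time i on the run is periodic with period j - i, so a halting time after N could be
    -- shortened by the period; descent excludes it. A halting time up to N would make time N
    -- halted.
    repetition⇒running : ∀ i j {N} → i < j → j ≤ N → Same i j → ¬ Halted M (config N) → ∀ m → ¬ Halted M (config m)
    repetition⇒running i j {N} i<j j≤N same running = <-rec _ λ m earlier halted →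
      case-≤ m (ℕ.≤-total m N) earlier halted
      where
      case-≤ : ∀ m → m ≤ N ⊎ N ≤ m → (∀ {k} → k < m → ¬ Halted M (config k)) → ¬ Halted M (config m)
      case-≤ m (inj₁ m≤N) earlier halted = running (subst (Halted M) (sym (run-beyond (init M w) halted m≤N)) halted)
      case-≤ m (inj₂ N≤m) earlier halted = earlier {m ∸ j + i}
        (subst (m ∸ j + i <_) (ℕ.m∸n+n≡m j≤m) (ℕ.+-monoʳ-< (m ∸ j) i<j))
        (same-halted (m ∸ j + i) (m ∸ j + j) (same-+ (m ∸ j) i j same) (subst (Halted M ∘ config) (sym (ℕ.m∸n+n≡m j≤m)) halted))
        where
        j≤m : j ≤ m
        j≤m = ℕ.≤-trans j≤N N≤m

    halts-by : ∀ {N} → snapshots ≤ N → ∀ {t} → Halted M (config t) → Halted M (config N)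
    halts-by {N} enough {t} halted with halted? (config N)
    ... | yes now    = now
    ... | no running =
      -- The times 0 to N are one more than N, hence more than the snapshots.
      let (i , j , i<j , same) = Fin.pigeonhole (s≤s enough) (snapshot ∘ toℕ)
      in ⊥-elim (repetition⇒running (toℕ i) (toℕ j) i<j (Fin.toℕ≤pred[n] j) (snapshot-same (toℕ i) (toℕ j) same) running t halted)

-- Functions computed by polynomials

data PolyFun : (ℕ → ℕ) → Set where
  constant : ∀ a → PolyFun (λ _ → a)
  argument : PolyFun (λ n → n)
  _⊞_      : ∀ {f g} → PolyFun f → PolyFun g → PolyFun (λ n → f n + g n)
  _⊠_      : ∀ {f g} → PolyFun f → PolyFun g → PolyFun (λ n → f n * g n)

infixl 6 _⊞_
infixl 7 _⊠_

substitute : ∀ {f g} → PolyFun f → PolyFun g → PolyFun (f ∘ g)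
substitute (constant a) q = constant a
substitute argument     q = q
substitute (p ⊞ p′)     q = substitute p q ⊞ substitute p′ q
substitute (p ⊠ p′)     q = substitute p q ⊠ substitute p′ q

-- Serves to bound the cost of a loop body at every index by its cost at the last one.
PolyFun-mono : ∀ {f m n} → PolyFun f → m ≤ n → f m ≤ f n
PolyFun-mono (constant a) m≤n = ℕ.≤-refl
PolyFun-mono argument     m≤n = m≤n
PolyFun-mono (p ⊞ q)      m≤n = ℕ.+-mono-≤ (PolyFun-mono p m≤n) (PolyFun-mono q m≤n)
PolyFun-mono (p ⊠ q)      m≤n = ℕ.*-mono-≤ (PolyFun-mono p m≤n) (PolyFun-mono q m≤n)

add : Polynomial → Polynomial → Polynomial
add []      q       = q
add (a ∷ p) []      = a ∷ p
add (a ∷ p) (b ∷ q) = a + b ∷ add p q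

eval-add : ∀ p q n → eval (add p q) n ≡ eval p n + eval q n
eval-add []      q       n = refl
eval-add (a ∷ p) []      n = sym (ℕ.+-identityʳ _)
eval-add (a ∷ p) (b ∷ q) n = trans (cong (λ e → a + b + n * e) (eval-add p q n)) (rearrange a b n (eval p n) (eval q n))
  where
  rearrange : ∀ a b n x y → a + b + n * (x + y) ≡ a + n * x + (b + n * y)
  rearrange = solve 5 (λ a b n x y → a :+ b :+ n :* (x :+ y) := a :+ n :* x :+ (b :+ n :* y)) refl
    where open ℕ-Solver

multiply : Polynomial → Polynomial → Polynomial
multiply []      q = []
multiply (a ∷ p) q = add (map (a *_) q) (0 ∷ multiply p q)

eval-scale : ∀ a q n → eval (map (a *_) q) n ≡ a * eval q n
eval-scale a []      n = sym (ℕ.*-zeroʳ a)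
eval-scale a (b ∷ q) n = trans (cong (λ e → a * b + n * e) (eval-scale a q n)) (rearrange a b n (eval q n))
  where
  rearrange : ∀ a b n x → a * b + n * (a * x) ≡ a * (b + n * x)
  rearrange = solve 4 (λ a b n x → a :* b :+ n :* (a :* x) := a :* (b :+ n :* x)) refl
    where open ℕ-Solver

eval-multiply : ∀ p q n → eval (multiply p q) n ≡ eval p n * eval q n
eval-multiply []      q n = refl
eval-multiply (a ∷ p) q n = trans (eval-add (map (a *_) q) (0 ∷ multiply p q) n)
  (trans (cong₂ (λ e e′ → e + n * e′) (eval-scale a q n) (eval-multiply p q n)) (rearrange a n (eval p n) (eval q n)))
  where
  rearrange : ∀ a n x y → a * y + n * (x * y) ≡ (a + n * x) * y
  rearrange = solve 4 (λ a n x y → a :* y :+ n :* (x :* y) := (a :+ n :* x) :* y) refl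
    where open ℕ-Solver

-- Costs stay expressions while programs are composed; coefficients are computed once, for the whole
-- program.
polynomial : ∀ {f} → PolyFun f → ∃ λ p → ∀ n → f n ≡ eval p n
polynomial (constant a) = a ∷ [] , λ n → sym (trans (cong (a +_) (ℕ.*-zeroʳ n)) (ℕ.+-identityʳ a))
polynomial argument     = 0 ∷ 1 ∷ [] , λ n → sym (trans (cong (λ e → n * (1 + e)) (ℕ.*-zeroʳ n)) (ℕ.*-identityʳ n))
polynomial (p ⊞ q)      = let (p′ , p≡) = polynomial p ; (q′ , q≡) = polynomial q
  in add p′ q′ , λ n → trans (cong₂ _+_ (p≡ n) (q≡ n)) (sym (eval-add p′ q′ n))
polynomial (p ⊠ q)      = let (p′ , p≡) = polynomial p ; (q′ , q≡) = polynomial q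
  in multiply p′ q′ , λ n → trans (cong₂ _*_ (p≡ n) (q≡ n)) (sym (eval-multiply p′ q′ n))

-- Repeated words

copies : ∀ {A : Set} → ℕ → List A → List A
copies n u = concat (replicate n u)

copies-+ : ∀ {A : Set} m n (u : List A) → copies (m + n) u ≡ copies m u ++ copies n u
copies-+ zero    n u = refl
copies-+ (suc m) n u = trans (cong (u ++_) (copies-+ m n u)) (sym (List.++-assoc u (copies m u) (copies n u)))

series-copies : ∀ {A : Set} m n (u : List A) → series m (λ _ → copies n u) ≡ copies (m * n) u
series-copies zero    n u = refl
series-copies (suc m) n u = begin
  series m (λ _ → copies n u) ++ copies n u  ≡⟨ cong (_++ copies n u) (series-copies m n u) ⟩
  copies (m * n) u ++ copies n u             ≡⟨ sym (copies-+ (m * n) n u) ⟩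
  copies (m * n + n) u                       ≡⟨ cong (λ k → copies k u) (ℕ.+-comm (m * n) n) ⟩
  copies (n + m * n) u                       ∎
  where open ≡-Reasoning

-- Programs over five tapes: the input, two unary registers, a unary loop
-- index, and the output.  A blank cell marks the left end of each tape.

open Programs 4 0

pattern W = zero
pattern X = suc zero
pattern Y = suc (suc zero)
pattern J = suc (suc (suc zero))
pattern O = suc (suc (suc (suc zero)))

Cell : Set
Cell = Symbol 0

is-bit : Cell → Bool
is-bit (bit _) = true
is-bit _       = false

on : Fin 5 → (Cell → Cell × Move) → Prog
on r h = basic λ hs → Vec.updateAt (idle hs) r (λ (c , _) → h c)

shift : Fin 5 → Move → Prog
shift r d = on r (_, d)

while-bit : Fin 5 → Prog → Prog
while-bit r = while (λ hs → is-bit (Vec.lookup hs r))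

head-≔ : ∀ {n} (ts : Vec (Tape Cell) n) r τ → Vec.lookup (Vec.map head (ts [ r ]≔ τ)) r ≡ head τ
head-≔ (t ∷ ts) zero    τ = refl
head-≔ (t ∷ ts) (suc r) τ = head-≔ ts r τ

perform-on : ∀ {n} (ts : Vec (Tape Cell) n) r τ (h : Cell → Cell × Move) →
  Vec.zipWith act (Vec.updateAt (Vec.map (_, none) (Vec.map head (ts [ r ]≔ τ))) r (λ (c , _) → h c)) (ts [ r ]≔ τ)
  ≡ ts [ r ]≔ act (h (head τ)) τ
perform-on (t ∷ ts) zero    τ h = cong (act (h (head τ)) τ ∷_) (act-idle ts)
perform-on (t ∷ ts) (suc r) τ h = cong (t ∷_) (perform-on ts r τ h)

on-exec : ∀ ts r τ (h : Cell → Cell × Move) → Exec (on r h) (ts [ r ]≔ τ) 1 (ts [ r ]≔ act (h (head τ)) τ)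
on-exec ts r τ h = subst (Exec (on r h) (ts [ r ]≔ τ) 1) (perform-on ts r τ h) basic

-- The word v written before the head, nearest letter first.
End : Word → Tape Cell
End v = tape (map bit v ++ blank ∷ []) blank []

Leftward : Word → List Cell → Tape Cell
Leftward []      rs = tape [] blank rs
Leftward (b ∷ v) rs = tape (map bit v ++ blank ∷ []) (bit b) rs

-- `rs` is what is stored after the word: a blank if the head has been there, nothing on the fresh
-- input tape. The hypothesis of `sweep-right` about `rs` covers both.
Rightward : List Cell → Word → Word → Tape Cell
Rightward rs v []      = End v
Rightward rs v (b ∷ u) = tape (map bit v ++ blank ∷ []) (bit b) (map bit u ++ rs)

shift-left : ∀ ts r v → Exec (shift r left) (ts [ r ]≔ End v) 1 (ts [ r ]≔ Leftward v (blank ∷ []))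
shift-left ts r []      = on-exec ts r _ _
shift-left ts r (b ∷ v) = on-exec ts r _ _

shift-left′ : ∀ ts r b v rs → Exec (shift r left) (ts [ r ]≔ Leftward (b ∷ v) rs) 1 (ts [ r ]≔ Leftward v (bit b ∷ rs))
shift-left′ ts r b []       rs = on-exec ts r _ _
shift-left′ ts r b (b′ ∷ v) rs = on-exec ts r _ _

shift-right : ∀ ts r v → Exec (shift r right) (ts [ r ]≔ Leftward [] (map bit v ++ blank ∷ [])) 1
                                              (ts [ r ]≔ Rightward (blank ∷ []) [] v)
shift-right ts r []      = on-exec ts r _ _
shift-right ts r (b ∷ v) = on-exec ts r _ _

sweep-right : ∀ ts r rs v u → (∀ ls c → move right (tape {Γ = Cell} ls c rs) ≡ tape (c ∷ ls) blank []) →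
  Exec (while-bit r (shift r right)) (ts [ r ]≔ Rightward rs v u) (length u * 2 + 1) (ts [ r ]≔ End (u ʳ++ v))
sweep-right ts r rs v []      ends = done (cong is-bit (head-≔ ts r (End v)))
sweep-right ts r rs v (b ∷ u) ends = again (cong is-bit (head-≔ ts r (Rightward rs v (b ∷ u))))
  (subst (λ τ → Exec (shift r right) (ts [ r ]≔ Rightward rs v (b ∷ u)) 1 (ts [ r ]≔ τ)) (moved u)
    (on-exec ts r (Rightward rs v (b ∷ u)) (_, right)))
  (sweep-right ts r rs (b ∷ v) u ends)
  where
  moved : ∀ u → act (bit b , right) (Rightward rs v (b ∷ u)) ≡ Rightward rs (b ∷ v) u
  moved []      = ends (map bit v ++ blank ∷ []) (bit b)
  moved (_ ∷ _) = refl

-- us k gives the tapes other than r after k executions of P.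
loop-left : ∀ r {P} b (us : ℕ → Tapes) v v′ →
  (∀ k → k < length v → ∀ τ → Exec P (us k [ r ]≔ τ) b (us (suc k) [ r ]≔ τ)) →
  Exec (while-bit r (P ⨾ shift r left)) (us 0 [ r ]≔ Leftward v (map bit v′ ++ blank ∷ [])) (length v * (b + 2) + 1)
       (us (length v) [ r ]≔ Leftward [] (map bit (v ʳ++ v′) ++ blank ∷ []))
loop-left r b us []      v′ body = done (cong is-bit (head-≔ (us 0) r _))
loop-left r b us (c ∷ v) v′ body = relax (ℕ.≤-reflexive (arith b (length v)))
  (again (cong is-bit (head-≔ (us 0) r (Leftward (c ∷ v) _)))
    (body 0 (s≤s z≤n) _ ⨾ shift-left′ (us 1) r c v _)
    (loop-left r b (us ∘ suc) v (c ∷ v′) (λ k k< → body (suc k) (s≤s k<))))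
  where
  arith : ∀ b n → suc (b + 1 + (n * (b + 2) + 1)) ≡ suc n * (b + 2) + 1
  arith = solve 2 (λ b n → con 1 :+ (b :+ con 1 :+ (n :* (b :+ con 2) :+ con 1)) := (con 1 :+ n) :* (b :+ con 2) :+ con 1) refl
    where open ℕ-Solver

-- The body is executed once per letter during the sweep to the left; the sweep back restores the
-- tape, so registers can be reused and loops nested.
for : Fin 5 → Prog → Prog
for r P = shift r left ⨾ while-bit r (P ⨾ shift r left) ⨾ shift r right ⨾ while-bit r (shift r right)

for-cost : ℕ → ℕ → ℕ
for-cost n b = n * (b + 4) + 4

-- The sweep changes tape `r` between two executions of the body, so the body must work for every
-- content τ of that tape and leave it alone.
for-exec : ∀ r {P} b (us : ℕ → Tapes) v →
  (∀ k → k < length v → ∀ τ → Exec P (us k [ r ]≔ τ) b (us (suc k) [ r ]≔ τ)) →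
  Exec (for r P) (us 0 [ r ]≔ End v) (for-cost (length v) b) (us (length v) [ r ]≔ End v)
for-exec r {P} b us v body =
  relax (ℕ.≤-reflexive (trans (cong (λ n → 1 + (length v * (b + 2) + 1 + (1 + (n * 2 + 1)))) (List.length-reverse v)) (arith b (length v))))
  (subst (λ v′ → Exec (for r P) (us 0 [ r ]≔ End v) (1 + (length v * (b + 2) + 1 + (1 + (length (reverse v) * 2 + 1))))
                      (us (length v) [ r ]≔ End v′))
    (List.reverse-involutive v)
    (shift-left (us 0) r v ⨾ loop-left r b us v [] body ⨾ shift-right (us (length v)) r (reverse v)
      ⨾ sweep-right (us (length v)) r (blank ∷ []) [] (reverse v) (λ _ _ → refl)))
  where
  arith : ∀ b n → 1 + (n * (b + 2) + 1 + (1 + (n * 2 + 1))) ≡ n * (b + 4) + 4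
  arith = solve 2 (λ b n → con 1 :+ (n :* (b :+ con 2) :+ con 1 :+ (con 1 :+ (n :* con 2 :+ con 1))) := n :* (b :+ con 4) :+ con 4) refl
    where open ℕ-Solver

marks : ℕ → Tape Cell
marks n = End (replicate n true)

for-marks : ∀ r {P} b (us : ℕ → Tapes) n →
  (∀ k → k < n → ∀ τ → Exec P (us k [ r ]≔ τ) b (us (suc k) [ r ]≔ τ)) →
  Exec (for r P) (us 0 [ r ]≔ marks n) (for-cost n b) (us n [ r ]≔ marks n)
for-marks r {P} b us n body = subst (λ m → Exec (for r P) (us 0 [ r ]≔ marks n) (for-cost m b) (us m [ r ]≔ marks n)) n≡
  (for-exec r b us (replicate n true) (λ k k< → body k (subst (k <_) n≡ k<)))
  where
  n≡ : length (replicate n true) ≡ n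
  n≡ = List.length-replicate n

skip : Prog
skip = basic idle

skip-exec : ∀ ts → Exec skip ts 1 ts
skip-exec ts = subst (Exec skip ts 1) (act-idle ts) basic

inc-register : Fin 5 → Prog
inc-register r = on r (λ _ → bit true , right)

inc-exec : ∀ ts r n → Exec (inc-register r) (ts [ r ]≔ marks n) 1 (ts [ r ]≔ marks (suc n))
inc-exec ts r n = on-exec ts r (marks n) _

-- The idle body makes the plain sweep an instance of `loop-left`.
rewind : Fin 5 → Prog
rewind r = shift r left ⨾ while-bit r (skip ⨾ shift r left) ⨾ shift r right

rewind-exec : ∀ ts r v → Exec (rewind r) (ts [ r ]≔ End v) (length v * 3 + 3) (ts [ r ]≔ Rightward (blank ∷ []) [] (reverse v))
rewind-exec ts r v = relax (ℕ.≤-reflexive (arith (length v)))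
  (shift-left ts r v ⨾ loop-left r 1 (λ _ → ts) v [] (λ _ _ τ → skip-exec _) ⨾ shift-right ts r (reverse v))
  where
  arith : ∀ n → 1 + (n * 3 + 1 + 1) ≡ n * 3 + 3
  arith = solve 1 (λ n → con 1 :+ (n :* con 3 :+ con 1 :+ con 1) := n :* con 3 :+ con 3) refl
    where open ℕ-Solver

-- The head stands after the output, so that appending to `v` is writing at the head; the stored
-- cells list `v` backwards.
state : Tape Cell → Tape Cell → Tape Cell → Tape Cell → Word → Tapes
state w x y j v = w ∷ x ∷ y ∷ j ∷ End (reverse v) ∷ []

put : (Cell → Bool) → Prog
put f = basic λ hs → Vec.updateAt (idle hs) O (λ _ → bit (f (Vec.lookup hs W)) , right)

-- Each written bit is a function of the scanned input letter, which replaces a branching on that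
-- letter.
emit-read : List (Cell → Bool) → Prog
emit-read []       = skip
emit-read (f ∷ fs) = put f ⨾ emit-read fs

emit-read-exec : ∀ fs w x y j v →
  Exec (emit-read fs) (state w x y j v) (suc (length fs)) (state w x y j (v ++ map (λ f → f (head w)) fs))
emit-read-exec []       w x y j v = subst (λ v′ → Exec skip (state w x y j v) 1 (state w x y j v′)) (sym (List.++-identityʳ v)) (skip-exec _)
emit-read-exec (f ∷ fs) w x y j v =
  subst (λ o → Exec (put f) (state w x y j v) 1 (w ∷ x ∷ y ∷ j ∷ End o ∷ [])) (sym (List.reverse-++ v (f (head w) ∷ []))) basic
  ⨾ subst (λ v′ → Exec (emit-read fs) (state w x y j (v ++ f (head w) ∷ [])) (suc (length fs)) (state w x y j v′))
      (List.++-assoc v (f (head w) ∷ []) _) (emit-read-exec fs w x y j (v ++ f (head w) ∷ []))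

emit : Word → Prog
emit u = emit-read (map (λ b _ → b) u)

emit-exec : ∀ u w x y j v → Exec (emit u) (state w x y j v) (suc (length u)) (state w x y j (v ++ u))
emit-exec u w x y j v = subst₂ (λ n u′ → Exec (emit u) (state w x y j v) (suc n) (state w x y j (v ++ u′)))
  (List.length-map _ u) (trans (sym (List.map-∘ u)) (List.map-id u)) (emit-read-exec (map (λ b _ → b) u) w x y j v)

for-appends : ∀ r {P} b (us : ℕ → Word → Tapes) F n →
  (∀ k → k < n → ∀ τ v → Exec P (us k v [ r ]≔ τ) b (us (suc k) (v ++ F k) [ r ]≔ τ)) → ∀ v →
  Exec (for r P) (us 0 v [ r ]≔ marks n) (for-cost n b) (us n (v ++ series n F) [ r ]≔ marks n)
for-appends r {P} b us F n body v =
  subst (λ v′ → Exec (for r P) (us 0 v′ [ r ]≔ marks n) (for-cost n b) (us n (v ++ series n F) [ r ]≔ marks n))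
    (List.++-identityʳ v)
    (for-marks r b (λ k → us k (v ++ series k F)) n λ k k< τ →
      subst (λ v′ → Exec P (us k (v ++ series k F) [ r ]≔ τ) b (us (suc k) v′ [ r ]≔ τ))
        (List.++-assoc v (series k F) (F k)) (body k k< τ (v ++ series k F)))

-- `m` is the loop index on tape `J`, on which the output may depend; the other tapes are arbitrary
-- and return unchanged.
record Emits (P : Prog) (f : ℕ → Word) : Set where
  field
    cost  : ℕ → ℕ
    poly  : PolyFun cost
    exec  : ∀ w x y m v → Exec P (state w x y (marks m) v) (cost m) (state w x y (marks m) (v ++ f m))

emits-word : ∀ u → Emits (emit u) (λ _ → u)
emits-word u = record
  { cost = λ _ → suc (length u) ; poly = constant _ ; exec = λ w x y m → emit-exec u w x y (marks m) }

infixr 5 _⨾ᵉ_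

_⨾ᵉ_ : ∀ {P Q f g} → Emits P f → Emits Q g → Emits (P ⨾ Q) (λ m → f m ++ g m)
_⨾ᵉ_ {P} {Q} {f} {g} p q = record
  { cost = λ m → P′.cost m + Q′.cost m
  ; poly = P′.poly ⊞ Q′.poly
  ; exec = λ w x y m v → P′.exec w x y m v ⨾
      subst (λ v′ → Exec Q (state w x y (marks m) (v ++ f m)) (Q′.cost m) (state w x y (marks m) v′))
        (List.++-assoc v (f m) (g m)) (Q′.exec w x y m (v ++ f m))
  }
  where
  module P′ = Emits p
  module Q′ = Emits q

emits-resp : ∀ {P f g} → (∀ m → f m ≡ g m) → Emits P f → Emits P g
emits-resp {P} f≡g p = record
  { cost = cost ; poly = poly
  ; exec = λ w x y m v →
      subst (λ u → Exec P (state w x y (marks m) v) (cost m) (state w x y (marks m) (v ++ u))) (f≡g m) (exec w x y m v) }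
  where open Emits p

emits-for : ∀ u → Emits (for J (emit u)) (λ m → series m (λ _ → u))
emits-for u = record
  { cost = λ m → for-cost m (suc (length u))
  ; poly = argument ⊠ constant (suc (length u) + 4) ⊞ constant 4
  ; exec = λ w x y m → for-appends J (suc (length u)) (λ _ → state w x y (marks 0)) (λ _ → u) m
      (λ _ _ τ → emit-exec u w x y τ)
  }

emit-list : ∀ {A : Set} → (A → Prog) → List A → Prog
emit-list P []       = emit []
emit-list P (a ∷ as) = P a ⨾ emit-list P as

emits-list : ∀ {A : Set} {P : A → Prog} {f : ℕ → A → Word} → (∀ a → Emits (P a) (λ m → f m a)) →
             ∀ as → Emits (emit-list P as) (λ m → concat (map (f m) as))
emits-list p []       = emits-word []
emits-list p (a ∷ as) = p a ⨾ᵉ emits-list p as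

-- The reduction as a program

-- What `horner` leaves in `X` and `Y`. An upper bound of the polynomial is enough, since any larger
-- space bound is admissible.
register-x register-y : Polynomial → ℕ → ℕ
register-x []      n = 0
register-x (a ∷ p) n = a + (register-y (a ∷ p) n + register-x p n)
register-y []      n = 0
register-y (a ∷ p) n = n * register-x p n + register-y p n

eval≤register-x : ∀ p n → eval p n ≤ register-x p n
eval≤register-x []      n = z≤n
eval≤register-x (a ∷ p) n = ℕ.+-monoʳ-≤ a (ℕ.≤-trans (ℕ.*-monoʳ-≤ n (eval≤register-x p n))
  (ℕ.≤-trans (ℕ.m≤m+n _ (register-y p n)) (ℕ.m≤m+n _ (register-x p n))))

register-x-poly : ∀ p → PolyFun (register-x p)
register-y-poly : ∀ p → PolyFun (register-y p)
register-x-poly []      = constant 0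
register-x-poly (a ∷ p) = constant a ⊞ (register-y-poly (a ∷ p) ⊞ register-x-poly p)
register-y-poly []      = constant 0
register-y-poly (a ∷ p) = argument ⊠ register-x-poly p ⊞ register-y-poly p

times : ℕ → Prog → Prog
times zero    P = skip
times (suc n) P = P ⨾ times n P

-- Horner's scheme; not clearing register Y only makes the result larger.
horner : Polynomial → Prog
horner []      = skip
horner (a ∷ p) = horner p ⨾ for W (for X (inc-register Y)) ⨾ for Y (inc-register X) ⨾ times a (inc-register X)

for-cost-poly : ∀ {f g} → PolyFun f → PolyFun g → PolyFun (λ n → for-cost (f n) (g n))
for-cost-poly p q = p ⊠ (q ⊞ constant 4) ⊞ constant 4

horner-cost : Polynomial → ℕ → ℕ
horner-cost []      n = 1
horner-cost (a ∷ p) n =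
  horner-cost p n + (for-cost n (for-cost (register-x p n) 1) + (for-cost (register-y (a ∷ p) n) 1 + (a + 1)))

horner-cost-poly : ∀ p → PolyFun (horner-cost p)
horner-cost-poly []      = constant 1
horner-cost-poly (a ∷ p) = horner-cost-poly p ⊞ (for-cost-poly argument (for-cost-poly (register-x-poly p) (constant 1))
  ⊞ (for-cost-poly (register-y-poly (a ∷ p)) (constant 1) ⊞ (constant a ⊞ constant 1)))

registers : Word → ℕ → ℕ → Word → Tapes
registers u x y v = state (End u) (marks x) (marks y) (marks 0) v

add-register-y : ∀ τ x y j v →
  Exec (for X (inc-register Y)) (state τ (marks x) (marks y) j v) (for-cost x 1) (state τ (marks x) (marks (x + y)) j v)
add-register-y τ x y j v =
  for-marks X 1 (λ k → state τ (marks 0) (marks (k + y)) j v) x (λ k _ σ → inc-exec (state τ σ (marks 0) j v) Y (k + y))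

add-register-x : ∀ τ x y j v →
  Exec (for Y (inc-register X)) (state τ (marks x) (marks y) j v) (for-cost y 1) (state τ (marks (y + x)) (marks y) j v)
add-register-x τ x y j v =
  for-marks Y 1 (λ k → state τ (marks (k + x)) (marks 0) j v) y (λ k _ σ → inc-exec (state τ (marks 0) σ j v) X (k + x))

increase-register-x : ∀ a τ x y j v →
  Exec (times a (inc-register X)) (state τ (marks x) (marks y) j v) (a + 1) (state τ (marks (a + x)) (marks y) j v)
increase-register-x zero    τ x y j v = skip-exec _
increase-register-x (suc a) τ x y j v = inc-exec (state τ (marks 0) (marks y) j v) X x ⨾
  subst (λ n → Exec (times a (inc-register X)) (state τ (marks (suc x)) (marks y) j v) (a + 1) (state τ (marks n) (marks y) j v))
    (ℕ.+-suc a x) (increase-register-x a τ (suc x) y j v)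

horner-exec : ∀ p u v → Exec (horner p) (registers u 0 0 v) (horner-cost p (length u))
  (registers u (register-x p (length u)) (register-y p (length u)) v)
horner-exec []      u v = skip-exec _
horner-exec (a ∷ p) u v = horner-exec p u v
  ⨾ for-exec W (for-cost x 1) (λ k → registers [] x (k * x + y) v) u
      (λ k _ τ → subst (λ n → Exec (for X (inc-register Y)) (state τ (marks x) (marks (k * x + y)) (marks 0) v) (for-cost x 1)
                                   (state τ (marks x) (marks n) (marks 0) v))
                   (sym (ℕ.+-assoc x (k * x) y)) (add-register-y τ x (k * x + y) (marks 0) v))
  ⨾ add-register-x (End u) x (register-y (a ∷ p) (length u)) (marks 0) v
  ⨾ increase-register-x a (End u) _ _ (marks 0) v
  where
  x y : ℕ
  x = register-x p (length u)
  y = register-y p (length u)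

setup : Prog
setup = (shift W left ⨾ shift W right ⨾ while-bit W (shift W right)) ⨾ shift X right ⨾ shift Y right ⨾ shift J right ⨾ shift O right

blank-tape : Tape Cell
blank-tape = tape [] blank []

setup-input : ∀ w ts → Exec (shift W left ⨾ shift W right ⨾ while-bit W (shift W right))
  (ts [ W ]≔ fromList (map bit w)) (1 + (1 + (length w * 2 + 1))) (ts [ W ]≔ End (reverse w))
setup-input w ts = left-exec w ⨾ right-exec w ⨾ sweep-right ts W [] [] w (λ _ _ → refl)
  where
  left-exec : ∀ w → Exec (shift W left) (ts [ W ]≔ fromList (map bit w)) 1 (ts [ W ]≔ move left (fromList (map bit w)))
  left-exec []      = on-exec ts W blank-tape (_, left)
  left-exec (b ∷ w) = on-exec ts W (fromList (map bit (b ∷ w))) (_, left)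
  right-exec : ∀ w → Exec (shift W right) (ts [ W ]≔ move left (fromList (map bit w))) 1 (ts [ W ]≔ Rightward [] [] w)
  right-exec []      = on-exec ts W _ (_, right)
  right-exec (b ∷ w) = subst (λ as → Exec (shift W right) (ts [ W ]≔ move left (fromList (map bit (b ∷ w)))) 1
                                          (ts [ W ]≔ tape (blank ∷ []) (bit b) as))
    (sym (List.++-identityʳ (map bit w))) (on-exec ts W (move left (fromList (map bit (b ∷ w)))) (_, right))

setup-exec : ∀ w → Exec setup (fromList (map bit w) ∷ Vec.replicate 4 blank-tape) (length w * 2 + 7) (registers (reverse w) 0 0 [])
setup-exec w = relax (ℕ.≤-reflexive (arith (length w)))
  (setup-input w (fromList [] ∷ Vec.replicate 4 blank-tape)
   ⨾ on-exec (End (reverse w) ∷ Vec.replicate 4 blank-tape) X blank-tape (_, right)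
   ⨾ on-exec (End (reverse w) ∷ marks 0 ∷ Vec.replicate 3 blank-tape) Y blank-tape (_, right)
   ⨾ on-exec (End (reverse w) ∷ marks 0 ∷ marks 0 ∷ Vec.replicate 2 blank-tape) J blank-tape (_, right)
   ⨾ on-exec (End (reverse w) ∷ marks 0 ∷ marks 0 ∷ marks 0 ∷ Vec.replicate 1 blank-tape) O blank-tape (_, right))
  where
  arith : ∀ n → 1 + (1 + (n * 2 + 1)) + 4 ≡ n * 2 + 7
  arith = solve 1 (λ n → con 1 :+ (con 1 :+ (n :* con 2 :+ con 1)) :+ con 4 := n :* con 2 :+ con 7) refl
    where open ℕ-Solver

value : Cell → Maybe Bool
value (bit b) = just b
value _       = nothing

value-symbol : ∀ m → value (symbol m) ≡ m
value-symbol nothing  = refl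
value-symbol (just b) = refl

moved : ℕ → Tape Cell → Tape Cell
moved zero    τ = τ
moved (suc i) τ = move right (moved i τ)

moved-suc : ∀ i τ → moved (suc i) τ ≡ moved i (move right τ)
moved-suc zero    τ = refl
moved-suc (suc i) τ = cong (move right) (moved-suc i τ)

head-moved : ∀ i τ → head (moved i τ) ≡ read (head τ ∷ after τ) i
head-moved zero    τ = refl
head-moved (suc i) τ = trans (cong head (moved-suc i τ)) (trans (head-moved i (move right τ)) (shifted τ i))
  where
  shifted : ∀ τ i → read (head (move right τ) ∷ after (move right τ)) i ≡ read (after τ) i
  shifted (tape ls c [])       zero    = refl
  shifted (tape ls c [])       (suc i) = refl
  shifted (tape ls c (r ∷ rs)) i       = refl

input : Word → Tape Cell
input = Rightward (blank ∷ []) []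

value-input : ∀ i w → value (head (moved i (input w))) ≡ at w i
value-input i w = trans (cong value (trans (head-moved i (input w)) (trans (cong (λ as → read as i) (cells w)) (padded w i))))
  (value-symbol (at w i))
  where
  cells : ∀ w → head (input w) ∷ after (input w) ≡ map bit w ++ blank ∷ []
  cells []      = refl
  cells (b ∷ w) = refl
  padded : ∀ w i → read {0} (map bit w ++ blank ∷ []) i ≡ symbol (at w i)
  padded []      zero    = refl
  padded []      (suc i) = refl
  padded (b ∷ w) zero    = refl
  padded (b ∷ w) (suc i) = padded w i

-- The counterpart of `Emits` for tapes that depend on the input and that the program may change;
-- the cost is in terms of the input length.
record Stage (P : Prog) (s t : Word → Word → Tapes) (u : Word → Word) : Set where
  field
    cost : ℕ → ℕ
    poly : PolyFun cost
    exec : ∀ w v → Exec P (s w v) (cost (length w)) (t w (v ++ u w))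

infixr 5 _⨾ˢ_

_⨾ˢ_ : ∀ {P Q s t r u u′} → Stage P s t u → Stage Q t r u′ → Stage (P ⨾ Q) s r (λ w → u w ++ u′ w)
_⨾ˢ_ {P} {Q} {s} {t} {r} {u} {u′} p q = record
  { cost = λ n → P′.cost n + Q′.cost n
  ; poly = P′.poly ⊞ Q′.poly
  ; exec = λ w v → P′.exec w v ⨾ subst (λ v′ → Exec Q (t w (v ++ u w)) (Q′.cost (length w)) (r w v′))
      (List.++-assoc v (u w) (u′ w)) (Q′.exec w (v ++ u w))
  }
  where
  module P′ = Stage p
  module Q′ = Stage q

stage-resp : ∀ {P s t u u′} → (∀ w → u w ≡ u′ w) → Stage P s t u → Stage P s t u′
stage-resp {P} {s} {t} u≡u′ p = record
  { cost = cost ; poly = poly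
  ; exec = λ w v → subst (λ u → Exec P (s w v) (cost (length w)) (t w (v ++ u))) (u≡u′ w) (exec w v) }
  where open Stage p

silent : ∀ {P s t cost} → PolyFun cost → (∀ w v → Exec P (s w v) (cost (length w)) (t w v)) → Stage P s t (λ _ → [])
silent {P} {s} {t} {cost} poly exec = record
  { cost = cost ; poly = poly
  ; exec = λ w v → subst (λ v′ → Exec P (s w v) (cost (length w)) (t w v′)) (sym (List.++-identityʳ v)) (exec w v) }

-- The bijective numeral of `n` digits 1 denotes 2ⁿ - 1, so an exponential number is written by a
-- loop alone.
ones : ℕ → ℕᵇ
ones zero    = ℕᵇ.zero
ones (suc n) = 1+[2 ones n ]

-- The code of the digit 1 in `digits`.
pulse : Word
pulse = true ∷ false ∷ []

digits-ones-+ : ∀ m n → digits (ones (m + n)) ≡ copies m pulse ++ digits (ones n)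
digits-ones-+ zero    n = refl
digits-ones-+ (suc m) n = cong (λ u → true ∷ false ∷ u) (digits-ones-+ m n)

suc-toℕ-ones : ∀ n → suc (ℕᵇ.toℕ (ones n)) ≡ 2 ^ n
suc-toℕ-ones zero    = refl
suc-toℕ-ones (suc n) = trans (arith (ℕᵇ.toℕ (ones n))) (cong (2 *_) (suc-toℕ-ones n))
  where
  arith : ∀ m → suc (suc (2 * m)) ≡ 2 * suc m
  arith = solve 1 (λ m → con 1 :+ (con 1 :+ con 2 :* m) := con 2 :* (con 1 :+ m)) refl
    where open ℕ-Solver

unary-copies : ∀ n → unary n ≡ copies n (true ∷ []) ++ false ∷ []
unary-copies n = cong (_++ false ∷ []) (replicate-copies n)
  where
  replicate-copies : ∀ n → replicate n true ≡ copies n (true ∷ [])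
  replicate-copies zero    = refl
  replicate-copies (suc n) = cong (true ∷_) (replicate-copies n)

unary-+ : ∀ m n → unary (m + n) ≡ copies m (true ∷ []) ++ unary n
unary-+ zero    n = refl
unary-+ (suc m) n = cong (true ∷_) (unary-+ m n)

-- A step adds at most one cell before the head. So the running time bounds the length of the
-- output, and thereby the cost of rewinding it.
before-growth : ∀ r {P ts n us} → Exec P ts n us → length (before (Vec.lookup us r)) ≤ length (before (Vec.lookup ts r)) + n
before-growth r {ts = ts} (basic {f}) = subst (λ t → length (before t) ≤ length (before (Vec.lookup ts r)) + 1)
  (sym (Vec.lookup-zipWith act r (f (heads ts)) ts)) (growth (Vec.lookup (f (heads ts)) r) (Vec.lookup ts r))
  where
  growth : ∀ a (t : Tape Cell) → length (before (act a t)) ≤ length (before t) + 1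
  growth (b , left)  (tape []       c rs)       = z≤n
  growth (b , left)  (tape (l ∷ ls) c rs)       = ℕ.≤-trans (ℕ.n≤1+n _) (ℕ.m≤m+n _ 1)
  growth (b , right) (tape ls       c [])       = ℕ.≤-reflexive (ℕ.+-comm 1 (length ls))
  growth (b , right) (tape ls       c (r ∷ rs)) = ℕ.≤-reflexive (ℕ.+-comm 1 (length ls))
  growth (b , none)  t                          = ℕ.m≤m+n _ 1
before-growth r {ts = ts} (_⨾_ {m = m} {n} p q) = ℕ.≤-trans (before-growth r q)
  (ℕ.≤-trans (ℕ.+-monoˡ-≤ n (before-growth r p)) (ℕ.≤-reflexive (ℕ.+-assoc _ m n)))
before-growth r (done _) = ℕ.m≤m+n _ 1
before-growth r {ts = ts} (again {m = m} {n} _ p q) = ℕ.≤-trans (before-growth r q)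
  (ℕ.≤-trans (ℕ.+-monoˡ-≤ n (before-growth r p))
  (ℕ.≤-trans (ℕ.≤-reflexive (ℕ.+-assoc _ m n)) (ℕ.+-monoʳ-≤ (length (before (Vec.lookup ts r))) (ℕ.n≤1+n (m + n)))))
before-growth r (relax m≤n p) = ℕ.≤-trans (before-growth r p) (ℕ.+-monoʳ-≤ _ m≤n)

module Reduction (K : Automaton) (p : Polynomial) where
  open Automaton K
  open Layout K

  -- The location number is affine in the window number: the loop over `J` writes `width` marks per
  -- mark of the index.
  emit-ref : Kind → Ref → Prog
  emit-ref κ (glob a)   = emit (ref-word κ 0 (glob a))
  emit-ref κ (cell q c) = emit (true ∷ true ∷ true ∷ copies globs (true ∷ [])) ⨾ for J (emit (copies width (true ∷ [])))
                          ⨾ emit (unary (toℕ q * width + toℕ c) ++ weight-word κ)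

  emits-ref : ∀ κ r → Emits (emit-ref κ r) (λ m → ref-word κ m r)
  emits-ref κ (glob a)   = emits-word _
  emits-ref κ (cell q c) = emits-resp (λ m → cong (λ u → true ∷ true ∷ true ∷ u) (number m))
    (emits-word _ ⨾ᵉ emits-for _ ⨾ᵉ emits-word _)
    where
    o : ℕ
    o = toℕ q * width + toℕ c
    number : ∀ m → copies globs (true ∷ []) ++ series m (λ _ → copies width (true ∷ [])) ++ unary o ++ weight-word κ
             ≡ unary (globs + (m * width + o)) ++ weight-word κ
    number m = begin
      copies globs (true ∷ []) ++ series m (λ _ → copies width (true ∷ [])) ++ unary o ++ weight-word κ
        ≡⟨ cong (λ u → copies globs (true ∷ []) ++ u ++ unary o ++ weight-word κ) (series-copies m width (true ∷ [])) ⟩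
      copies globs (true ∷ []) ++ copies (m * width) (true ∷ []) ++ unary o ++ weight-word κ
        ≡⟨ cong (copies globs (true ∷ []) ++_) (sym (List.++-assoc (copies (m * width) (true ∷ [])) (unary o) (weight-word κ))) ⟩
      copies globs (true ∷ []) ++ (copies (m * width) (true ∷ []) ++ unary o) ++ weight-word κ
        ≡⟨ cong (λ u → copies globs (true ∷ []) ++ u ++ weight-word κ) (sym (unary-+ (m * width) o)) ⟩
      copies globs (true ∷ []) ++ unary (m * width + o) ++ weight-word κ
        ≡⟨ sym (List.++-assoc (copies globs (true ∷ [])) (unary (m * width + o)) (weight-word κ)) ⟩
      (copies globs (true ∷ []) ++ unary (m * width + o)) ++ weight-word κ
        ≡⟨ cong (_++ weight-word κ) (sym (unary-+ globs (m * width + o))) ⟩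
      unary (globs + (m * width + o)) ++ weight-word κ ∎
      where open ≡-Reasoning

  emit-entry : Entry → Prog
  emit-entry e = emit (kind-bit kind ∷ zero-word kind) ⨾ emit-list (emit-ref kind) refs ⨾ emit (false ∷ [])
    where open Entry e

  emits-entry : ∀ e → Emits (emit-entry e) (λ m → entry-word m e)
  emits-entry e = emits-word _ ⨾ᵉ emits-list (emits-ref kind) refs ⨾ᵉ emits-word _
    where open Entry e

  emit-block : ∀ {n} → (Fin n → Entry) → Prog
  emit-block {n} τ = emit-list (emit-entry ∘ τ) (allFin n)

  emits-block : ∀ {n} (τ : Fin n → Entry) → Emits (emit-block τ) (block-word τ)
  emits-block {n} τ = emits-resp (λ m → cong concat (List.map-tabulate (λ i → i) (λ c → entry-word m (τ c))))
    (emits-list (λ c → emits-entry (τ c)) (allFin n))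

  -- The successor provides the interior cell that `Run` presupposes.
  cells : ℕ → ℕ
  cells n = suc (register-x p n)

  cells-poly : PolyFun cells
  cells-poly = constant 1 ⊞ register-x-poly p

  at-stage : (Word → Tape Cell) → (ℕ → ℕ) → Word → Word → Tapes
  at-stage τ j w v = state (τ w) (marks (cells (length w))) (marks (register-y p (length w))) (marks (j (length w))) v

  emits-stage : ∀ {P f} → Emits P f → ∀ τ {j} → PolyFun j → Stage P (at-stage τ j) (at-stage τ j) (λ w → f (j (length w)))
  emits-stage e τ j-poly = record
    { cost = λ n → cost _ ; poly = substitute poly j-poly ; exec = λ w v → exec (τ w) _ _ _ v }
    where open Emits e

  for-stage : ∀ u τ j → Stage (for X (emit u)) (at-stage τ j) (at-stage τ j) (λ w → series (cells (length w)) (λ _ → u))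
  for-stage u τ j = record
    { cost = λ n → for-cost (cells n) (suc (length u))
    ; poly = for-cost-poly cells-poly (constant (suc (length u)))
    ; exec = λ w → for-appends X (suc (length u)) (λ _ → at-stage τ j w) (λ _ → u) (cells (length w))
        (λ _ _ σ → emit-exec u (τ w) σ (marks (register-y p (length w))) (marks (j (length w)))) }

  rewound : Word → Tape Cell
  rewound w = End (reverse w)

  none-yet : ℕ → ℕ
  none-yet _ = 0

  size-stage : Stage (emit (copies (globs + 3 * width) (true ∷ [])) ⨾ for X (emit (copies width (true ∷ []))) ⨾ emit (false ∷ []))
    (at-stage rewound none-yet) (at-stage rewound none-yet) (λ w → unary (Size.size (cells (length w))))
  size-stage = stage-resp (λ w → sizes (cells (length w)))
    (emits-stage (emits-word _) rewound (constant 0) ⨾ˢ for-stage _ rewound none-yet ⨾ˢ emits-stage (emits-word _) rewound (constant 0))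
    where
    sizes : ∀ S → copies (globs + 3 * width) (true ∷ []) ++ series S (λ _ → copies width (true ∷ [])) ++ false ∷ []
            ≡ unary (globs + (3 + S) * width)
    sizes S = begin
      copies (globs + 3 * width) (true ∷ []) ++ series S (λ _ → copies width (true ∷ [])) ++ false ∷ []
        ≡⟨ cong (λ u → copies (globs + 3 * width) (true ∷ []) ++ u ++ false ∷ []) (series-copies S width (true ∷ [])) ⟩
      copies (globs + 3 * width) (true ∷ []) ++ copies (S * width) (true ∷ []) ++ false ∷ []
        ≡⟨ cong (copies (globs + 3 * width) (true ∷ []) ++_) (sym (unary-copies (S * width))) ⟩
      copies (globs + 3 * width) (true ∷ []) ++ unary (S * width)
        ≡⟨ sym (unary-+ (globs + 3 * width) (S * width)) ⟩
      unary (globs + 3 * width + S * width)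
        ≡⟨ cong unary (trans (ℕ.+-assoc globs (3 * width) (S * width)) (cong (globs +_) (sym (ℕ.*-distribʳ-+ width 3 S)))) ⟩
      unary (globs + (3 + S) * width) ∎
      where open ≡-Reasoning

  -- Incrementing `J` after each block gives block k the window number k, and ends with `J` at S,
  -- the window of the two blocks that follow.
  blocks-stage : Stage (for X (emit-block interior-entry ⨾ inc-register J))
    (at-stage rewound none-yet) (at-stage rewound cells) (λ w → series (cells (length w)) (block-word interior-entry))
  blocks-stage = record
    { cost = λ n → for-cost (cells n) (cost (cells n) + 1)
    ; poly = for-cost-poly cells-poly (substitute poly cells-poly ⊞ constant 1)
    ; exec = λ w → for-appends X (cost (cells (length w)) + 1)
        (λ k v → state (rewound w) (marks 0) (marks (register-y p (length w))) (marks k) v)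
        (block-word interior-entry) (cells (length w))
        -- The cost of block k is bounded by that of the final index, as the loop rule takes one
        -- bound for all rounds.
        (λ k k< σ v → relax (ℕ.+-monoˡ-≤ 1 (PolyFun-mono poly (ℕ.<⇒≤ k<))) (exec (rewound w) σ _ k v
           ⨾ inc-exec (state (rewound w) σ (marks (register-y p (length w))) (marks 0) (v ++ block-word interior-entry k)) J k)) }
    where open Emits (emits-block interior-entry)

  process-prog : Prog
  process-prog = (emit (copies (globs + 3 * width) (true ∷ [])) ⨾ for X (emit (copies width (true ∷ []))) ⨾ emit (false ∷ []))
    ⨾ emit-block global-entry ⨾ emit-block (boundary-entry zero)
    ⨾ (for X (emit-block interior-entry ⨾ inc-register J) ⨾ emit-block (boundary-entry (suc zero)))
    ⨾ emit-block (boundary-entry (suc (suc zero)))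

  process-stage : Stage process-prog (at-stage rewound none-yet) (at-stage rewound cells)
    (λ w → encodeOCMDP (Size.process (cells (length w))))
  process-stage = stage-resp (λ w → sym (Size.encodeOCMDP-process (cells (length w))))
    (size-stage ⨾ˢ emits-stage (emits-block global-entry) rewound (constant 0)
     ⨾ˢ emits-stage (emits-block (boundary-entry zero)) rewound (constant 0)
     ⨾ˢ (blocks-stage ⨾ˢ emits-stage (emits-block (boundary-entry (suc zero))) rewound cells-poly)
     ⨾ˢ emits-stage (emits-block (boundary-entry (suc (suc zero)))) rewound cells-poly)

  input-bits : ∀ {n} → (Maybe Bool → Fin n → Bool) → List (Cell → Bool)
  input-bits f = tabulate (λ i c → f (value c) i)

  input-bits-exec : ∀ {n} (f : Maybe Bool → Fin n → Bool) i w x y j v →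
    Exec (emit-read (input-bits f)) (state (moved i (input w)) x y j v) (suc n)
         (state (moved i (input w)) x y j (v ++ tabulate (f (at w i))))
  input-bits-exec {n} f i w x y j v = subst₂ (λ k u → Exec (emit-read (input-bits f)) (state (moved i (input w)) x y j v) (suc k)
                                                           (state (moved i (input w)) x y j (v ++ u)))
    (List.length-tabulate _)
    (trans (List.map-tabulate (λ i c → f (value c) i) (λ g → g (head (moved i (input w)))))
           (List.tabulate-cong (λ k → cong (λ m → f m k) (value-input i w))))
    (emit-read-exec (input-bits f) (moved i (input w)) x y j v)

  rewind-stage : Stage (rewind W) (at-stage rewound cells) (at-stage input cells) (λ _ → [])
  rewind-stage = silent (argument ⊠ constant 3 ⊞ constant 3) λ w v →
    subst₂ (λ n w′ → Exec (rewind W) (at-stage rewound cells w v) (n * 3 + 3) (at-stage rewound cells w v [ W ]≔ input w′))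
      (List.length-reverse w) (List.reverse-involutive w) (rewind-exec (at-stage rewound cells w v) W (reverse w))

  global-bits-stage : Stage (emit-read (input-bits (global-bit ∘ initial-global))) (at-stage input cells) (at-stage input cells)
    (λ w → tabulate (global-bit (initial-global (at w 0))))
  global-bits-stage = record
    { cost = λ _ → suc globs ; poly = constant _
    ; exec = λ w v → input-bits-exec (global-bit ∘ initial-global) 0 w _ _ _ v }

  -- The input head advances once per cell and may leave the input; the blanks met there are read as
  -- `nothing`.
  beyond : Word → Tape Cell
  beyond w = moved (suc (cells (length w))) (input w)

  content-bits : Prog
  content-bits = emit-read (input-bits (fact-bit ∘ initial-content))

  content-bits-stage : Stage (shift W right ⨾ for X (content-bits ⨾ shift W right)) (at-stage input cells) (at-stage beyond cells)
    (λ w → series (cells (length w)) (λ m → tabulate (fact-bit (initial-content (at w (suc m))))))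
  -- The letter at position 0 is under the head initially and belongs to the global state, so cell 1
  -- begins with the next letter.
  content-bits-stage = silent {t = at-stage (λ w → moved 1 (input w)) cells} (constant 1)
      (λ w v → on-exec (at-stage input cells w v) W (input w) (_, right))
    ⨾ˢ record
    { cost = λ n → for-cost (cells n) (suc width + 1)
    ; poly = for-cost-poly cells-poly (constant (suc width + 1))
    ; exec = λ w → for-appends X (suc width + 1)
        (λ k v → state (moved (suc k) (input w)) (marks 0) (marks (register-y p (length w))) (marks (cells (length w))) v)
        (λ m → tabulate (fact-bit (initial-content (at w (suc m))))) (cells (length w))
        (λ k _ σ v → input-bits-exec (fact-bit ∘ initial-content) (suc k) w σ _ _ v
          ⨾ on-exec (state (input w) σ (marks (register-y p (length w))) (marks (cells (length w)))
                       (v ++ tabulate (fact-bit (initial-content (at w (suc k))))))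
              W (moved (suc k) (input w)) (_, right)) }

  targets-prog : Prog
  targets-prog = rewind W ⨾ emit-read (input-bits (global-bit ∘ initial-global)) ⨾ emit (tabulate (fact-bit edge))
    ⨾ ((shift W right ⨾ for X (content-bits ⨾ shift W right)) ⨾ emit (tabulate (fact-bit void)))
    ⨾ emit (tabulate (fact-bit void))

  targets-stage : Stage targets-prog (at-stage rewound cells) (at-stage beyond cells)
    (λ w → Vec.toList (Size.targets (cells (length w)) (at w)))
  targets-stage = stage-resp (λ w → sym (Size.toList-targets (cells (length w)) (at w)))
    (rewind-stage ⨾ˢ global-bits-stage ⨾ˢ emits-stage (emits-word _) input cells-poly
     ⨾ˢ (content-bits-stage ⨾ˢ emits-stage (emits-word _) beyond cells-poly)
     ⨾ˢ emits-stage (emits-word _) beyond cells-poly)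

  -- By n ≤ 2ⁿ the snapshots number at most 2 to the power globals + (3 + S) · contents; one more
  -- factor 2 makes up for the -1 in the value of `ones`.
  exponent time : ℕ → ℕ
  exponent S = suc globals + (3 + S) * contents
  time S = ℕᵇ.toℕ (ones (exponent S))

  twice-* : ∀ n → twice n ≡ 2 * n
  twice-* zero    = refl
  twice-* (suc n) = trans (cong (λ m → suc (suc m)) (twice-* n)) (arith n)
    where
    arith : ∀ m → suc (suc (2 * m)) ≡ 2 * suc m
    arith = solve 1 (λ m → con 1 :+ (con 1 :+ con 2 :* m) := con 2 :* (con 1 :+ m)) refl
      where open ℕ-Solver

  -- Doubling and adding 1 adds one more digit 1 to a bijective numeral.
  binary-time : ∀ S → binary (suc (twice (time S))) ≡ digits (ones (suc (exponent S)))
  binary-time S = cong digits (trans (cong (ℕᵇ.fromℕ ∘ suc) (twice-* (time S))) (ℕᵇ.fromℕ-toℕ (ones (suc (exponent S)))))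

  time-prog : Prog
  time-prog = emit (copies (2 + globals + 3 * contents) pulse) ⨾ for X (emit (copies contents pulse)) ⨾ emit (false ∷ [])

  time-stage : Stage time-prog (at-stage beyond cells) (at-stage beyond cells) (λ w → binary (suc (twice (time (cells (length w))))))
  time-stage = stage-resp (λ w → times≡ (cells (length w)))
    (emits-stage (emits-word _) beyond cells-poly ⨾ˢ for-stage _ beyond cells ⨾ˢ emits-stage (emits-word _) beyond cells-poly)
    where
    times≡ : ∀ S → copies (2 + globals + 3 * contents) pulse ++ series S (λ _ → copies contents pulse) ++ false ∷ []
             ≡ binary (suc (twice (time S)))
    times≡ S = begin
      copies (2 + globals + 3 * contents) pulse ++ series S (λ _ → copies contents pulse) ++ false ∷ []
        ≡⟨ cong (λ u → copies (2 + globals + 3 * contents) pulse ++ u ++ false ∷ []) (series-copies S contents pulse) ⟩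
      copies (2 + globals + 3 * contents) pulse ++ copies (S * contents) pulse ++ digits (ones 0)
        ≡⟨ cong (copies (2 + globals + 3 * contents) pulse ++_) (sym (digits-ones-+ (S * contents) 0)) ⟩
      copies (2 + globals + 3 * contents) pulse ++ digits (ones (S * contents + 0))
        ≡⟨ sym (digits-ones-+ (2 + globals + 3 * contents) (S * contents + 0)) ⟩
      digits (ones (2 + globals + 3 * contents + (S * contents + 0)))
        ≡⟨ cong (digits ∘ ones) (arith globals contents S) ⟩
      digits (ones (suc (exponent S)))
        ≡⟨ sym (binary-time S) ⟩
      binary (suc (twice (time S))) ∎
      where
      open ≡-Reasoning
      arith : ∀ g c S → 2 + g + 3 * c + (S * c + 0) ≡ 2 + g + (3 + S) * c
      arith = solve 3 (λ g c S → con 2 :+ g :+ con 3 :* c :+ (S :* c :+ con 0) := con 2 :+ g :+ (con 3 :+ S) :* c) refl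
        where open ℕ-Solver

  instance-of : Word → ValOneInstance
  instance-of w = record
    { A = Size.process (cells (length w)) ; R = Size.targets (cells (length w)) (at w)
    ; s = suc zero , suc (twice (time (cells (length w)))) }

  instance-prog : Prog
  instance-prog = process-prog ⨾ targets-prog ⨾ emit (unary 1) ⨾ time-prog

  instance-stage : Stage instance-prog (at-stage rewound none-yet) (at-stage beyond cells) (encodeInstance ∘ instance-of)
  instance-stage = process-stage ⨾ˢ targets-stage ⨾ˢ emits-stage (emits-word _) beyond cells-poly ⨾ˢ time-stage

  -- The output is read from the head to the right, so the head has returned to its first letter.
  output-tapes : Word → Tapes
  output-tapes w = at-stage beyond cells w [] [ O ]≔ input (encodeInstance (instance-of w))

  prog-cost : ℕ → ℕ
  prog-cost n = n * 2 + 7 + (horner-cost p n + (1 + Stage.cost instance-stage n))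

  exec-instance : ∀ w → Exec (setup ⨾ horner p ⨾ inc-register X ⨾ instance-prog) (fromList (map bit w) ∷ Vec.replicate 4 blank-tape)
    (prog-cost (length w)) (at-stage beyond cells w (encodeInstance (instance-of w)))
  exec-instance w = setup-exec w
    ⨾ subst (λ n → Exec (horner p) (registers (reverse w) 0 0 []) (horner-cost p n)
                     (registers (reverse w) (register-x p n) (register-y p n) []))
        (List.length-reverse w) (horner-exec p (reverse w) [])
    ⨾ inc-exec (registers (reverse w) 0 (register-y p (length w)) []) X (register-x p (length w))
    ⨾ Stage.exec instance-stage w []

  instance-length : ∀ w → length (encodeInstance (instance-of w)) ≤ prog-cost (length w)
  instance-length w = begin
    length u                                              ≡⟨ sym (List.length-reverse u) ⟩
    length (reverse u)                                    ≡⟨ sym (List.length-map bit (reverse u)) ⟩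
    length (map bit (reverse u))                          ≤⟨ ℕ.m≤m+n _ _ ⟩
    length (map bit (reverse u)) + 1                      ≡⟨ sym (List.length-++ (map bit (reverse u))) ⟩
    length (map bit (reverse u) ++ blank ∷ [])            ≤⟨ before-growth O (exec-instance w) ⟩
    prog-cost (length w)                                  ∎
    where
    open ℕ.≤-Reasoning
    u : Word
    u = encodeInstance (instance-of w)

  exec-prog : ∀ w → Exec ((setup ⨾ horner p ⨾ inc-register X ⨾ instance-prog) ⨾ rewind O) (fromList (map bit w) ∷ Vec.replicate 4 blank-tape)
    (prog-cost (length w) + (prog-cost (length w) * 3 + 3)) (output-tapes w)
  exec-prog w = exec-instance w ⨾ relax
    (ℕ.+-monoˡ-≤ 3 (ℕ.*-monoˡ-≤ 3 (ℕ.≤-trans (ℕ.≤-reflexive (List.length-reverse u)) (instance-length w))))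
    (subst (λ u′ → Exec (rewind O) (at-stage beyond cells w u) (length (reverse u) * 3 + 3) (at-stage beyond cells w u [ O ]≔ input u′))
      (List.reverse-involutive u) (rewind-exec (at-stage beyond cells w u) O (reverse u)))
    where
    u : Word
    u = encodeInstance (instance-of w)

  prog-poly : PolyFun prog-cost
  prog-poly = argument ⊠ constant 2 ⊞ constant 7 ⊞ (horner-cost-poly p ⊞ (constant 1 ⊞ Stage.poly instance-stage))

  instance-polynomial-time : PolynomialTime (encodeInstance ∘ instance-of)
  instance-polynomial-time =
    let (q , q≡) = polynomial (prog-poly ⊞ (prog-poly ⊠ constant 3 ⊞ constant 3))
    in machine , q , λ w →
      let (t , t≤ , run≡) = run-exec (exec-prog w)
      in t , ℕ.≤-trans t≤ (ℕ.≤-reflexive (q≡ (length w)))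
           , subst (Halted machine) (sym run≡) (halted-zero (output-tapes w))
           , trans (cong (output machine) run≡) (leadingBits-input (encodeInstance (instance-of w)))
    where
    open Compile ((setup ⨾ horner p ⨾ inc-register X ⨾ instance-prog) ⨾ rewind O)
    leadingBits-input : ∀ u → leadingBits (head (input u) ∷ after (input u)) ≡ u
    leadingBits-input []      = refl
    leadingBits-input (b ∷ u) = cong (b ∷_) (padded u)
      where
      padded : ∀ u → leadingBits {0} (map bit u ++ blank ∷ []) ≡ u
      padded []      = refl
      padded (b ∷ u) = cong (b ∷_) (padded u)

  time-large : ∀ S → globals * contents ^ (3 + S) ≤ time S
  time-large S = ℕ.s≤s⁻¹ (begin
    suc (globals * contents ^ (3 + S))                    ≤⟨ s≤s (ℕ.*-mono-≤ (n≤2^n globals) (ℕ.^-monoˡ-≤ (3 + S) (n≤2^n contents))) ⟩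
    suc (2 ^ globals * (2 ^ contents) ^ (3 + S))          ≡⟨ cong (λ k → suc (2 ^ globals * k))
                                                               (trans (ℕ.^-*-assoc 2 contents (3 + S)) (cong (2 ^_) (ℕ.*-comm contents (3 + S)))) ⟩
    suc (2 ^ globals * 2 ^ ((3 + S) * contents))          ≡⟨ cong suc (sym (ℕ.^-distribˡ-+-* 2 globals ((3 + S) * contents))) ⟩
    suc (2 ^ (globals + (3 + S) * contents))              ≤⟨ ℕ.+-monoˡ-≤ (2 ^ (globals + (3 + S) * contents)) (ℕ.m^n>0 2 (globals + (3 + S) * contents)) ⟩
    2 ^ (globals + (3 + S) * contents) + 2 ^ (globals + (3 + S) * contents)
                                                          ≡⟨ cong (2 ^ (globals + (3 + S) * contents) +_) (sym (ℕ.+-identityʳ _)) ⟩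
    2 ^ exponent S                                        ≡⟨ sym (suc-toℕ-ones (exponent S)) ⟩
    suc (time S)                                          ∎)
    where
    open ℕ.≤-Reasoning
    n≤2^n : ∀ n → n ≤ 2 ^ n
    n≤2^n zero    = z≤n
    n≤2^n (suc n) = ℕ.≤-trans (ℕ.+-mono-≤ (ℕ.m^n>0 2 n) (n≤2^n n)) (ℕ.+-monoʳ-≤ (2 ^ n) (ℕ.m≤m+n (2 ^ n) 0))

-- Correctness of the reduction

theorem8p2 : PSPACE-hard ValOneProblem
theorem8p2 L (M , p , decides) = instance-of , instance-polynomial-time , correct
  where
  open Simulation M
  open Reduction automaton p

  correct : ∀ w → L w ⇔ DecisionProblem.Yes ValOneProblem (instance-of w)
  correct w = ⇔-sym (accepting⇔L ⇔∘ accepts-global (config T₀) ⇔∘ start-ValOne T₀)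
    where
    S T₀ : ℕ
    S = cells (length w)

    space≤S : ∀ t → space M (run M t (init M w)) ≤ S
    space≤S t = ℕ.≤-trans (proj₁ (decides w) t) (ℕ.≤-trans (eval≤register-x p (length w)) (ℕ.n≤1+n _))

    open Halting w S space≤S

    T₀ = time S

    open Layout.Run automaton (register-x p (length w)) (at w) (global ∘ config) (content ∘ config)
      (λ _ → refl) (λ t i → content-beyond (config t) (space≤S t))
      (global-init w) (λ i _ → content-init w i)
      (λ t → trans (cong global (run-suc t (init M w))) (global-advance (config t)))
      (λ t i _ → trans (cong (λ c → content c (suc i)) (run-suc t (init M w))) (content-advance (config t) i))

    accepting⇔L : Accepting M (config T₀) ⇔ L w
    accepting⇔L =
      let (t , halted , accepting⇔) = proj₂ (decides w)
      -- The decision is given at some halting time t without a time bound; T₀ is another halting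
      -- time, and halted configurations of one run coincide.
      in subst (λ c → Accepting M c ⇔ L w) (run-final {t} {T₀} (init M w) halted (halts-by (time-large S) {t} halted)) accepting⇔
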